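{- Let $B$ be a definite quaternion algebra over $\mathbb{Q}$, $R$ an order in $B$, $K$ a quadratic field with a fixed embedding $i:K\hookrightarrow B$, and $O$ an order in $K$ of discriminant $D$. Then the classes of special points for $O$ are in one-to-one correspondence with the $O$-points.
   Context: A left $R$-ideal is a lattice $\mathfrak{a}\subset B$ with $\mathfrak{a}_\ell=R_\ell x_\ell$, $x_\ell\in B_\ell^\times$, for every prime $\ell$; its right order is $R_r(\mathfrak{a})=\{x\in B:\mathfrak{a}x\subseteq\mathfrak{a}\}$. A special point for $O$ is a pair $(\mathfrak{a},\psi)$ where $\mathfrak{a}$ is a left $R$-ideal and $\psi:K\hookrightarrow B$ is an embedding with $R_r(\mathfrak{a})\cap\psi(K)=\psi(O)$. The group $B^\times$ acts on the right on special points by $(\mathfrak{a},\psi)\cdot\alpha=(\mathfrak{a}\alpha,\alpha^{ -1}\psi\alpha)$; the classes of special points are the orbits. Let $\widehat{\mathbb{Z}}=\prod_\ell\mathbb{Z}_\ell$, $\widehat{\mathbb{Q}}=\widehat{\mathbb{Z}}\otimes\mathbb{Q}$, $\widehat{B}=B\otimes\widehat{\mathbb{Q}}$, $\widehat{R}=R\otimes\widehat{\mathbb{Z}}$. Identify $K$ with $i(K)\subset B$. For $x\in\widehat{B}^\times$ put $O_x=K\cap x^{ -1}\widehat{R}x$, an order in $K$, and let $\widehat{N}_O=\{x\in\widehat{B}^\times:O_x=O\}$. The $O$-points are the elements of the double quotient $\widehat{R}^\times\backslash\widehat{N}_O/K^\times$. -}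

module Defs where

open import Algebra.Bundles using (Ring; CommutativeRing; AbelianGroup)
import Algebra.Construct.DirectProduct as DirectProduct
open import Algebra.Morphism.Structures using (module RingMorphisms)
import Algebra.Properties.Ring as RingProperties
import Algebra.Properties.Semiring.Sum as Sum
import Algebra.Solver.Ring.NaturalCoefficients.Default as SemiringSolver
open import Algebra.Structures using (IsRing; IsCommutativeRing)
open import Data.Fin.Base using (Fin; zero; suc)
open import Data.Integer.Base as ℤ using (ℤ; +_)
import Data.Integer.Divisibility.Signed as ℤ
import Data.Integer.Properties as ℤ
open import Data.Integer.Tactic.RingSolver using (solve-∀)
open import Data.Nat.Base as ℕ using (ℕ; zero; suc)
open import Data.Nat.Primality using (Prime)
open import Data.Product.Base using (Σ; ∃; _×_; _,_; proj₁; proj₂)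
open import Data.Rational.Base as ℚ using (ℚ; mkℚ; toℚᵘ)
import Data.Rational.Literals as ℚ using (fromℤ)
import Data.Rational.Properties as ℚ
open import Data.Rational.Unnormalised.Base as ℚᵘ using (ℚᵘ; mkℚᵘ; *≡*)
import Data.Rational.Unnormalised.Properties as ℚᵘ
open import Data.Vec.Functional using (Vector)
open import Function.Base using (_∘_)
open import Level using (0ℓ)
open import Relation.Binary.Bundles using (Setoid)
open import Relation.Binary.PropositionalEquality.Core as ≡ using (_≡_; _≢_)
import Relation.Binary.PropositionalEquality.Properties as ≡
import Relation.Binary.Reasoning.Setoid as SetoidReasoning
open import Relation.Nullary.Negation.Core using (¬_)
open import Relation.Unary using (Pred; _∈_; _∩_; _≐_; U)

------------------------------------------------------------------------

Hom : (R S : Ring 0ℓ 0ℓ) → (Ring.Carrier R → Ring.Carrier S) → Set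
Hom R S = RingMorphisms.IsRingHomomorphism (Ring.rawRing R) (Ring.rawRing S)

module _ (R S : Ring 0ℓ 0ℓ) where
  private
    module R = Ring R
    module S = Ring S
  open RingMorphisms R.rawRing S.rawRing

  abstract
    mkHom : {f : R.Carrier → S.Carrier} →
            (∀ {x y} → x R.≈ y → f x S.≈ f y) →
            (∀ x y → f (x R.+ y) S.≈ f x S.+ f y) →
            (∀ x y → f (x R.* y) S.≈ f x S.* f y) →
            f R.0# S.≈ S.0# → f R.1# S.≈ S.1# →
            (∀ x → f (R.- x) S.≈ S.- f x) → Hom R S f
    mkHom f-cong f-+ f-* f-0 f-1 f-neg = record
      { isSemiringHomomorphism = record
        { isNearSemiringHomomorphism = record
          { +-isMonoidHomomorphism = record
            { isMagmaHomomorphism = record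
              { isRelHomomorphism = record { cong = f-cong }
              ; homo = f-+ }
            ; ε-homo = f-0 }
          ; *-homo = f-* }
        ; 1#-homo = f-1 }
      ; -‿homo = f-neg }

  record Embedding : Set where
    field
      ⟦_⟧                : R.Carrier → S.Carrier
      isRingMonomorphism : IsRingMonomorphism ⟦_⟧
    open IsRingMonomorphism isRingMonomorphism public

abstract
  ∘-hom : (R S T : Ring 0ℓ 0ℓ) {g : Ring.Carrier S → Ring.Carrier T}
            {f : Ring.Carrier R → Ring.Carrier S} →
            Hom S T g → Hom R S f → Hom R T (g ∘ f)
  ∘-hom R S T hg hf = mkHom R T
    (λ eq → G.⟦⟧-cong (F.⟦⟧-cong eq))
    (λ x y → T.trans (G.⟦⟧-cong (F.+-homo x y)) (G.+-homo _ _))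
    (λ x y → T.trans (G.⟦⟧-cong (F.*-homo x y)) (G.*-homo _ _))
    (T.trans (G.⟦⟧-cong F.0#-homo) G.0#-homo)
    (T.trans (G.⟦⟧-cong F.1#-homo) G.1#-homo)
    (λ x → T.trans (G.⟦⟧-cong (F.-‿homo x)) (G.-‿homo _))
    where
    module T = Ring T
    module F = RingMorphisms.IsRingHomomorphism hf
    module G = RingMorphisms.IsRingHomomorphism hg

record Unit (R : Ring 0ℓ 0ℓ) : Set where
  open Ring R
  field
    value inv : Carrier
    inverseˡ  : inv * value ≈ 1#
    inverseʳ  : value * inv ≈ 1#

module _ (R : Ring 0ℓ 0ℓ) where
  open Ring R
  open Unit
  open SetoidReasoning setoid

  private
    cancel-middle : ∀ x y z w → y * z ≈ 1# → (x * y) * (z * w) ≈ x * w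
    cancel-middle x y z w eq = begin
      (x * y) * (z * w) ≈⟨ *-assoc x y (z * w) ⟩
      x * (y * (z * w)) ≈⟨ *-congˡ (*-assoc y z w) ⟨
      x * ((y * z) * w) ≈⟨ *-congˡ (*-congʳ eq) ⟩
      x * (1# * w)      ≈⟨ *-congˡ (*-identityˡ w) ⟩
      x * w             ∎

  1ᵘ : Unit R
  1ᵘ = record { value = 1# ; inv = 1#
              ; inverseˡ = *-identityˡ 1# ; inverseʳ = *-identityˡ 1# }

  _⁻¹ᵘ : Unit R → Unit R
  u ⁻¹ᵘ = record { value = inv u ; inv = value u
                 ; inverseˡ = inverseʳ u ; inverseʳ = inverseˡ u }

  _*ᵘ_ : Unit R → Unit R → Unit R
  u *ᵘ v = record
    { value = value u * value v
    ; inv   = inv v * inv u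
    ; inverseˡ = trans (cancel-middle _ _ _ _ (inverseˡ u)) (inverseˡ v)
    ; inverseʳ = trans (cancel-middle _ _ _ _ (inverseʳ v)) (inverseʳ u) }

module UnitProperties (R : Ring 0ℓ 0ℓ) where
  open Ring R
  open Unit
  open SetoidReasoning setoid

  cancelʳ : ∀ x {u v} → u * v ≈ 1# → x ≈ (x * u) * v
  cancelʳ x {u} {v} eq = sym (begin
    (x * u) * v ≈⟨ *-assoc x u v ⟩
    x * (u * v) ≈⟨ *-congˡ eq ⟩
    x * 1#      ≈⟨ *-identityʳ x ⟩
    x           ∎)

  cancelˡ : ∀ x {u v} → u * v ≈ 1# → u * (v * x) ≈ x
  cancelˡ x {u} {v} eq = trans (sym (*-assoc u v x)) (trans (*-congʳ eq) (*-identityˡ x))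

  double-refl : ∀ x {v} → v ≈ 1# → x ≈ 1# * x * v
  double-refl x {v} eq = sym (trans (*-cong (*-identityˡ x) eq) (*-identityʳ x))

  double-sym : ∀ {x y u u′ v v′} → u′ * u ≈ 1# → v * v′ ≈ 1# →
               y ≈ u * x * v → x ≈ u′ * y * v′
  double-sym {x} {y} {u} {u′} {v} {v′} eq eq′ p = sym (begin
    u′ * y * v′               ≈⟨ *-congʳ (*-congˡ p) ⟩
    u′ * (u * x * v) * v′     ≈⟨ *-congʳ (*-assoc u′ (u * x) v) ⟨
    u′ * (u * x) * v * v′     ≈⟨ cancelʳ (u′ * (u * x)) eq′ ⟨
    u′ * (u * x)              ≈⟨ cancelˡ x eq ⟩
    x                         ∎)

  double-trans : ∀ {x y z u u′ v v′ w} → w ≈ v * v′ →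
                 y ≈ u * x * v → z ≈ u′ * y * v′ → z ≈ (u′ * u) * x * w
  double-trans {x} {y} {z} {u} {u′} {v} {v′} {w} eq p q = begin
    z                         ≈⟨ q ⟩
    u′ * y * v′               ≈⟨ *-congʳ (*-congˡ p) ⟩
    u′ * (u * x * v) * v′     ≈⟨ *-congʳ (*-assoc u′ (u * x) v) ⟨
    u′ * (u * x) * v * v′     ≈⟨ *-assoc (u′ * (u * x)) v v′ ⟩
    u′ * (u * x) * (v * v′)   ≈⟨ *-cong (*-assoc u′ u x) eq ⟨
    (u′ * u) * x * w          ∎

Image : {X : Set} (S : Setoid 0ℓ 0ℓ) → (X → Setoid.Carrier S) →
        Pred X 0ℓ → Pred (Setoid.Carrier S) 0ℓ
Image S f P v = ∃ λ u → u ∈ P × Setoid._≈_ S v (f u)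

------------------------------------------------------------------------

record Algebra (S : CommutativeRing 0ℓ 0ℓ) : Set₁ where
  private module S = CommutativeRing S
  field
    ring : Ring 0ℓ 0ℓ
  open Ring ring public
  field
    scalar         : S.Carrier → Carrier
    scalar-hom     : Hom S.ring ring scalar
    scalar-central : ∀ s x → scalar s * x ≈ x * scalar s
  module scalar = RingMorphisms.IsRingHomomorphism scalar-hom

restrict : {S T : CommutativeRing 0ℓ 0ℓ}
           (f : CommutativeRing.Carrier S → CommutativeRing.Carrier T) →
           Hom (CommutativeRing.ring S) (CommutativeRing.ring T) f →
           Algebra T → Algebra S
restrict {S} {T} f f-hom V = record
  { ring           = ring
  ; scalar         = scalar ∘ f
  ; scalar-hom     = ∘-hom (CommutativeRing.ring S) (CommutativeRing.ring T) ring scalar-hom f-hom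
  ; scalar-central = λ s → scalar-central (f s) }
  where open Algebra V

module _ {S : CommutativeRing 0ℓ 0ℓ} (V : Algebra S) where
  private module S = CommutativeRing S
  open Algebra V
  open Sum semiring

  Span : {n : ℕ} → Vector Carrier n → Pred Carrier 0ℓ
  Span {n} g v = ∃ λ (c : Vector S.Carrier n) → v ≈ ∑[ i < n ] (scalar (c i) * g i)

module SpanProperties {S : CommutativeRing 0ℓ 0ℓ} (V : Algebra S) where
  private module S = CommutativeRing S
  open Algebra V hiding (zero)
  open Sum semiring
  open SetoidReasoning setoid

  span-resp : ∀ {n} {g : Vector Carrier n} {x y} → x ≈ y → Span V g x → Span V g y
  span-resp eq (c , p) = c , trans (sym eq) p

  span-0 : ∀ {n} (g : Vector Carrier n) → Span V g 0#
  span-0 {n} g = (λ _ → S.0#) , sym (begin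
    ∑[ i < n ] (scalar S.0# * g i) ≈⟨ sum-cong-≋ {n} (λ i → trans (*-congʳ scalar.0#-homo) (zeroˡ (g i))) ⟩
    ∑[ i < n ] 0#                  ≈⟨ sum-replicate-zero n ⟩
    0#                             ∎)

  span-+ : ∀ {n} {g : Vector Carrier n} {x y} →
           Span V g x → Span V g y → Span V g (x + y)
  span-+ {n} {g} {x} {y} (c , p) (d , q) = (λ i → c i S.+ d i) , (begin
    x + y ≈⟨ +-cong p q ⟩
    (∑[ i < n ] (scalar (c i) * g i)) + (∑[ i < n ] (scalar (d i) * g i)) 
      ≈⟨ ∑-distrib-+ (λ i → scalar (c i) * g i) (λ i → scalar (d i) * g i) ⟨
    ∑[ i < n ] (scalar (c i) * g i + scalar (d i) * g i)
      ≈⟨ sum-cong-≋ {n} (λ i → trans (sym (distribʳ (g i) _ _)) (*-congʳ (sym (scalar.+-homo (c i) (d i))))) ⟩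
    ∑[ i < n ] (scalar (c i S.+ d i) * g i) ∎)

  span-generator : ∀ {n} {g : Vector Carrier n} i → Span V g (g i)
  span-generator {g = g} zero =
    (λ { zero → S.1# ; (suc _) → S.0# }) , sym (begin
      scalar S.1# * g zero + ∑[ j < _ ] (scalar S.0# * g (suc j))
        ≈⟨ +-cong (trans (*-congʳ scalar.1#-homo) (*-identityˡ _)) (sym (proj₂ (span-0 (g ∘ suc)))) ⟩
      g zero + 0# ≈⟨ +-identityʳ _ ⟩
      g zero      ∎)
  span-generator {g = g} (suc i) with span-generator {g = g ∘ suc} i
  ... | c , p = (λ { zero → S.0# ; (suc j) → c j }) , trans p
    (sym (trans (+-congʳ (trans (*-congʳ scalar.0#-homo) (zeroˡ _))) (+-identityˡ _)))

  span-scale : ∀ {n} {g : Vector Carrier n} s {x} → Span V g x → Span V g (scalar s * x)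
  span-scale {n} {g} s {x} (c , p) = (λ i → s S.* c i) , (begin
    scalar s * x                                  ≈⟨ *-congˡ p ⟩
    scalar s * ∑[ i < n ] (scalar (c i) * g i)    ≈⟨ *-distribˡ-sum (scalar s) (λ i → scalar (c i) * g i) ⟩
    ∑[ i < n ] (scalar s * (scalar (c i) * g i))
      ≈⟨ sum-cong-≋ {n} (λ i → trans (sym (*-assoc _ _ _)) (*-congʳ (sym (scalar.*-homo s (c i))))) ⟩
    ∑[ i < n ] (scalar (s S.* c i) * g i)         ∎)

  span-sum : ∀ {n m} {g : Vector Carrier n} (v : Vector Carrier m) →
             (∀ i → Span V g (v i)) → Span V g (sum v)
  span-sum {m = zero}  v p = span-0 _
  span-sum {m = suc m} v p = span-+ (p zero) (span-sum (v ∘ suc) (p ∘ suc))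

  span-* : ∀ {n} {g : Vector Carrier n} → (∀ i j → Span V g (g i * g j)) →
           ∀ {x y} → Span V g x → Span V g y → Span V g (x * y)
  span-* {n} {g} closed {x} {y} (c , p) (d , q) =
    span-resp (sym x*y≈) (span-sum _ λ i → span-scale (c i)
      (span-sum _ λ j → span-scale (d j) (closed i j)))
    where
    x*y≈ : x * y ≈ ∑[ i < n ] (scalar (c i) * ∑[ j < n ] (scalar (d j) * (g i * g j)))
    x*y≈ = begin
      x * y                                                  ≈⟨ *-cong p q ⟩
      (∑[ i < n ] (scalar (c i) * g i)) * (∑[ j < n ] (scalar (d j) * g j))
        ≈⟨ *-distribʳ-sum _ (λ i → scalar (c i) * g i) ⟩
      ∑[ i < n ] (scalar (c i) * g i * ∑[ j < n ] (scalar (d j) * g j))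
        ≈⟨ sum-cong-≋ {n} (λ i → trans (*-assoc _ _ _) (*-congˡ (trans (*-distribˡ-sum (g i) (λ j → scalar (d j) * g j))
             (sum-cong-≋ {n} (λ j → swap (d j) (g i) (g j)))))) ⟩
      ∑[ i < n ] (scalar (c i) * ∑[ j < n ] (scalar (d j) * (g i * g j))) ∎
      where
      swap : ∀ s u w → u * (scalar s * w) ≈ scalar s * (u * w)
      swap s u w = begin
        u * (scalar s * w) ≈⟨ *-assoc _ _ _ ⟨
        u * scalar s * w   ≈⟨ *-congʳ (scalar-central s u) ⟨
        scalar s * u * w   ≈⟨ *-assoc _ _ _ ⟩
        scalar s * (u * w) ∎

------------------------------------------------------------------------
-- S[√d]: the pair (x , y) is x + y√d

module Quadratic (S : CommutativeRing 0ℓ 0ℓ) (d : CommutativeRing.Carrier S) where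
  private module S = CommutativeRing S
  open S using (_+_; _*_; -_; _-_; 0#; 1#)
  open RingProperties S.ring
  open SemiringSolver S.commutativeSemiring

  private
    +-group : AbelianGroup 0ℓ 0ℓ
    +-group = DirectProduct.abelianGroup S.+-abelianGroup S.+-abelianGroup

  open AbelianGroup +-group using (_≈_) renaming (Carrier to L; _∙_ to _⊕_)

  _·_ : L → L → L
  (x , y) · (z , w) = x * z + d * (y * w) , x * w + y * z

  abstract
    isCommutativeRing : IsCommutativeRing _≈_ _⊕_ _·_ (AbelianGroup._⁻¹ +-group) (0# , 0#) (1# , 0#)
    isCommutativeRing = record
      { isRing = record
        { +-isAbelianGroup = AbelianGroup.isAbelianGroup +-group
        ; *-cong = λ (p , q) (r , s) →
            S.+-cong (S.*-cong p r) (S.*-congˡ (S.*-cong q s)) ,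
            S.+-cong (S.*-cong p s) (S.*-cong q r)
        ; *-assoc = λ (x , y) (z , w) (s , t) →
            solve 7 (λ d x y z w s t →
              (x :* z :+ d :* (y :* w)) :* s :+ d :* ((x :* w :+ y :* z) :* t) :=
              x :* (z :* s :+ d :* (w :* t)) :+ d :* (y :* (z :* t :+ w :* s)))
              S.refl d x y z w s t ,
            solve 7 (λ d x y z w s t →
              (x :* z :+ d :* (y :* w)) :* t :+ (x :* w :+ y :* z) :* s :=
              x :* (z :* t :+ w :* s) :+ y :* (z :* s :+ d :* (w :* t)))
              S.refl d x y z w s t
        ; *-identity = identityˡ , λ x → S.trans (proj₁ (comm x (1# , 0#))) (proj₁ (identityˡ x)) ,
                                         S.trans (proj₂ (comm x (1# , 0#))) (proj₂ (identityˡ x))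
        ; distrib =
            (λ (x , y) (z , w) (s , t) →
              solve 7 (λ d x y z w s t →
                x :* (z :+ s) :+ d :* (y :* (w :+ t)) :=
                (x :* z :+ d :* (y :* w)) :+ (x :* s :+ d :* (y :* t)))
                S.refl d x y z w s t ,
              solve 6 (λ x y z w s t →
                x :* (w :+ t) :+ y :* (z :+ s) :=
                (x :* w :+ y :* z) :+ (x :* t :+ y :* s))
                S.refl x y z w s t) ,
            (λ (x , y) (z , w) (s , t) →
              solve 7 (λ d x y z w s t →
                (z :+ s) :* x :+ d :* ((w :+ t) :* y) :=
                (z :* x :+ d :* (w :* y)) :+ (s :* x :+ d :* (t :* y)))
                S.refl d x y z w s t ,
              solve 6 (λ x y z w s t →
                (z :+ s) :* y :+ (w :+ t) :* x :=
                (z :* y :+ w :* x) :+ (s :* y :+ t :* x))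
                S.refl x y z w s t)
        }
      ; *-comm = comm
      }
      where
      comm : ∀ u v → (u · v) ≈ (v · u)
      comm (x , y) (z , w) =
        S.+-cong (S.*-comm x z) (S.*-congˡ (S.*-comm y w)) ,
        S.trans (S.+-comm (x * w) (y * z)) (S.+-cong (S.*-comm y z) (S.*-comm x w))
      identityˡ : ∀ u → ((1# , 0#) · u) ≈ u
      identityˡ (x , y) =
        S.trans (S.+-cong (S.*-identityˡ x) (S.trans (S.*-congˡ (S.zeroˡ y)) (S.zeroʳ d))) (S.+-identityʳ x) ,
        S.trans (S.+-cong (S.*-identityˡ y) (S.zeroˡ x)) (S.+-identityʳ y)

  commutativeRing : CommutativeRing 0ℓ 0ℓ
  commutativeRing = record
    { Carrier = L
    ; _≈_ = _≈_
    ; _+_ = _⊕_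
    ; _*_ = _·_
    ; -_  = AbelianGroup._⁻¹ +-group
    ; 0#  = 0# , 0#
    ; 1#  = 1# , 0#
    ; isCommutativeRing = isCommutativeRing
    }

  open CommutativeRing commutativeRing public using (ring)

  conj : L → L
  conj (x , y) = x , - y

  norm trace : L → S.Carrier
  norm  (x , y) = x * x - d * (y * y)
  trace (x , y) = x + x

  conj-hom : Hom ring ring conj
  conj-hom = mkHom ring ring
    (λ (p , q) → p , S.-‿cong q)
    (λ (x , y) (z , w) → S.refl , S.sym (-‿+-comm y w))
    (λ (x , y) (z , w) →
      S.+-congˡ (S.*-congˡ (S.sym (S.trans (S.sym (-‿distribˡ-* y (- w)))
        (S.trans (S.-‿cong (S.sym (-‿distribʳ-* y w))) (-‿involutive _))))) ,
      S.trans (S.sym (-‿+-comm (x * w) (y * z)))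
        (S.+-cong (-‿distribʳ-* x w) (-‿distribˡ-* y z)))
    (S.refl , -0#≈0#) (S.refl , -0#≈0#)
    (λ _ → S.refl , S.refl)

  abstract
    conj-involutive : ∀ u → conj (conj u) ≈ u
    conj-involutive (x , y) = S.refl , -‿involutive y

  fromS : S.Carrier → L
  fromS x = x , 0#

  fromS-hom : Hom S.ring ring fromS
  fromS-hom = mkHom S.ring ring
    (λ p → p , S.refl)
    (λ x y → S.refl , S.sym (S.+-identityʳ 0#))
    (λ x y → S.sym (S.trans (S.+-congˡ (S.trans (S.*-congˡ (S.zeroˡ 0#)) (S.zeroʳ d))) (S.+-identityʳ _)) ,
             S.sym (S.trans (S.+-cong (S.zeroʳ x) (S.zeroˡ y)) (S.+-identityʳ 0#)))
    (S.refl , S.refl) (S.refl , S.refl)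
    (λ x → S.refl , S.sym -0#≈0#)

  abstract
    conj-fromS : ∀ x → conj (fromS x) ≈ fromS x
    conj-fromS x = S.refl , -0#≈0#

  asAlgebra : Algebra S
  asAlgebra = record
    { ring = ring ; scalar = fromS ; scalar-hom = fromS-hom
    ; scalar-central = λ s → CommutativeRing.*-comm commutativeRing (fromS s) }

module QuadraticMap
  (S T : CommutativeRing 0ℓ 0ℓ)
  (f : CommutativeRing.Carrier S → CommutativeRing.Carrier T)
  (f-hom : Hom (CommutativeRing.ring S) (CommutativeRing.ring T) f)
  (d : CommutativeRing.Carrier S) where
  private
    module S = CommutativeRing S
    module T = CommutativeRing T
    module F = RingMorphisms.IsRingHomomorphism f-hom
    module QS = Quadratic S d
    module QT = Quadratic T (f d)

  map : S.Carrier × S.Carrier → T.Carrier × T.Carrier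
  map (x , y) = f x , f y

  map-hom : Hom QS.ring QT.ring map
  map-hom = mkHom QS.ring QT.ring
    (λ (p , q) → F.⟦⟧-cong p , F.⟦⟧-cong q)
    (λ _ _ → F.+-homo _ _ , F.+-homo _ _)
    (λ _ _ → T.trans (F.+-homo _ _) (T.+-cong (F.*-homo _ _)
               (T.trans (F.*-homo _ _) (T.*-congˡ (F.*-homo _ _)))) ,
             T.trans (F.+-homo _ _) (T.+-cong (F.*-homo _ _) (F.*-homo _ _)))
    (F.0#-homo , F.0#-homo) (F.1#-homo , F.0#-homo)
    (λ _ → F.-‿homo _ , F.-‿homo _)

  abstract
    map-conj : ∀ u → CommutativeRing._≈_ QT.commutativeRing (map (QS.conj u)) (QT.conj (map u))
    map-conj _ = T.refl , F.-‿homo _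

------------------------------------------------------------------------
-- L ⊕ Lj with j u = σ(u) j and j² = β: the pair (u , v) is u + vj

module CrossedProduct
  (L : CommutativeRing 0ℓ 0ℓ)
  (σ : CommutativeRing.Carrier L → CommutativeRing.Carrier L)
  (σ-hom : Hom (CommutativeRing.ring L) (CommutativeRing.ring L) σ)
  (σ-involutive : ∀ u → CommutativeRing._≈_ L (σ (σ u)) u)
  (β : CommutativeRing.Carrier L)
  (σ-β : CommutativeRing._≈_ L (σ β) β) where

  private
    module L = CommutativeRing L
    module σ = RingMorphisms.IsRingHomomorphism σ-hom
    +-group : AbelianGroup 0ℓ 0ℓ
    +-group = DirectProduct.abelianGroup L.+-abelianGroup L.+-abelianGroup

  open L using (_+_; _*_; 0#; 1#)
  open SemiringSolver L.commutativeSemiring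
  open AbelianGroup +-group using (_≈_) renaming (Carrier to Q; _∙_ to _⊕_)

  _·_ : Q → Q → Q
  (u , v) · (w , z) = u * w + β * (v * σ z) , u * z + v * σ w

  private
    σ-1 : ∀ {z w s t} → σ (z * s + w * t) L.≈ σ z * σ s + σ w * σ t
    σ-1 = L.trans (σ.+-homo _ _) (L.+-cong (σ.*-homo _ _) (σ.*-homo _ _))

    σ-fst : ∀ w s z t → σ (w * s + β * (z * σ t)) L.≈ σ w * σ s + β * (σ z * t)
    σ-fst w s z t = L.trans σ-1 (L.+-congˡ (L.*-cong σ-β
      (L.trans (σ.*-homo _ _) (L.*-congˡ (σ-involutive t)))))

    σ-snd : ∀ w t z s → σ (w * t + z * σ s) L.≈ σ w * σ t + σ z * s
    σ-snd w t z s = L.trans σ-1 (L.+-congˡ (L.*-congˡ (σ-involutive s)))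

  abstract
    isRing : IsRing _≈_ _⊕_ _·_ (AbelianGroup._⁻¹ +-group) (0# , 0#) (1# , 0#)
    isRing = record
      { +-isAbelianGroup = AbelianGroup.isAbelianGroup +-group
      ; *-cong = λ (p , q) (r , s) →
          L.+-cong (L.*-cong p r) (L.*-congˡ (L.*-cong q (σ.⟦⟧-cong s))) ,
          L.+-cong (L.*-cong p s) (L.*-cong q (σ.⟦⟧-cong r))
      ; *-assoc = λ (u , v) (w , z) (s , t) →
          L.trans
            (solve 9 (λ β u v w z s t′ w′ z′ →
              (u :* w :+ β :* (v :* z′)) :* s :+ β :* ((u :* z :+ v :* w′) :* t′) :=
              u :* (w :* s :+ β :* (z :* t′)) :+ β :* (v :* (w′ :* t′ :+ z′ :* s)))
              L.refl β u v w z s (σ t) (σ w) (σ z))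
            (L.+-congˡ (L.*-congˡ (L.*-congˡ (L.sym (σ-snd w t z s))))) ,
          L.trans
            (solve 9 (λ β u v w z t s′ w′ z′ →
              (u :* w :+ β :* (v :* z′)) :* t :+ (u :* z :+ v :* w′) :* s′ :=
              u :* (w :* t :+ z :* s′) :+ v :* (w′ :* s′ :+ β :* (z′ :* t)))
              L.refl β u v w z t (σ s) (σ w) (σ z))
            (L.+-congˡ (L.*-congˡ (L.sym (σ-fst w s z t))))
      ; *-identity =
          (λ (u , v) →
            L.trans (L.+-cong (L.*-identityˡ u) (L.trans (L.*-congˡ (L.zeroˡ _)) (L.zeroʳ β))) (L.+-identityʳ u) ,
            L.trans (L.+-cong (L.*-identityˡ v) (L.zeroˡ _)) (L.+-identityʳ v)) ,
          (λ (u , v) →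
            L.trans (L.+-cong (L.*-identityʳ u)
              (L.trans (L.*-congˡ (L.trans (L.*-congˡ σ.0#-homo) (L.zeroʳ v))) (L.zeroʳ β))) (L.+-identityʳ u) ,
            L.trans (L.+-cong (L.zeroʳ u) (L.trans (L.*-congˡ σ.1#-homo) (L.*-identityʳ v))) (L.+-identityˡ v))
      ; distrib =
          (λ (u , v) (w , z) (s , t) →
            L.trans (L.+-congˡ (L.*-congˡ (L.*-congˡ (σ.+-homo z t))))
              (solve 7 (λ β u v w z′ s t′ →
                u :* (w :+ s) :+ β :* (v :* (z′ :+ t′)) :=
                (u :* w :+ β :* (v :* z′)) :+ (u :* s :+ β :* (v :* t′)))
                L.refl β u v w (σ z) s (σ t)) ,
            L.trans (L.+-congˡ (L.*-congˡ (σ.+-homo w s)))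
              (solve 6 (λ u v z w′ t s′ →
                u :* (z :+ t) :+ v :* (w′ :+ s′) :=
                (u :* z :+ v :* w′) :+ (u :* t :+ v :* s′))
                L.refl u v z (σ w) t (σ s))) ,
          (λ (u , v) (w , z) (s , t) →
            solve 7 (λ β u v′ w z s t →
              (w :+ s) :* u :+ β :* ((z :+ t) :* v′) :=
              (w :* u :+ β :* (z :* v′)) :+ (s :* u :+ β :* (t :* v′)))
              L.refl β u (σ v) w z s t ,
            solve 6 (λ v u′ w z s t →
              (w :+ s) :* v :+ (z :+ t) :* u′ :=
              (w :* v :+ z :* u′) :+ (s :* v :+ t :* u′))
              L.refl v (σ u) w z s t)
      }

  ring : Ring 0ℓ 0ℓ
  ring = record
    { Carrier = Q
    ; _≈_ = _≈_
    ; _+_ = _⊕_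
    ; _*_ = _·_
    ; -_  = AbelianGroup._⁻¹ +-group
    ; 0#  = 0# , 0#
    ; 1#  = 1# , 0#
    ; isRing = isRing
    }

  fromL : L.Carrier → Q
  fromL u = u , 0#

  fromL-hom : Hom L.ring ring fromL
  fromL-hom = mkHom L.ring ring
    (λ p → p , L.refl)
    (λ _ _ → L.refl , L.sym (L.+-identityʳ 0#))
    (λ u w → L.sym (L.trans (L.+-congˡ (L.trans (L.*-congˡ (L.zeroˡ _)) (L.zeroʳ β))) (L.+-identityʳ _)) ,
             L.sym (L.trans (L.+-cong (L.zeroʳ u) (L.zeroˡ _)) (L.+-identityʳ 0#)))
    (L.refl , L.refl) (L.refl , L.refl)
    (λ _ → L.refl , L.sym (RingProperties.-0#≈0# L.ring))

  abstract
    fromL-central : ∀ s → σ s L.≈ s → ∀ x → (fromL s · x) ≈ (x · fromL s)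
    fromL-central s fix (w , z) =
      L.+-cong (L.*-comm s w)
        (L.*-congˡ (L.trans (L.zeroˡ _) (L.sym (L.trans (L.*-congˡ σ.0#-homo) (L.zeroʳ z))))) ,
      L.trans (L.+-cong (L.*-comm s z) (L.zeroˡ _))
        (L.trans (L.+-comm _ _) (L.+-cong (L.sym (L.zeroʳ w)) (L.*-congˡ (L.sym fix))))

------------------------------------------------------------------------
-- The quaternion algebra (a , b / S), with basis 1, i, j, ij and relations
-- i² = a, j² = b, ji = - ij, presented as S[i] ⊕ S[i]j:
-- ((x , y) , (z , w)) is x + yi + zj + w(ij).

module Quaternion (S : CommutativeRing 0ℓ 0ℓ) (a b : CommutativeRing.Carrier S) where
  private
    module S = CommutativeRing S
    module L = Quadratic S a

  open CrossedProduct L.commutativeRing L.conj L.conj-hom L.conj-involutive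
    (L.fromS b) (L.conj-fromS b) public using (ring; fromL; fromL-hom; fromL-central)

  algebra : Algebra S
  algebra = record
    { ring           = ring
    ; scalar         = fromL ∘ L.fromS
    ; scalar-hom     = ∘-hom S.ring L.ring ring fromL-hom L.fromS-hom
    ; scalar-central = λ s → fromL-central (L.fromS s) (L.conj-fromS s) }

  reducedNorm : Ring.Carrier ring → S.Carrier
  reducedNorm (u , v) = L.norm u S.- b S.* L.norm v

module QuaternionMap
  (S T : CommutativeRing 0ℓ 0ℓ)
  (f : CommutativeRing.Carrier S → CommutativeRing.Carrier T)
  (f-hom : Hom (CommutativeRing.ring S) (CommutativeRing.ring T) f)
  (a b : CommutativeRing.Carrier S) where
  private
    module T = CommutativeRing T
    module F = RingMorphisms.IsRingHomomorphism f-hom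
    module QS = Quaternion S a b
    module QT = Quaternion T (f a) (f b)
    module M = QuadraticMap S T f f-hom a
    module LT = CommutativeRing (Quadratic.commutativeRing T (f a))
    module MH = RingMorphisms.IsRingHomomorphism M.map-hom

  map : Ring.Carrier QS.ring → Ring.Carrier QT.ring
  map (u , v) = M.map u , M.map v

  map-hom : Hom QS.ring QT.ring map
  map-hom = mkHom QS.ring QT.ring
    (λ (p , q) → MH.⟦⟧-cong p , MH.⟦⟧-cong q)
    (λ _ _ → MH.+-homo _ _ , MH.+-homo _ _)
    (λ (u , v) (w , z) →
      LT.trans (MH.+-homo _ _) (LT.+-cong (MH.*-homo _ _)
        (LT.trans (MH.*-homo _ _) (LT.*-cong (T.refl , F.0#-homo)
          (LT.trans (MH.*-homo _ _) (LT.*-congˡ {M.map v} (M.map-conj z)))))) ,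
      LT.trans (MH.+-homo _ _) (LT.+-cong (MH.*-homo _ _)
        (LT.trans (MH.*-homo _ _) (LT.*-congˡ {M.map v} (M.map-conj w)))))
    (MH.0#-homo , MH.0#-homo) (MH.1#-homo , MH.0#-homo)
    (λ _ → MH.-‿homo _ , MH.-‿homo _)

  map-scalar : ∀ s → Ring._≈_ QT.ring (map (Algebra.scalar QS.algebra s))
                                      (Algebra.scalar QT.algebra (f s))
  map-scalar s = (T.refl , F.0#-homo) , (F.0#-homo , F.0#-homo)

------------------------------------------------------------------------
-- A ⊗ ℚ for a commutative ring A with structure map ι : ℤ → A

module Rationalisation
  (A : CommutativeRing 0ℓ 0ℓ)
  (ι : ℤ → CommutativeRing.Carrier A)
  (ι-hom : Hom (CommutativeRing.ring ℤ.+-*-commutativeRing) (CommutativeRing.ring A) ι) where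

  private
    module A = CommutativeRing A
    module ι = RingMorphisms.IsRingHomomorphism ι-hom
  open A using (_+_; _*_; -_; 0#; 1#)
  open SemiringSolver A.commutativeSemiring
  open SetoidReasoning A.setoid

  record Fraction : Set where
    constructor mkFraction
    field
      numerator     : A.Carrier
      denominator-1 : ℕ

  D : ℕ → A.Carrier
  D n = ι (+ suc n)

  -- suc (m ⊛ n) is suc m * suc n.
  _⊛_ : ℕ → ℕ → ℕ
  m ⊛ n = n ℕ.+ m ℕ.* suc n

  -- A is not assumed to be ℤ-torsion-free, hence the extra factor.
  record _≃_ (f g : Fraction) : Set where
    constructor equal
    private
      module f = Fraction f
      module g = Fraction g
    field
      factor : ℕ
      cross  : D factor * (f.numerator * D g.denominator-1) A.≈
               D factor * (g.numerator * D f.denominator-1)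

  private
    D-* : ∀ m n → D (m ⊛ n) A.≈ D m * D n
    D-* m n = ι.*-homo (+ suc m) (+ suc n)

    D-*₃ : ∀ k m n → D (k ⊛ (m ⊛ n)) A.≈ D k * (D m * D n)
    D-*₃ k m n = A.trans (D-* k (m ⊛ n)) (A.*-congˡ (D-* m n))

    D-*₃′ : ∀ k m n → D ((k ⊛ m) ⊛ n) A.≈ (D k * D m) * D n
    D-*₃′ k m n = A.trans (D-* (k ⊛ m) n) (A.*-congʳ (D-* k m))

    cross : ∀ {x m y n} → x * D n A.≈ y * D m → mkFraction x m ≃ mkFraction y n
    cross eq = equal 0 (A.*-congˡ eq)

    ≃-refl : ∀ {f} → f ≃ f
    ≃-refl = cross A.refl

    ≃-sym : ∀ {f g} → f ≃ g → g ≃ f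
    ≃-sym (equal k p) = equal k (A.sym p)

    ≃-trans : ∀ {f g h} → f ≃ g → g ≃ h → f ≃ h
    ≃-trans {mkFraction x m} {mkFraction y n} {mkFraction z o} (equal k p) (equal l q) =
      equal (k ⊛ (l ⊛ n)) (begin
        D (k ⊛ (l ⊛ n)) * (x * D o)       ≈⟨ A.*-congʳ (D-*₃ k l n) ⟩
        D k * (D l * D n) * (x * D o)
          ≈⟨ solve 5 (λ k l n x o → k :* (l :* n) :* (x :* o) := l :* o :* (k :* (x :* n)))
               A.refl (D k) (D l) (D n) x (D o) ⟩
        D l * D o * (D k * (x * D n))     ≈⟨ A.*-congˡ p ⟩
        D l * D o * (D k * (y * D m))
          ≈⟨ solve 5 (λ k l m y o → l :* o :* (k :* (y :* m)) := k :* m :* (l :* (y :* o)))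
               A.refl (D k) (D l) (D m) y (D o) ⟩
        D k * D m * (D l * (y * D o))     ≈⟨ A.*-congˡ q ⟩
        D k * D m * (D l * (z * D n))
          ≈⟨ solve 5 (λ k l m z n → k :* m :* (l :* (z :* n)) := k :* (l :* n) :* (z :* m))
               A.refl (D k) (D l) (D m) z (D n) ⟩
        D k * (D l * D n) * (z * D m)     ≈⟨ A.*-congʳ (D-*₃ k l n) ⟨
        D (k ⊛ (l ⊛ n)) * (z * D m)       ∎)

  0ᶠ 1ᶠ : Fraction
  0ᶠ = mkFraction 0# 0
  1ᶠ = mkFraction 1# 0

  _+ᶠ_ _*ᶠ_ : Fraction → Fraction → Fraction
  mkFraction x m +ᶠ mkFraction y n = mkFraction (x * D n + y * D m) (m ⊛ n)
  mkFraction x m *ᶠ mkFraction y n = mkFraction (x * y) (m ⊛ n)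

  -ᶠ_ : Fraction → Fraction
  -ᶠ mkFraction x m = mkFraction (- x) m

  private
    +-cong : ∀ {f f′ g g′} → f ≃ f′ → g ≃ g′ → (f +ᶠ g) ≃ (f′ +ᶠ g′)
    +-cong {mkFraction x m} {mkFraction x′ m′} {mkFraction y n} {mkFraction y′ n′} (equal k p) (equal l q) =
      equal (k ⊛ l) (begin
        D (k ⊛ l) * ((x * D n + y * D m) * D (m′ ⊛ n′))
          ≈⟨ A.*-cong (D-* k l) (A.*-congˡ (D-* m′ n′)) ⟩
        D k * D l * ((x * D n + y * D m) * (D m′ * D n′))
          ≈⟨ solve 8 (λ k l x y m n m′ n′ →
               k :* l :* ((x :* n :+ y :* m) :* (m′ :* n′)) :=
               l :* n :* n′ :* (k :* (x :* m′)) :+ k :* m :* m′ :* (l :* (y :* n′)))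
               A.refl (D k) (D l) x y (D m) (D n) (D m′) (D n′) ⟩
        D l * D n * D n′ * (D k * (x * D m′)) + D k * D m * D m′ * (D l * (y * D n′))
          ≈⟨ A.+-cong (A.*-congˡ p) (A.*-congˡ q) ⟩
        D l * D n * D n′ * (D k * (x′ * D m)) + D k * D m * D m′ * (D l * (y′ * D n))
          ≈⟨ solve 8 (λ k l x y m n m′ n′ →
               l :* n :* n′ :* (k :* (x :* m)) :+ k :* m :* m′ :* (l :* (y :* n)) :=
               k :* l :* ((x :* n′ :+ y :* m′) :* (m :* n)))
               A.refl (D k) (D l) x′ y′ (D m) (D n) (D m′) (D n′) ⟩
        D k * D l * ((x′ * D n′ + y′ * D m′) * (D m * D n))
          ≈⟨ A.*-cong (D-* k l) (A.*-congˡ (D-* m n)) ⟨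
        D (k ⊛ l) * ((x′ * D n′ + y′ * D m′) * D (m ⊛ n)) ∎)

    *-cong : ∀ {f f′ g g′} → f ≃ f′ → g ≃ g′ → (f *ᶠ g) ≃ (f′ *ᶠ g′)
    *-cong {mkFraction x m} {mkFraction x′ m′} {mkFraction y n} {mkFraction y′ n′} (equal k p) (equal l q) =
      equal (k ⊛ l) (begin
        D (k ⊛ l) * ((x * y) * D (m′ ⊛ n′))
          ≈⟨ A.*-cong (D-* k l) (A.*-congˡ (D-* m′ n′)) ⟩
        D k * D l * ((x * y) * (D m′ * D n′))
          ≈⟨ solve 6 (λ k l x y m n → k :* l :* ((x :* y) :* (m :* n)) := (k :* (x :* m)) :* (l :* (y :* n)))
               A.refl (D k) (D l) x y (D m′) (D n′) ⟩
        (D k * (x * D m′)) * (D l * (y * D n′))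
          ≈⟨ A.*-cong p q ⟩
        (D k * (x′ * D m)) * (D l * (y′ * D n))
          ≈⟨ solve 6 (λ k l x y m n → (k :* (x :* m)) :* (l :* (y :* n)) := k :* l :* ((x :* y) :* (m :* n)))
               A.refl (D k) (D l) x′ y′ (D m) (D n) ⟩
        D k * D l * ((x′ * y′) * (D m * D n))
          ≈⟨ A.*-cong (D-* k l) (A.*-congˡ (D-* m n)) ⟨
        D (k ⊛ l) * ((x′ * y′) * D (m ⊛ n)) ∎)

    neg-cong : ∀ {f g} → f ≃ g → (-ᶠ f) ≃ (-ᶠ g)
    neg-cong {mkFraction x m} {mkFraction y n} (equal k p) = equal k (begin
      D k * (- x * D n)   ≈⟨ lemma x n ⟩
      - (D k * (x * D n)) ≈⟨ A.-‿cong p ⟩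
      - (D k * (y * D m)) ≈⟨ lemma y m ⟨
      D k * (- y * D m)   ∎)
      where
      open RingProperties A.ring
      lemma : ∀ x n → D k * (- x * D n) A.≈ - (D k * (x * D n))
      lemma x n = A.trans (A.*-congˡ (A.sym (-‿distribˡ-* x (D n)))) (A.sym (-‿distribʳ-* (D k) (x * D n)))

    +-assoc : ∀ f g h → ((f +ᶠ g) +ᶠ h) ≃ (f +ᶠ (g +ᶠ h))
    +-assoc (mkFraction x m) (mkFraction y n) (mkFraction z o) = cross (begin
      ((x * D n + y * D m) * D o + z * D (m ⊛ n)) * D (m ⊛ (n ⊛ o))
        ≈⟨ A.*-cong (A.+-congˡ (A.*-congˡ (D-* m n))) (D-*₃ m n o) ⟩
      ((x * D n + y * D m) * D o + z * (D m * D n)) * (D m * (D n * D o))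
        ≈⟨ solve 6 (λ x y z m n o →
             ((x :* n :+ y :* m) :* o :+ z :* (m :* n)) :* (m :* (n :* o)) :=
             (x :* (n :* o) :+ (y :* o :+ z :* n) :* m) :* (m :* n :* o))
             A.refl x y z (D m) (D n) (D o) ⟩
      (x * (D n * D o) + (y * D o + z * D n) * D m) * (D m * D n * D o)
        ≈⟨ A.*-cong (A.+-congʳ (A.*-congˡ (D-* n o))) (D-*₃′ m n o) ⟨
      (x * D (n ⊛ o) + (y * D o + z * D n) * D m) * D ((m ⊛ n) ⊛ o) ∎)

    +-comm : ∀ f g → (f +ᶠ g) ≃ (g +ᶠ f)
    +-comm (mkFraction x m) (mkFraction y n) = cross (A.*-cong
      (A.+-comm _ _) (A.trans (D-* n m) (A.trans (A.*-comm _ _) (A.sym (D-* m n)))))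

    +-identityˡ : ∀ f → (0ᶠ +ᶠ f) ≃ f
    +-identityˡ (mkFraction x m) = cross (begin
      (0# * D m + x * D 0) * D m ≈⟨ A.*-congʳ (A.trans (A.+-congʳ (A.zeroˡ _)) (A.+-identityˡ _)) ⟩
      (x * D 0) * D m            ≈⟨ A.*-assoc _ _ _ ⟩
      x * (D 0 * D m)            ≈⟨ A.*-congˡ (D-* 0 m) ⟨
      x * D (0 ⊛ m)              ∎)

    -‿inverseˡ : ∀ f → ((-ᶠ f) +ᶠ f) ≃ 0ᶠ
    -‿inverseˡ (mkFraction x m) = cross (A.*-cong (A.trans (A.sym (A.distribʳ (D m) (- x) x))
      (A.trans (A.*-congʳ (A.-‿inverseˡ x)) (A.zeroˡ _))) A.refl ⟨≈⟩ (A.zeroˡ _ ⟨≈⟩ A.sym (A.zeroˡ _)))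
      where
      _⟨≈⟩_ = A.trans

    *-assoc : ∀ f g h → ((f *ᶠ g) *ᶠ h) ≃ (f *ᶠ (g *ᶠ h))
    *-assoc (mkFraction x m) (mkFraction y n) (mkFraction z o) = cross (A.*-cong (A.*-assoc x y z)
      (A.trans (D-*₃ m n o) (A.trans (A.sym (A.*-assoc _ _ _)) (A.sym (D-*₃′ m n o)))))

    *-comm : ∀ f g → (f *ᶠ g) ≃ (g *ᶠ f)
    *-comm (mkFraction x m) (mkFraction y n) = cross (A.*-cong
      (A.*-comm _ _) (A.trans (D-* n m) (A.trans (A.*-comm _ _) (A.sym (D-* m n)))))

    *-identityˡ : ∀ f → (1ᶠ *ᶠ f) ≃ f
    *-identityˡ (mkFraction x m) = cross (A.*-cong (A.*-identityˡ x)
      (A.sym (A.trans (D-* 0 m) (A.trans (A.*-congʳ ι.1#-homo) (A.*-identityˡ _)))))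

    distribˡ : ∀ f g h → (f *ᶠ (g +ᶠ h)) ≃ ((f *ᶠ g) +ᶠ (f *ᶠ h))
    distribˡ (mkFraction x m) (mkFraction y n) (mkFraction z o) = cross (begin
      (x * (y * D o + z * D n)) * D ((m ⊛ n) ⊛ (m ⊛ o))
        ≈⟨ A.*-congˡ (A.trans (D-* (m ⊛ n) (m ⊛ o)) (A.*-cong (D-* m n) (D-* m o))) ⟩
      (x * (y * D o + z * D n)) * ((D m * D n) * (D m * D o))
        ≈⟨ solve 6 (λ x y z m n o →
             (x :* (y :* o :+ z :* n)) :* ((m :* n) :* (m :* o)) :=
             ((x :* y) :* (m :* o) :+ (x :* z) :* (m :* n)) :* (m :* (n :* o)))
             A.refl x y z (D m) (D n) (D o) ⟩
      ((x * y) * (D m * D o) + (x * z) * (D m * D n)) * (D m * (D n * D o))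
        ≈⟨ A.*-cong (A.+-cong (A.*-congˡ (D-* m o)) (A.*-congˡ (D-* m n))) (D-*₃ m n o) ⟨
      ((x * y) * D (m ⊛ o) + (x * z) * D (m ⊛ n)) * D (m ⊛ (n ⊛ o)) ∎)

  abstract
    isCommutativeRing : IsCommutativeRing _≃_ _+ᶠ_ _*ᶠ_ -ᶠ_ 0ᶠ 1ᶠ
    isCommutativeRing = record
      { isRing = record
        { +-isAbelianGroup = record
          { isGroup = record
            { isMonoid = record
              { isSemigroup = record
                { isMagma = record
                  { isEquivalence = record
                    { refl  = λ {f} → ≃-refl {f}
                    ; sym   = λ {f} {g} → ≃-sym {f} {g}
                    ; trans = λ {f} {g} {h} → ≃-trans {f} {g} {h} }
                  ; ∙-cong = λ {f} {f′} {g} {g′} → +-cong {f} {f′} {g} {g′} }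
                ; assoc = +-assoc }
              ; identity = +-identityˡ , λ f →
                  ≃-trans {f +ᶠ 0ᶠ} {0ᶠ +ᶠ f} {f} (+-comm f 0ᶠ) (+-identityˡ f) }
            ; inverse = -‿inverseˡ , λ f →
                ≃-trans {f +ᶠ (-ᶠ f)} {(-ᶠ f) +ᶠ f} {0ᶠ} (+-comm f (-ᶠ f)) (-‿inverseˡ f)
            ; ⁻¹-cong = λ {f} {g} → neg-cong {f} {g} }
          ; comm = +-comm }
        ; *-cong = λ {f} {f′} {g} {g′} → *-cong {f} {f′} {g} {g′}
        ; *-assoc = *-assoc
        ; *-identity = *-identityˡ , λ f →
            ≃-trans {f *ᶠ 1ᶠ} {1ᶠ *ᶠ f} {f} (*-comm f 1ᶠ) (*-identityˡ f)
        ; distrib = distribˡ , λ f g h →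
            ≃-trans {(g +ᶠ h) *ᶠ f} {f *ᶠ (g +ᶠ h)} {(g *ᶠ f) +ᶠ (h *ᶠ f)} (*-comm (g +ᶠ h) f)
              (≃-trans {f *ᶠ (g +ᶠ h)} {(f *ᶠ g) +ᶠ (f *ᶠ h)} {(g *ᶠ f) +ᶠ (h *ᶠ f)} (distribˡ f g h)
                (+-cong {f *ᶠ g} {g *ᶠ f} {f *ᶠ h} {h *ᶠ f} (*-comm f g) (*-comm f h)))
        }
      ; *-comm = *-comm
      }

  commutativeRing : CommutativeRing 0ℓ 0ℓ
  commutativeRing = record
    { Carrier = Fraction
    ; _≈_ = _≃_
    ; _+_ = _+ᶠ_
    ; _*_ = _*ᶠ_
    ; -_  = -ᶠ_
    ; 0#  = 0ᶠ
    ; 1#  = 1ᶠ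
    ; isCommutativeRing = isCommutativeRing
    }

  open CommutativeRing commutativeRing public using (ring)

  fromA : A.Carrier → Fraction
  fromA x = mkFraction x 0

  private
    D0 : ∀ x → x * D 0 A.≈ x
    D0 x = A.trans (A.*-congˡ ι.1#-homo) (A.*-identityʳ x)

  fromA-hom : Hom A.ring ring fromA
  fromA-hom = mkHom A.ring ring
    (λ p → cross (A.*-congʳ p))
    (λ x y → cross (A.*-congʳ (A.sym (A.+-cong (D0 x) (D0 y)))))
    (λ _ _ → cross A.refl) (cross A.refl) (cross A.refl) (λ _ → cross A.refl)

  fromℚᵘ : ℚᵘ → Fraction
  fromℚᵘ (mkℚᵘ n d) = mkFraction (ι n) d

  fromℚ : ℚ → Fraction
  fromℚ = fromℚᵘ ∘ toℚᵘ

  private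
    fromℚᵘ-cong : ∀ {p q} → p ℚᵘ.≃ q → fromℚᵘ p ≃ fromℚᵘ q
    fromℚᵘ-cong {mkℚᵘ n d} {mkℚᵘ m e} (*≡* eq) = cross
      (A.trans (A.sym (ι.*-homo n (+ suc e)))
        (A.trans (ι.⟦⟧-cong eq) (ι.*-homo m (+ suc d))))

    fromℚᵘ-+ : ∀ p q → fromℚᵘ (p ℚᵘ.+ q) ≃ (fromℚᵘ p +ᶠ fromℚᵘ q)
    fromℚᵘ-+ (mkℚᵘ n d) (mkℚᵘ m e) = cross (A.*-congʳ
      (A.trans (ι.+-homo (n ℤ.* + suc e) (m ℤ.* + suc d)) (A.+-cong (ι.*-homo n _) (ι.*-homo m _))))

    fromℚᵘ-* : ∀ p q → fromℚᵘ (p ℚᵘ.* q) ≃ (fromℚᵘ p *ᶠ fromℚᵘ q)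
    fromℚᵘ-* (mkℚᵘ n d) (mkℚᵘ m e) = cross (A.*-congʳ (ι.*-homo n m))

    fromℚᵘ-neg : ∀ p → fromℚᵘ (ℚᵘ.- p) ≃ (-ᶠ fromℚᵘ p)
    fromℚᵘ-neg (mkℚᵘ n d) = cross (A.*-congʳ (ι.-‿homo n))

  fromℚ-hom : Hom (CommutativeRing.ring ℚ.+-*-commutativeRing) ring fromℚ
  fromℚ-hom = mkHom (CommutativeRing.ring ℚ.+-*-commutativeRing) ring
    (λ { ≡.refl → cross A.refl })
    (λ p q → ≃-trans {fromℚ (p ℚ.+ q)} {fromℚᵘ (toℚᵘ p ℚᵘ.+ toℚᵘ q)}
      (fromℚᵘ-cong (ℚ.toℚᵘ-homo-+ p q)) (fromℚᵘ-+ (toℚᵘ p) (toℚᵘ q)))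
    (λ p q → ≃-trans {fromℚ (p ℚ.* q)} {fromℚᵘ (toℚᵘ p ℚᵘ.* toℚᵘ q)}
      (fromℚᵘ-cong (ℚ.toℚᵘ-homo-* p q)) (fromℚᵘ-* (toℚᵘ p) (toℚᵘ q)))
    (cross (A.*-congʳ ι.0#-homo)) (cross (A.*-congʳ ι.1#-homo))
    (λ p → ≃-trans {fromℚ (ℚ.- p)} {fromℚᵘ (ℚᵘ.- toℚᵘ p)}
      (fromℚᵘ-cong (ℚ.toℚᵘ-homo‿- p)) (fromℚᵘ-neg (toℚᵘ p)))

------------------------------------------------------------------------
-- ℤ_ℓ as the inverse limit of the ℤ/ℓⁿ, by coherent integer representatives

module Congruence (m : ℤ) where

  infix 4 _≋_
  _≋_ : ℤ → ℤ → Set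
  x ≋ y = m ℤ.∣ x ℤ.- y

  abstract
    ≋-reflexive : ∀ {x y} → x ≡ y → x ≋ y
    ≋-reflexive {x} ≡.refl = ≡.subst (m ℤ.∣_) (≡.sym (ℤ.+-inverseʳ x)) (ℤ.divides ℤ.0ℤ ≡.refl)

    ≋-sym : ∀ {x y} → x ≋ y → y ≋ x
    ≋-sym {x} {y} p = ≡.subst (m ℤ.∣_) (eq x y) (ℤ.∣m⇒∣-m p)
      where
      eq : ∀ x y → ℤ.- (x ℤ.+ ℤ.- y) ≡ y ℤ.+ ℤ.- x
      eq = solve-∀

    ≋-trans : ∀ {x y z} → x ≋ y → y ≋ z → x ≋ z
    ≋-trans {x} {y} {z} p q = ≡.subst (m ℤ.∣_) (eq x y z) (ℤ.∣m∣n⇒∣m+n p q)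
      where
      eq : ∀ x y z → (x ℤ.+ ℤ.- y) ℤ.+ (y ℤ.+ ℤ.- z) ≡ x ℤ.+ ℤ.- z
      eq = solve-∀

    ≋-+ : ∀ {x x′ y y′} → x ≋ x′ → y ≋ y′ → x ℤ.+ y ≋ x′ ℤ.+ y′
    ≋-+ {x} {x′} {y} {y′} p q = ≡.subst (m ℤ.∣_) (eq x x′ y y′) (ℤ.∣m∣n⇒∣m+n p q)
      where
      eq : ∀ x x′ y y′ → (x ℤ.+ ℤ.- x′) ℤ.+ (y ℤ.+ ℤ.- y′) ≡ (x ℤ.+ y) ℤ.+ ℤ.- (x′ ℤ.+ y′)
      eq = solve-∀

    ≋-* : ∀ {x x′ y y′} → x ≋ x′ → y ≋ y′ → x ℤ.* y ≋ x′ ℤ.* y′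
    ≋-* {x} {x′} {y} {y′} p q = ≡.subst (m ℤ.∣_) (eq x x′ y y′)
      (ℤ.∣m∣n⇒∣m+n (ℤ.∣n⇒∣m*n x q) (ℤ.∣m⇒∣m*n y′ p))
      where
      eq : ∀ x x′ y y′ → x ℤ.* (y ℤ.+ ℤ.- y′) ℤ.+ (x ℤ.+ ℤ.- x′) ℤ.* y′ ≡ x ℤ.* y ℤ.+ ℤ.- (x′ ℤ.* y′)
      eq = solve-∀

    ≋-neg : ∀ {x x′} → x ≋ x′ → ℤ.- x ≋ ℤ.- x′
    ≋-neg {x} {x′} p = ≡.subst (m ℤ.∣_) (eq x x′) (ℤ.∣m⇒∣-m p)
      where
      eq : ∀ x x′ → ℤ.- (x ℤ.+ ℤ.- x′) ≡ ℤ.- x ℤ.+ ℤ.- (ℤ.- x′)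
      eq = solve-∀

module Adic (ℓ : ℕ) where
  private
    module C (n : ℕ) = Congruence (+ (ℓ ℕ.^ n))

  record ℤₗ : Set where
    constructor mkℤₗ
    field
      residue  : ℕ → ℤ
      coherent : ∀ n → C._≋_ n (residue (suc n)) (residue n)
  open ℤₗ

  record _≈ₗ_ (x y : ℤₗ) : Set where
    constructor mk≈
    field at : ∀ n → C._≋_ n (residue x n) (residue y n)
  open _≈ₗ_

  fromℤ : ℤ → ℤₗ
  fromℤ x = mkℤₗ (λ _ → x) (λ n → C.≋-reflexive n {x} ≡.refl)

  private
    pointwise : ∀ {x y} → (∀ n → residue x n ≡ residue y n) → x ≈ₗ y
    pointwise eq = mk≈ λ n → C.≋-reflexive n (eq n)

  commutativeRing : CommutativeRing 0ℓ 0ℓ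
  commutativeRing = record
    { Carrier = ℤₗ
    ; _≈_ = _≈ₗ_
    ; _+_ = _+ₗ_
    ; _*_ = λ x y → mkℤₗ (λ n → residue x n ℤ.* residue y n)
        (λ n → C.≋-* n {residue x (suc n)} {residue x n} {residue y (suc n)} {residue y n}
          (coherent x n) (coherent y n))
    ; -_  = -ₗ_
    ; 0#  = fromℤ ℤ.0ℤ
    ; 1#  = fromℤ ℤ.1ℤ
    ; isCommutativeRing = record
      { isRing = record
        { +-isAbelianGroup = record
          { isGroup = record
            { isMonoid = record
              { isSemigroup = record
                { isMagma = record
                  { isEquivalence = record
                    { refl  = pointwise λ _ → ≡.refl
                    ; sym   = λ {x} {y} p → mk≈ λ n → C.≋-sym n {residue x n} {residue y n} (at p n)
                    ; trans = λ {x} {y} {z} p q → mk≈ λ n →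
                        C.≋-trans n {residue x n} {residue y n} {residue z n} (at p n) (at q n) }
                  ; ∙-cong = λ {x} {x′} {y} {y′} p q → mk≈ λ n →
                      C.≋-+ n {residue x n} {residue x′ n} {residue y n} {residue y′ n} (at p n) (at q n) }
                ; assoc = λ x y z → pointwise λ n → ℤ.+-assoc (residue x n) _ _ }
              ; identity = (λ x → pointwise λ n → ℤ.+-identityˡ (residue x n)) ,
                           (λ x → pointwise λ n → ℤ.+-identityʳ (residue x n)) }
            ; inverse = (λ x → pointwise λ n → ℤ.+-inverseˡ (residue x n)) ,
                        (λ x → pointwise λ n → ℤ.+-inverseʳ (residue x n))
            ; ⁻¹-cong = λ {x} {x′} p → mk≈ λ n → C.≋-neg n {residue x n} {residue x′ n} (at p n) }
          ; comm = λ x y → pointwise λ n → ℤ.+-comm (residue x n) _ }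
        ; *-cong = λ {x} {x′} {y} {y′} p q → mk≈ λ n →
            C.≋-* n {residue x n} {residue x′ n} {residue y n} {residue y′ n} (at p n) (at q n)
        ; *-assoc = λ x y z → pointwise λ n → ℤ.*-assoc (residue x n) _ _
        ; *-identity = (λ x → pointwise λ n → ℤ.*-identityˡ (residue x n)) ,
                       (λ x → pointwise λ n → ℤ.*-identityʳ (residue x n))
        ; distrib = (λ x y z → pointwise λ n → ℤ.*-distribˡ-+ (residue x n) _ _) ,
                    (λ x y z → pointwise λ n → ℤ.*-distribʳ-+ (residue x n) (residue y n) _)
        }
      ; *-comm = λ x y → pointwise λ n → ℤ.*-comm (residue x n) _
      }
    }
    where
    _+ₗ_ : ℤₗ → ℤₗ → ℤₗ
    x +ₗ y = mkℤₗ (λ n → residue x n ℤ.+ residue y n)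
      (λ n → C.≋-+ n {residue x (suc n)} {residue x n} {residue y (suc n)} {residue y n}
        (coherent x n) (coherent y n))
    -ₗ_ : ℤₗ → ℤₗ
    -ₗ x = mkℤₗ (λ n → ℤ.- residue x n)
      (λ n → C.≋-neg n {residue x (suc n)} {residue x n} (coherent x n))

  fromℤ-hom : Hom (CommutativeRing.ring ℤ.+-*-commutativeRing) (CommutativeRing.ring commutativeRing) fromℤ
  fromℤ-hom = mkHom (CommutativeRing.ring ℤ.+-*-commutativeRing) (CommutativeRing.ring commutativeRing)
    (λ p → pointwise λ _ → p)
    (λ _ _ → pointwise λ _ → ≡.refl) (λ _ _ → pointwise λ _ → ≡.refl)
    (pointwise λ _ → ≡.refl) (pointwise λ _ → ≡.refl) (λ _ → pointwise λ _ → ≡.refl)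

------------------------------------------------------------------------
-- Ẑ = ∏ ℤ_ℓ over all primes ℓ

-- Irrelevance makes the index a prime number, not a primality proof.
record Prime# : Set where
  constructor prime#
  field
    value    : ℕ
    .isPrime : Prime value

module Profinite where
  private
    module Z (ℓ : Prime#) = CommutativeRing (Adic.commutativeRing (Prime#.value ℓ))

  commutativeRing : CommutativeRing 0ℓ 0ℓ
  commutativeRing = record
    { Carrier = (ℓ : Prime#) → Z.Carrier ℓ
    ; _≈_ = λ x y → ∀ ℓ → Z._≈_ ℓ (x ℓ) (y ℓ)
    ; _+_ = λ x y ℓ → Z._+_ ℓ (x ℓ) (y ℓ)
    ; _*_ = λ x y ℓ → Z._*_ ℓ (x ℓ) (y ℓ)
    ; -_  = λ x ℓ → Z.-_ ℓ (x ℓ)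
    ; 0#  = λ ℓ → Z.0# ℓ
    ; 1#  = λ ℓ → Z.1# ℓ
    ; isCommutativeRing = record
      { isRing = record
        { +-isAbelianGroup = record
          { isGroup = record
            { isMonoid = record
              { isSemigroup = record
                { isMagma = record
                  { isEquivalence = record
                    { refl  = λ {x} ℓ → Z.refl ℓ {x ℓ}
                    ; sym   = λ {x} {y} p ℓ → Z.sym ℓ {x ℓ} {y ℓ} (p ℓ)
                    ; trans = λ {x} {y} {z} p q ℓ → Z.trans ℓ {x ℓ} {y ℓ} {z ℓ} (p ℓ) (q ℓ) }
                  ; ∙-cong = λ {x} {x′} {y} {y′} p q ℓ →
                      Z.+-cong ℓ {x ℓ} {x′ ℓ} {y ℓ} {y′ ℓ} (p ℓ) (q ℓ) }
                ; assoc = λ x y z ℓ → Z.+-assoc ℓ (x ℓ) (y ℓ) (z ℓ) }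
              ; identity = (λ x ℓ → Z.+-identityˡ ℓ (x ℓ)) , (λ x ℓ → Z.+-identityʳ ℓ (x ℓ)) }
            ; inverse = (λ x ℓ → Z.-‿inverseˡ ℓ (x ℓ)) , (λ x ℓ → Z.-‿inverseʳ ℓ (x ℓ))
            ; ⁻¹-cong = λ {x} {x′} p ℓ → Z.-‿cong ℓ {x ℓ} {x′ ℓ} (p ℓ) }
          ; comm = λ x y ℓ → Z.+-comm ℓ (x ℓ) (y ℓ) }
        ; *-cong = λ {x} {x′} {y} {y′} p q ℓ →
            Z.*-cong ℓ {x ℓ} {x′ ℓ} {y ℓ} {y′ ℓ} (p ℓ) (q ℓ)
        ; *-assoc = λ x y z ℓ → Z.*-assoc ℓ (x ℓ) (y ℓ) (z ℓ)
        ; *-identity = (λ x ℓ → Z.*-identityˡ ℓ (x ℓ)) , (λ x ℓ → Z.*-identityʳ ℓ (x ℓ))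
        ; distrib = (λ x y z ℓ → Z.distribˡ ℓ (x ℓ) (y ℓ) (z ℓ)) ,
                    (λ x y z ℓ → Z.distribʳ ℓ (x ℓ) (y ℓ) (z ℓ))
        }
      ; *-comm = λ x y ℓ → Z.*-comm ℓ (x ℓ) (y ℓ)
      }
    }

  fromℤ : ℤ → CommutativeRing.Carrier commutativeRing
  fromℤ x ℓ = Adic.fromℤ (Prime#.value ℓ) x

  fromℤ-hom : Hom (CommutativeRing.ring ℤ.+-*-commutativeRing) (CommutativeRing.ring commutativeRing) fromℤ
  fromℤ-hom = mkHom (CommutativeRing.ring ℤ.+-*-commutativeRing) (CommutativeRing.ring commutativeRing)
    (λ p ℓ → H.⟦⟧-cong ℓ p)
    (λ x y ℓ → H.+-homo ℓ x y)
    (λ x y ℓ → H.*-homo ℓ x y)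
    (λ ℓ → H.0#-homo ℓ) (λ ℓ → H.1#-homo ℓ)
    (λ x ℓ → H.-‿homo ℓ x)
    where
    module H (ℓ : Prime#) = RingMorphisms.IsRingHomomorphism (Adic.fromℤ-hom (Prime#.value ℓ))

------------------------------------------------------------------------

ℤ-ring ℚ-ring : CommutativeRing 0ℓ 0ℓ
ℤ-ring = ℤ.+-*-commutativeRing
ℚ-ring = ℚ.+-*-commutativeRing

ℤ→ℚ-hom : Hom (CommutativeRing.ring ℤ-ring) (CommutativeRing.ring ℚ-ring) ℚ.fromℤ
ℤ→ℚ-hom = mkHom (CommutativeRing.ring ℤ-ring) (CommutativeRing.ring ℚ-ring)
  (≡.cong ℚ.fromℤ)
  (λ x y → ℚ.toℚᵘ-injective (ℚᵘ.≃-sym (ℚᵘ.≃-trans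
    (ℚ.toℚᵘ-homo-+ (ℚ.fromℤ x) (ℚ.fromℤ y)) (*≡* (eq x y)))))
  (λ x y → ℚ.toℚᵘ-injective (ℚᵘ.≃-sym (ℚᵘ.≃-trans
    (ℚ.toℚᵘ-homo-* (ℚ.fromℤ x) (ℚ.fromℤ y)) (*≡* ≡.refl))))
  ≡.refl ≡.refl
  (λ x → ℚ.toℚᵘ-injective (ℚᵘ.≃-sym (ℚᵘ.≃-trans
    (ℚ.toℚᵘ-homo‿- (ℚ.fromℤ x)) (*≡* ≡.refl))))
  where
  eq : ∀ x y → (x ℤ.* ℤ.1ℤ ℤ.+ y ℤ.* ℤ.1ℤ) ℤ.* ℤ.1ℤ ≡ (x ℤ.+ y) ℤ.* ℤ.1ℤ
  eq = solve-∀

ℚ-Algebra : Set₁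
ℚ-Algebra = Algebra ℚ-ring

overℤ : ℚ-Algebra → Algebra ℤ-ring
overℤ = restrict {ℤ-ring} {ℚ-ring} ℚ.fromℤ ℤ→ℚ-hom

-- Lattices are finitely generated ℤ-submodules spanning V over ℚ, given by
-- generators (which need not be independent).
record Lattice (V : ℚ-Algebra) : Set where
  open Algebra V
  field
    {size}     : ℕ
    generators : Vector Carrier size
    spanning   : ∀ v → v ∈ Span V generators

⟪_⟫ : {V : ℚ-Algebra} → Lattice V → Pred (Algebra.Carrier V) 0ℓ
⟪_⟫ {V} L = Span (overℤ V) (Lattice.generators L)

record Order (V : ℚ-Algebra) : Set where
  open Algebra V
  field
    lattice  : Lattice V
    1-closed : 1# ∈ ⟪ lattice ⟫
    *-closed : ∀ {x y} → x ∈ ⟪ lattice ⟫ → y ∈ ⟪ lattice ⟫ → x * y ∈ ⟪ lattice ⟫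

⟦_⟧ₒ : {V : ℚ-Algebra} → Order V → Pred (Algebra.Carrier V) 0ℓ
⟦ R ⟧ₒ = ⟪ Order.lattice R ⟫

rightOrder : {V : ℚ-Algebra} → Lattice V → Pred (Algebra.Carrier V) 0ℓ
rightOrder {V} 𝔞 x = ∀ {y} → y ∈ ⟪ 𝔞 ⟫ → y * x ∈ ⟪ 𝔞 ⟫
  where open Algebra V

module _ {S T : CommutativeRing 0ℓ 0ℓ} (V : Algebra S) (W : Algebra T)
  (φ : CommutativeRing.Carrier S → CommutativeRing.Carrier T)
  (f : Algebra.Carrier V → Algebra.Carrier W)
  (f-hom : Hom (Algebra.ring V) (Algebra.ring W) f)
  (f-scalar : ∀ s → Algebra._≈_ W (f (Algebra.scalar V s)) (Algebra.scalar W (φ s))) where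
  private
    module V = Algebra V
    module W = Algebra W
    module F = RingMorphisms.IsRingHomomorphism f-hom
    module ΣV = Sum V.semiring
    module ΣW = Sum W.semiring

    map-combination : ∀ {n} (c : Vector (CommutativeRing.Carrier S) n) (g : Vector V.Carrier n) →
      f (ΣV.sum (λ i → V.scalar (c i) V.* g i)) W.≈ ΣW.sum (λ i → W.scalar (φ (c i)) W.* f (g i))
    map-combination {zero}  c g = F.0#-homo
    map-combination {suc n} c g = W.trans (F.+-homo _ _)
      (W.+-cong (W.trans (F.*-homo _ _) (W.*-congʳ (f-scalar (c zero))))
                (map-combination (c ∘ suc) (g ∘ suc)))

  map-span : ∀ {n} {g : Vector V.Carrier n} {x} → x ∈ Span V g → f x ∈ Span W (f ∘ g)
  map-span {g = g} (c , p) = φ ∘ c , W.trans (F.⟦⟧-cong p) (map-combination c g)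

------------------------------------------------------------------------

quaternionAlgebra : ℚ → ℚ → ℚ-Algebra
quaternionAlgebra a b = Quaternion.algebra ℚ-ring a b

-- The reduced norm takes the value 1, so it is definite iff positive definite.
Definite : ℚ → ℚ → Set
Definite a b = ∀ x → ¬ x ≈ 0# → ℚ.0ℚ ℚ.< Quaternion.reducedNorm ℚ-ring a b x
  where open Algebra (quaternionAlgebra a b)

NonSquare : ℚ → Set
NonSquare d = ∀ q → q ℚ.* q ≢ d

ℚ[√_] : ℚ → ℚ-Algebra
ℚ[√ d ] = Quadratic.asAlgebra ℚ-ring d

-- det (tr (ωᵢ ωⱼ)) = D for a ℤ-basis ω₁, ω₂ of O; two generators are
-- automatically independent, as O spans ℚ(√d).
HasDiscriminant : (d : ℚ) → Order ℚ[√ d ] → ℤ → Set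
HasDiscriminant d O D = ∃ λ (ω : Vector Carrier 2) →
  ⟦ O ⟧ₒ ≐ Span (overℤ ℚ[√ d ]) ω ×
  tr (ω zero * ω zero) ℚ.* tr (ω (suc zero) * ω (suc zero))
    ℚ.- tr (ω zero * ω (suc zero)) ℚ.* tr (ω (suc zero) * ω zero) ≡ ℚ.fromℤ D
  where
  open Algebra ℚ[√ d ] using (Carrier; _*_)
  tr = Quadratic.trace ℚ-ring d

------------------------------------------------------------------------
-- B ⊗ A for B = (a , b / ℚ) and A = ℤ_ℓ, Ẑ, formed over A ⊗ ℚ

record Coefficients : Set₁ where
  field
    A     : CommutativeRing 0ℓ 0ℓ
    ι     : ℤ → CommutativeRing.Carrier A
    ι-hom : Hom (CommutativeRing.ring ℤ-ring) (CommutativeRing.ring A) ι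

ℤ[_] : Prime# → Coefficients
ℤ[ ℓ ] = record { A = Adic.commutativeRing n ; ι = Adic.fromℤ n ; ι-hom = Adic.fromℤ-hom n }
  where n = Prime#.value ℓ

Ẑ : Coefficients
Ẑ = record { A = Profinite.commutativeRing ; ι = Profinite.fromℤ ; ι-hom = Profinite.fromℤ-hom }

module Completion (C : Coefficients) (a b : ℚ) where
  open Coefficients C
  private
    module Aℚ = Rationalisation A ι ι-hom
    module M = QuaternionMap ℚ-ring Aℚ.commutativeRing Aℚ.fromℚ Aℚ.fromℚ-hom a b
    B : ℚ-Algebra
    B = quaternionAlgebra a b

  algebra : Algebra Aℚ.commutativeRing
  algebra = Quaternion.algebra Aℚ.commutativeRing (Aℚ.fromℚ a) (Aℚ.fromℚ b)

  algebra/A : Algebra A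
  algebra/A = restrict {A} {Aℚ.commutativeRing} Aℚ.fromA Aℚ.fromA-hom algebra

  open Algebra algebra using (Carrier; setoid; ring; _*_; 1#)

  include : Algebra.Carrier B → Carrier
  include = M.map

  include-hom : Hom (Algebra.ring B) ring include
  include-hom = M.map-hom

  -- L ⊗ A ⊂ B ⊗ A
  complete : Lattice B → Pred Carrier 0ℓ
  complete L = Span algebra/A (include ∘ Lattice.generators L)

  complete-∋ : (L : Lattice B) → ∀ {x} → x ∈ ⟪ L ⟫ → include x ∈ complete L
  complete-∋ L {x} = map-span {ℤ-ring} {A} (overℤ B) algebra/A ι include include-hom
    (λ s → M.map-scalar (ℚ.fromℤ s)) {Lattice.size L} {Lattice.generators L} {x}

  complete-* : (R : Order B) → ∀ {x y} → x ∈ complete (Order.lattice R) →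
               y ∈ complete (Order.lattice R) → x * y ∈ complete (Order.lattice R)
  complete-* R = SpanProperties.span-* algebra/A {g = include ∘ g} λ i j →
    SpanProperties.span-resp algebra/A {g = include ∘ g} (include.*-homo (g i) (g j))
      (complete-∋ (Order.lattice R) {g i B.* g j}
        (Order.*-closed R (generator i) (generator j)))
    where
    module B = Algebra B
    module include = RingMorphisms.IsRingHomomorphism include-hom
    g = Lattice.generators (Order.lattice R)
    generator : ∀ i → g i ∈ ⟪ Order.lattice R ⟫
    generator = SpanProperties.span-generator (overℤ B) {g = g}

  complete-1 : (R : Order B) → 1# ∈ complete (Order.lattice R)
  complete-1 R = SpanProperties.span-resp algebra/A {g = include ∘ Lattice.generators (Order.lattice R)}
    include.1#-homo (complete-∋ (Order.lattice R) {Algebra.1# B} (Order.1-closed R))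
    where
    module include = RingMorphisms.IsRingHomomorphism include-hom

  PrincipalFor : Order B → Lattice B → Set
  PrincipalFor R L = ∃ λ (x : Unit ring) →
    complete L ≐ Image setoid (_* Unit.value x) (complete (Order.lattice R))

------------------------------------------------------------------------

-- To be used with LocallyPrincipal saying that a lattice is a left R-ideal.
module SpecialPoints
  (B-algebra K-algebra : ℚ-Algebra) (O : Order K-algebra)
  (LocallyPrincipal : Lattice B-algebra → Set) where

  private
    module B = Algebra B-algebra
    module K = Algebra K-algebra
    open Unit

  record Ideal : Set where
    field
      lattice          : Lattice B-algebra
      locallyPrincipal : LocallyPrincipal lattice

  record SpecialPoint : Set where
    field
      ideal : Ideal
      ψ     : Embedding K.ring B.ring
    𝔞 : Pred B.Carrier 0ℓ
    𝔞 = ⟪ Ideal.lattice ideal ⟫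
    open Embedding ψ public using (⟦_⟧)
    field
      optimal : rightOrder (Ideal.lattice ideal) ∩ Image B.setoid ⟦_⟧ U
                ≐ Image B.setoid ⟦_⟧ ⟦ O ⟧ₒ

  -- p ∼ q if q = p · α for some α ∈ B^×.
  _∼_ : SpecialPoint → SpecialPoint → Set
  p ∼ q = ∃ λ (α : Unit B.ring) →
    Q.𝔞 ≐ Image B.setoid (B._* value α) P.𝔞 ×
    (∀ k → Q.⟦ k ⟧ B.≈ inv α B.* P.⟦ k ⟧ B.* value α)
    where
    module P = SpecialPoint p
    module Q = SpecialPoint q

  private
    module BU = UnitProperties B.ring

    𝔞-resp : ∀ p {x y} → x B.≈ y → x ∈ SpecialPoint.𝔞 p → y ∈ SpecialPoint.𝔞 p
    𝔞-resp p {x} {y} = SpanProperties.span-resp (overℤ B-algebra)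
      {g = Lattice.generators (Ideal.lattice (SpecialPoint.ideal p))} {x} {y}

    ∼-refl : ∀ {p} → p ∼ p
    ∼-refl {p} = 1ᵘ B.ring ,
      ((λ {x} x∈ → x , x∈ , B.sym {x B.* B.1#} {x} (B.*-identityʳ x)) ,
       (λ {x} (y , y∈ , eq) → 𝔞-resp p {y} {x}
         (B.sym {x} {y} (B.trans {x} {y B.* B.1#} {y} eq (B.*-identityʳ y))) y∈)) ,
      λ k → BU.double-refl (SpecialPoint.⟦_⟧ p k) {B.1#} (B.refl {B.1#})

    ∼-sym : ∀ {p q} → p ∼ q → q ∼ p
    ∼-sym {p} {q} (α , (to , from) , eq) = _⁻¹ᵘ B.ring α ,
      ((λ {x} x∈ → x B.* value α , from (x , x∈ , B.refl {x B.* value α}) ,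
          BU.cancelʳ x {value α} {inv α} (inverseʳ α)) ,
       (λ { {x} (y , y∈ , x≈) → let (z , z∈ , y≈) = to y∈ in
            𝔞-resp p {z} {x} (B.trans {z} {z B.* value α B.* inv α} {x}
              (BU.cancelʳ z {value α} {inv α} (inverseʳ α))
              (B.sym {x} {z B.* value α B.* inv α}
                (B.trans {x} {y B.* inv α} {z B.* value α B.* inv α} x≈
                  (B.*-congʳ {inv α} {y} {z B.* value α} y≈)))) z∈ })) ,
      λ k → BU.double-sym {P.⟦ k ⟧} {Q.⟦ k ⟧} {inv α} {value α} {value α} {inv α}
              (inverseʳ α) (inverseʳ α) (eq k)
      where
      module P = SpecialPoint p
      module Q = SpecialPoint q

    ∼-trans : ∀ {p q r} → p ∼ q → q ∼ r → p ∼ r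
    ∼-trans {p} {q} {r} (α , (to , from) , eq) (β , (to′ , from′) , eq′) = _*ᵘ_ B.ring α β ,
      ((λ {x} x∈ → let (y , y∈ , x≈) = to′ x∈ ; (z , z∈ , y≈) = to y∈ in
          z , z∈ , B.trans {x} {y B.* value β} {z B.* (value α B.* value β)} x≈
            (B.trans {y B.* value β} {z B.* value α B.* value β} {z B.* (value α B.* value β)}
              (B.*-congʳ {value β} {y} {z B.* value α} y≈) (B.*-assoc z (value α) (value β)))) ,
       (λ {x} (z , z∈ , x≈) → from′ (z B.* value α , from (z , z∈ , B.refl {z B.* value α}) ,
          B.trans {x} {z B.* (value α B.* value β)} {z B.* value α B.* value β} x≈
            (B.sym {z B.* value α B.* value β} {z B.* (value α B.* value β)}
              (B.*-assoc z (value α) (value β)))))) ,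
      λ k → BU.double-trans {P.⟦ k ⟧} {Q.⟦ k ⟧} {R.⟦ k ⟧} {inv α} {inv β} {value α} {value β}
              (B.refl {value α B.* value β}) (eq k) (eq′ k)
      where
      module P = SpecialPoint p
      module Q = SpecialPoint q
      module R = SpecialPoint r

  classes : Setoid 0ℓ 0ℓ
  classes = record
    { Carrier = SpecialPoint
    ; _≈_ = _∼_
    ; isEquivalence = record
      { refl  = λ {p} → ∼-refl {p}
      ; sym   = λ {p} {q} → ∼-sym {p} {q}
      ; trans = λ {p} {q} {r} → ∼-trans {p} {q} {r} } }

------------------------------------------------------------------------
-- The double cosets R̂^× \ N̂_O / K^× for a subring R̂ of B̂, a homomorphism
-- iₐ : K → B̂ and a subset O of K

module DoubleCosets
  (K-ring B̂-ring : Ring 0ℓ 0ℓ) (O : Pred (Ring.Carrier K-ring) 0ℓ)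
  (iₐ : Ring.Carrier K-ring → Ring.Carrier B̂-ring) (iₐ-hom : Hom K-ring B̂-ring iₐ)
  (R̂ : Pred (Ring.Carrier B̂-ring) 0ℓ) (1∈R̂ : Ring.1# B̂-ring ∈ R̂)
  (R̂-* : ∀ {x y} → x ∈ R̂ → y ∈ R̂ → Ring._*_ B̂-ring x y ∈ R̂) where

  private
    module K = Ring K-ring
    module B̂ = Ring B̂-ring
    open Unit

  record R̂^× : Set where
    field
      unit    : Unit B̂-ring
      value∈R̂ : value unit ∈ R̂
      inv∈R̂   : inv unit ∈ R̂

  -- O_x = K ∩ x⁻¹ R̂ x
  optimalOrder : Unit B̂-ring → Pred K.Carrier 0ℓ
  optimalOrder x k = iₐ k ∈ Image B̂.setoid (λ r → inv x B̂.* r B̂.* value x) R̂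

  record N̂ : Set where
    field
      unit  : Unit B̂-ring
      order : optimalOrder unit ≐ O

  _≈ₒ_ : N̂ → N̂ → Set
  x ≈ₒ y = ∃ λ (u : R̂^×) → ∃ λ (k : Unit K-ring) →
    value (N̂.unit y) B̂.≈ value (R̂^×.unit u) B̂.* value (N̂.unit x) B̂.* iₐ (value k)

  private
    module J = RingMorphisms.IsRingHomomorphism iₐ-hom
    module B̂U = UnitProperties B̂-ring

    iₐ-inverse : (k : Unit K-ring) → iₐ (value k) B̂.* iₐ (inv k) B̂.≈ B̂.1#
    iₐ-inverse k = B̂.trans {iₐ (value k) B̂.* iₐ (inv k)} {iₐ (value k K.* inv k)} {B̂.1#}
      (B̂.sym {iₐ (value k K.* inv k)} {iₐ (value k) B̂.* iₐ (inv k)} (J.*-homo (value k) (inv k)))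
      (B̂.trans {iₐ (value k K.* inv k)} {iₐ K.1#} {B̂.1#}
        (J.⟦⟧-cong {value k K.* inv k} {K.1#} (inverseʳ k)) J.1#-homo)

    ≈ₒ-refl : ∀ {x} → x ≈ₒ x
    ≈ₒ-refl {x} =
      record { unit = 1ᵘ B̂-ring ; value∈R̂ = 1∈R̂ ; inv∈R̂ = 1∈R̂ } ,
      1ᵘ K-ring , B̂U.double-refl (value (N̂.unit x)) {iₐ K.1#} J.1#-homo

    ≈ₒ-sym : ∀ {x y} → x ≈ₒ y → y ≈ₒ x
    ≈ₒ-sym {x} {y} (u , k , eq) =
      record { unit = _⁻¹ᵘ B̂-ring v ; value∈R̂ = R̂^×.inv∈R̂ u ; inv∈R̂ = R̂^×.value∈R̂ u } ,
      _⁻¹ᵘ K-ring k ,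
      B̂U.double-sym {value (N̂.unit x)} {value (N̂.unit y)} {value v} {inv v}
        {iₐ (value k)} {iₐ (inv k)} (inverseˡ v) (iₐ-inverse k) eq
      where
      v : Unit B̂-ring
      v = R̂^×.unit u

    ≈ₒ-trans : ∀ {x y z} → x ≈ₒ y → y ≈ₒ z → x ≈ₒ z
    ≈ₒ-trans {x} {y} {z} (u , k , eq) (u′ , k′ , eq′) =
      record
        { unit    = _*ᵘ_ B̂-ring v′ v
        ; value∈R̂ = R̂-* {value v′} {value v} (R̂^×.value∈R̂ u′) (R̂^×.value∈R̂ u)
        ; inv∈R̂   = R̂-* {inv v} {inv v′} (R̂^×.inv∈R̂ u) (R̂^×.inv∈R̂ u′) } ,
      _*ᵘ_ K-ring k k′ ,
      B̂U.double-trans {value (N̂.unit x)} {value (N̂.unit y)} {value (N̂.unit z)}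
        {value v} {value v′} {iₐ (value k)} {iₐ (value k′)} {iₐ (value k K.* value k′)}
        (J.*-homo (value k) (value k′)) eq eq′
      where
      v v′ : Unit B̂-ring
      v  = R̂^×.unit u
      v′ = R̂^×.unit u′

  setoid : Setoid 0ℓ 0ℓ
  setoid = record
    { Carrier = N̂
    ; _≈_ = _≈ₒ_
    ; isEquivalence = record
      { refl  = λ {x} → ≈ₒ-refl {x}
      ; sym   = λ {x} {y} → ≈ₒ-sym {x} {y}
      ; trans = λ {x} {y} {z} → ≈ₒ-trans {x} {y} {z} } }

------------------------------------------------------------------------

module _ (a b : ℚ) (R : Order (quaternionAlgebra a b)) (d : ℚ) (O : Order ℚ[√ d ]) where

  -- The units x_ℓ are witnesses only: the setoid of classes ignores them.
  IsLeftIdeal : Lattice (quaternionAlgebra a b) → Set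
  IsLeftIdeal L = (ℓ : Prime#) → Completion.PrincipalFor ℤ[ ℓ ] a b R L

  specialPointClasses : Setoid 0ℓ 0ℓ
  specialPointClasses = SpecialPoints.classes (quaternionAlgebra a b) ℚ[√ d ] O IsLeftIdeal

  O-points : Embedding (Algebra.ring ℚ[√ d ]) (Algebra.ring (quaternionAlgebra a b)) → Setoid 0ℓ 0ℓ
  O-points i = DoubleCosets.setoid
    (Algebra.ring ℚ[√ d ]) (Algebra.ring (Completion.algebra Ẑ a b)) ⟦ O ⟧ₒ
    (Completion.include Ẑ a b ∘ Embedding.⟦_⟧ i)
    (∘-hom (Algebra.ring ℚ[√ d ]) (Algebra.ring (quaternionAlgebra a b)) (Algebra.ring (Completion.algebra Ẑ a b))
      (Completion.include-hom Ẑ a b) (Embedding.isRingHomomorphism i))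
    (Completion.complete Ẑ a b (Order.lattice R))
    (Completion.complete-1 Ẑ a b R) (λ {x} {y} → Completion.complete-* Ẑ a b R {x} {y})

module Submission where

-- Every embedding ψ is β i β⁻¹ for some β ∈ B^×, and β is unique up to right
-- multiplication by K^×, as K is its own centralizer. A left R-ideal 𝔞 has the
-- form 𝔞̂ = R̂ x, where x ∈ B̂^× is unique up to left multiplication by R̂^×:
-- lattices have a common bound on denominators, so that local generators form
-- an element of B̂. Sending (𝔞 , ψ) to x β is the bijection: 𝔞 = B ∩ 𝔞̂ makes it
-- injective and identifies the right order of 𝔞 with B ∩ x⁻¹ R̂ x. Conversely
-- x ∈ B̂^× comes from (B ∩ R̂ x , i). If n x, n x⁻¹ ∈ R̂ and r ∈ R is congruent to
-- n x modulo n² R̂, then R (r / n) + n R is a lattice with completion R̂ x.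

-- Generators of a lattice may be dependent, so `L = B ∩ L̂` cannot be read off from coordinates. It
-- is proved for the lattice on the basis 1, i, j, ij, where it says that a rational number in Ẑ is
-- an integer, and carried to every `L` by commensurability: as ℤ is dense in Ẑ, an element of `L̂`
-- differs from one of `L` by an element of `k L̂` for any prescribed `k ≠ 0`, and a suitable `k`
-- brings this difference back to the basis lattice. The same density supplies the congruence for
-- `r`. It is the Chinese remainder theorem taken one prime factor at a time: `p` is a unit at every
-- prime other than `p`. The conjugating `β` is explicit. If `s` and `t` are the images of √d under
-- two embeddings, then `β = s y + y t` satisfies `β t = s β` for every `y`, and definiteness makes
-- any non-zero value of it a unit.

open import Defs
open import Algebra.Bundles using (Ring; CommutativeRing)
open import Algebra.Morphism.Structures using (module RingMorphisms)
import Algebra.Properties.CommutativeSemigroup as CommutativeSemigroupProperties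
import Algebra.Properties.Ring as RingProperties
import Algebra.Properties.Semiring.Sum as Sum
import Algebra.Solver.Ring.NaturalCoefficients.Default as SemiringSolver
open import Data.Fin.Base using (zero; suc; _↑ˡ_; _↑ʳ_; splitAt)
open import Data.Integer.Base as ℤ using (ℤ; +_; -[1+_])
import Data.Integer.Divisibility.Signed as ℤ
import Data.Integer.Properties as ℤ
open import Data.Integer.Tactic.RingSolver using (solve-∀)
open import Data.List.Base using ([]; _∷_)
open import Data.List.Relation.Unary.All using (All; []; _∷_)
open import Data.Nat.Base as ℕ using (ℕ; zero; suc; NonZero)
open import Data.Nat.Coprimality as ℕ using (Coprime; coprime-Bézout)
import Data.Nat.Divisibility as ℕ
open import Data.Nat.GCD using (module Bézout)
open import Data.Nat.Induction using (<-rec)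
open import Data.Nat.ListAction using (product)
open import Data.Nat.Primality using (Prime; prime?; euclidsLemma; prime⇒irreducible; prime⇒nonZero; prime⇒nonTrivial; ¬prime[1])
open import Data.Nat.Primality.Factorisation using (factorise; module PrimeFactorisation)
import Data.Nat.Properties as ℕ
open import Data.Product.Base using (∃; ∃₂; _×_; _,_; proj₁; proj₂)
open import Data.Rational.Base as ℚ using (ℚ; mkℚ; 0ℚ; 1ℚ)
import Data.Rational.Literals as ℚ using (fromℤ)
import Data.Rational.Properties as ℚ
open import Data.Rational.Solver using (module +-*-Solver)
import Data.Rational.Unnormalised.Base as ℚᵘ
import Data.Rational.Unnormalised.Properties as ℚᵘ
open import Data.Sum.Base using (_⊎_; inj₁; inj₂) renaming (map₂ to ⊎-map₂)
open import Data.Unit.Base using (tt)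
open import Data.Vec.Functional using (Vector; _++_)
open import Data.Vec.Functional.Properties using (lookup-++ˡ; lookup-++ʳ)
open import Function.Base using (_∘_)
open import Function.Bundles using (Bijection)
open import Level using (0ℓ)
open import Relation.Binary.Bundles using (Setoid)
open import Relation.Binary.PropositionalEquality as ≡ using (_≡_; _≢_)
import Relation.Binary.Reasoning.Setoid as SetoidReasoning
open import Relation.Nullary.Decidable.Core using (yes; no; recompute)
open import Relation.Nullary.Negation.Core using (¬_; contradiction)
open import Relation.Unary using (Pred; _∈_; _⊆_; _≐_)

-- Adic and profinite integers

-- The primality proof in `Prime#` is irrelevant; since primality is decidable, it can be
-- recomputed.
prime : (ℓ : Prime#) → Prime (Prime#.value ℓ)
prime (prime# ℓ p) = recompute (prime? ℓ) p

-- Euclid's lemma takes one factor `ℓ` out of `x` at a time.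
∤⇒^∣-cancelˡ : ∀ {ℓ n} → Prime ℓ → ℓ ℕ.∤ n → ∀ m x → ℓ ℕ.^ m ℕ.∣ n ℕ.* x → ℓ ℕ.^ m ℕ.∣ x
∤⇒^∣-cancelˡ p ℓ∤n zero x _ = ℕ.1∣ x
∤⇒^∣-cancelˡ {ℓ} {n} p ℓ∤n (suc m) x h with euclidsLemma n x p (ℕ.∣-trans (ℕ.m∣m*n (ℓ ℕ.^ m)) h)
... | inj₁ ℓ∣n = contradiction ℓ∣n ℓ∤n
... | inj₂ (ℕ.divides y ≡.refl) = ≡.subst (ℓ ℕ.^ suc m ℕ.∣_) (ℕ.*-comm ℓ y)
  (ℕ.*-monoʳ-∣ ℓ (∤⇒^∣-cancelˡ p ℓ∤n m y
    (ℕ.*-cancelˡ-∣ ℓ {{prime⇒nonZero p}} (≡.subst (ℓ ℕ.^ suc m ℕ.∣_)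
      (≡.trans (≡.sym (ℕ.*-assoc n y ℓ)) (ℕ.*-comm (n ℕ.* y) ℓ)) h))))

^-monoʳ-∣ : ∀ k {m n} → m ℕ.≤ n → k ℕ.^ m ℕ.∣ k ℕ.^ n
^-monoʳ-∣ k {m} {n} m≤n = ≡.subst (k ℕ.^ m ℕ.∣_)
  (≡.trans (≡.sym (ℕ.^-distribˡ-+-* k m (n ℕ.∸ m))) (≡.cong (k ℕ.^_) (ℕ.m+[n∸m]≡n m≤n)))
  (ℕ.m∣m*n (k ℕ.^ (n ℕ.∸ m)))

-- The ℓ-adic valuation of n is at most n.
^∣-cancelˡ : ∀ {ℓ} → Prime ℓ → ∀ n .{{_ : NonZero n}} m x →
             ℓ ℕ.^ (m ℕ.+ n) ℕ.∣ n ℕ.* x → ℓ ℕ.^ m ℕ.∣ x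
^∣-cancelˡ {ℓ} p = <-rec (λ n → .{{_ : NonZero n}} → ∀ m x → ℓ ℕ.^ (m ℕ.+ n) ℕ.∣ n ℕ.* x → ℓ ℕ.^ m ℕ.∣ x) step
  where
  instance
    _ = prime⇒nonZero p
    _ = prime⇒nonTrivial p
  step : ∀ n → (∀ {k} → k ℕ.< n → .{{_ : NonZero k}} → ∀ m x → ℓ ℕ.^ (m ℕ.+ k) ℕ.∣ k ℕ.* x → ℓ ℕ.^ m ℕ.∣ x) →
         .{{_ : NonZero n}} → ∀ m x → ℓ ℕ.^ (m ℕ.+ n) ℕ.∣ n ℕ.* x → ℓ ℕ.^ m ℕ.∣ x
  step n rec m x h with ℓ ℕ.∣? n
  ... | no ℓ∤n = ∤⇒^∣-cancelˡ p ℓ∤n m x (ℕ.∣-trans (^-monoʳ-∣ ℓ (ℕ.m≤m+n m n)) h)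
  -- Cancelling one `ℓ` lowers the exponent by one, while the bound drops from `k * ℓ` to `k`, that
  -- is by at least one.
  ... | yes (ℕ.divides k ≡.refl) = rec k<kℓ m x (ℕ.*-cancelˡ-∣ ℓ
    (≡.subst₂ ℕ._∣_ (≡.cong (ℓ ℕ.^_) (ℕ.+-suc m k))
      (≡.trans (≡.cong (ℕ._* x) (ℕ.*-comm k ℓ)) (ℕ.*-assoc ℓ k x))
      (ℕ.∣-trans (^-monoʳ-∣ ℓ (ℕ.+-monoʳ-≤ m k<kℓ)) h)))
    where
    instance _ = ℕ.m*n≢0⇒m≢0 k {ℓ}
    k<kℓ : k ℕ.< k ℕ.* ℓ
    k<kℓ = ℕ.m<m*n k ℓ (ℕ.nonTrivial⇒n>1 ℓ)

module _ (ℓ : Prime#) where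
  private
    p = Prime#.value ℓ
    module Zₗ = CommutativeRing (Adic.commutativeRing p)
    module C (n : ℕ) = Congruence (+ (p ℕ.^ n))
  open Adic.ℤₗ
  open Adic._≈ₗ_
  open Adic using (mk≈; mkℤₗ)

  coherent-+ : ∀ x k n → C._≋_ n (residue x (n ℕ.+ k)) (residue x n)
  coherent-+ x zero n = C.≋-reflexive n (≡.cong (residue x) (ℕ.+-identityʳ n))
  coherent-+ x (suc k) n = C.≋-trans n {residue x (n ℕ.+ suc k)} {residue x (n ℕ.+ k)} {residue x n}
    (≡.subst (λ m → C._≋_ n (residue x m) (residue x (n ℕ.+ k))) (≡.sym (ℕ.+-suc n k))
      (ℤ.∣-trans (ℤ.∣ᵤ⇒∣ (^-monoʳ-∣ p (ℕ.m≤m+n n k))) (coherent x (n ℕ.+ k))))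
    (coherent-+ x k n)

  -- Cancelling `n` costs at most `n` digits, so the residues modulo `p ^ m` are compared at level
  -- `m + n`; coherence leads back to level `m`.
  ℤₗ-torsion-free : ∀ n .{{_ : NonZero n}} {x y} →
    Adic.fromℤ p (+ n) Zₗ.* x Zₗ.≈ Adic.fromℤ p (+ n) Zₗ.* y → x Zₗ.≈ y
  ℤₗ-torsion-free n {x} {y} eq = mk≈ λ m →
    let X = residue x (m ℕ.+ n) ; Y = residue y (m ℕ.+ n) in
    C.≋-trans m {residue x m} {X} {residue y m} (C.≋-sym m {X} {residue x m} (coherent-+ x n m))
      (C.≋-trans m {X} {Y} {residue y m}
        (ℤ.∣ᵤ⇒∣ (^∣-cancelˡ (prime ℓ) n m ℤ.∣ X ℤ.- Y ∣
          (≡.subst (p ℕ.^ (m ℕ.+ n) ℕ.∣_) (≡.trans (≡.cong ℤ.∣_∣ (distrib (+ n) X Y)) (ℤ.abs-* (+ n) (X ℤ.- Y)))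
            (ℤ.∣⇒∣ᵤ (at eq (m ℕ.+ n))))))
        (coherent-+ y n m))
    where
    distrib : ∀ n x y → n ℤ.* x ℤ.+ ℤ.- (n ℤ.* y) ≡ n ℤ.* (x ℤ.+ ℤ.- y)
    distrib = solve-∀

prime-∤-^ : ∀ {p q} → Prime p → Prime q → p ≢ q → ∀ n → p ℕ.∤ q ℕ.^ n
prime-∤-^ pp pq p≢q zero p∣1 = ¬prime[1] (≡.subst Prime (ℕ.∣1⇒≡1 p∣1) pp)
prime-∤-^ {p} {q} pp pq p≢q (suc n) h with euclidsLemma q (q ℕ.^ n) pp h
... | inj₂ h′ = prime-∤-^ pp pq p≢q n h′
... | inj₁ p∣q with prime⇒irreducible pq p∣q
...   | inj₁ p≡1 = ¬prime[1] (≡.subst Prime p≡1 pp)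
...   | inj₂ p≡q = p≢q p≡q

prime-∤⇒coprime : ∀ {p n} → Prime p → p ℕ.∤ n → Coprime p n
prime-∤⇒coprime pp p∤n (d∣p , d∣n) with prime⇒irreducible pp d∣p
... | inj₁ d≡1 = d≡1
... | inj₂ ≡.refl = contradiction d∣n p∤n

coprime⇒inverse : ∀ {m n} → Coprime m n → ∃ λ u → + n ℤ.∣ (+ m ℤ.* u) ℤ.- ℤ.1ℤ
coprime⇒inverse {m} {n} c with coprime-Bézout c
... | Bézout.+- x y eq = + x , ℤ.divides (+ y) (≡.trans
  (≡.cong (ℤ._- ℤ.1ℤ) (≡.trans (≡.trans (≡.sym (ℤ.pos-* m x)) (≡.cong +_ (≡.trans (ℕ.*-comm m x) (≡.sym eq))))
    (≡.trans (ℤ.pos-+ 1 (y ℕ.* n)) (≡.cong (ℤ._+_ ℤ.1ℤ) (ℤ.pos-* y n))))) (lemma (+ y ℤ.* + n)))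
  where
  lemma : ∀ z → (ℤ.1ℤ ℤ.+ z) ℤ.- ℤ.1ℤ ≡ z
  lemma = solve-∀
... | Bézout.-+ x y eq = ℤ.- + x , ℤ.divides (ℤ.- + y) (≡.trans
  (lemma (+ m) (+ x))
  (≡.trans (≡.cong ℤ.-_ (≡.trans (≡.trans (≡.cong (ℤ._+_ ℤ.1ℤ) (≡.sym (ℤ.pos-* x m))) (≡.sym (ℤ.pos-+ 1 (x ℕ.* m))))
    (≡.trans (≡.cong +_ eq) (ℤ.pos-* y n)))) (ℤ.neg-distribˡ-* (+ y) (+ n))))
  where
  lemma : ∀ m x → m ℤ.* (ℤ.- x) ℤ.- ℤ.1ℤ ≡ ℤ.- (ℤ.1ℤ ℤ.+ x ℤ.* m)
  lemma = solve-∀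

-- Density of ℤ in Ẑ

module Ẑ = CommutativeRing Profinite.commutativeRing

module _ (p : Prime#) where
  private
    q = Prime#.value p
    pq = prime p
    instance _ = prime⇒nonZero pq
    module C (ℓ n : ℕ) = Congruence (+ (ℓ ℕ.^ n))
  open Adic.ℤₗ
  open Adic using (mk≈; mkℤₗ)

  private
    -- Division by `q` may be carried out level by level, provided that the quotients cohere.
    adic-division : ∀ ℓ (c : Adic.ℤₗ ℓ) c′ (e : ℕ → ℤ) →
      (∀ n → C._≋_ ℓ n (+ q ℤ.* e n) (residue c n ℤ.- c′)) →
      (∀ n → C._≋_ ℓ n (e (suc n)) (e n)) →
      ∃ λ e → CommutativeRing._≈_ (Adic.commutativeRing ℓ) c
        (CommutativeRing._+_ (Adic.commutativeRing ℓ) (Adic.fromℤ ℓ c′)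
          (CommutativeRing._*_ (Adic.commutativeRing ℓ) (Adic.fromℤ ℓ (+ q)) e))
    adic-division ℓ c c′ e div coh = mkℤₗ e coh , mk≈ λ n →
      ≡.subst (+ (ℓ ℕ.^ n) ℤ.∣_) (lemma (+ q ℤ.* e n) (residue c n) c′) (ℤ.∣m⇒∣-m (div n))
      where
      lemma : ∀ x c c′ → ℤ.- (x ℤ.- (c ℤ.- c′)) ≡ c ℤ.- (c′ ℤ.+ x)
      lemma = solve-∀

    -- At `ℓ = q` divisibility by `q` is decided by the first digit; at any other prime `q` is a
    -- unit. Thus the hypothesis is conditional, and one integer `c′` can serve all primes at once.
    divide-residue : ∀ ℓ (c : Adic.ℤₗ (Prime#.value ℓ)) c′ → (Prime#.value ℓ ≡ q → + q ℤ.∣ residue c 1 ℤ.- c′) →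
      ∃ λ e → CommutativeRing._≈_ (Adic.commutativeRing (Prime#.value ℓ)) c
        (CommutativeRing._+_ (Adic.commutativeRing (Prime#.value ℓ)) (Adic.fromℤ (Prime#.value ℓ) c′)
          (CommutativeRing._*_ (Adic.commutativeRing (Prime#.value ℓ)) (Adic.fromℤ (Prime#.value ℓ) (+ q)) e))
    divide-residue ℓ c c′ h with Prime#.value ℓ ℕ.≟ q
    -- Division by `q` loses a digit: level `n` of the quotient is read off from level `n + 1` of
    -- `c`.
    ... | yes ≡.refl = adic-division q c c′ e
      (λ n → ≡.subst (+ (q ℕ.^ n) ℤ.∣_) (lemma₁ (residue c (suc n)) (residue c n) c′ _ (eq n)) (coherent c n))
      (λ n → ℤ.*-cancelˡ-∣ (+ q) (≡.subst₂ ℤ._∣_ (ℤ.pos-* q (q ℕ.^ n))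
        (lemma₂ (residue c (suc (suc n))) (residue c (suc n)) c′ (e (suc n)) (e n) (+ q) (eq (suc n)) (eq n))
        (coherent c (suc n))))
      where
      q∣ : ∀ n → + q ℤ.∣ residue c (suc n) ℤ.- c′
      q∣ n = Congruence.≋-trans (+ q) {residue c (suc n)} {residue c 1} {c′}
        (≡.subst (λ k → + k ℤ.∣ residue c (suc n) ℤ.- residue c 1) (ℕ.*-identityʳ q)
          (coherent-+ p c n 1)) (h ≡.refl)
      e : ℕ → ℤ
      e n = ℤ._∣_.quotient (q∣ n)
      eq : ∀ n → residue c (suc n) ℤ.- c′ ≡ + q ℤ.* e n
      eq n = ≡.trans (ℤ._∣_.equality (q∣ n)) (ℤ.*-comm (e n) (+ q))
      lemma₁ : ∀ x y z w → x ℤ.- z ≡ w → x ℤ.- y ≡ w ℤ.- (y ℤ.- z)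
      lemma₁ x y z w ≡.refl = go x y z
        where
        go : ∀ x y z → x ℤ.- y ≡ (x ℤ.- z) ℤ.- (y ℤ.- z)
        go = solve-∀
      lemma₂ : ∀ x y z e e′ q → x ℤ.- z ≡ q ℤ.* e → y ℤ.- z ≡ q ℤ.* e′ → x ℤ.- y ≡ q ℤ.* (e ℤ.- e′)
      lemma₂ x y z e e′ q h h′ = ≡.trans (go x y z) (≡.trans (cong₂′ h h′) (go′ q e e′))
        where
        cong₂′ : ∀ {a b c d : ℤ} → a ≡ b → c ≡ d → a ℤ.- c ≡ b ℤ.- d
        cong₂′ ≡.refl ≡.refl = ≡.refl
        go : ∀ x y z → x ℤ.- y ≡ (x ℤ.- z) ℤ.- (y ℤ.- z)
        go = solve-∀
        go′ : ∀ q e e′ → q ℤ.* e ℤ.- q ℤ.* e′ ≡ q ℤ.* (e ℤ.- e′)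
        go′ = solve-∀
    -- The inverses of `q` modulo the powers of `l` come from Bézout independently at each level.
    -- Their quotients cohere because `q` times the difference is divisible by `l ^ n` and `l` does
    -- not divide `q`.
    ... | no ℓ≢q = adic-division l c c′ e div
      (λ n → ℤ.∣ᵤ⇒∣ (∤⇒^∣-cancelˡ (prime ℓ) l∤q n ℤ.∣ e (suc n) ℤ.- e n ∣
        (≡.subst (l ℕ.^ n ℕ.∣_) (ℤ.abs-* (+ q) (e (suc n) ℤ.- e n)) (ℤ.∣⇒∣ᵤ (coh n)))))
      where
      l = Prime#.value ℓ
      l∤q : l ℕ.∤ q
      l∤q h with prime⇒irreducible pq h
      ... | inj₁ l≡1 = ¬prime[1] (≡.subst Prime l≡1 (prime ℓ))
      ... | inj₂ l≡q = ℓ≢q l≡q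
      inverse : ∀ n → ∃ λ u → + (l ℕ.^ n) ℤ.∣ (+ q ℤ.* u) ℤ.- ℤ.1ℤ
      inverse n = coprime⇒inverse (prime-∤⇒coprime pq (prime-∤-^ pq (prime ℓ) (λ q≡l → ℓ≢q (≡.sym q≡l)) n))
      e : ℕ → ℤ
      e n = proj₁ (inverse n) ℤ.* (residue c n ℤ.- c′)
      div : ∀ n → C._≋_ l n (+ q ℤ.* e n) (residue c n ℤ.- c′)
      div n = ≡.subst (+ (l ℕ.^ n) ℤ.∣_) (lemma (+ q) (proj₁ (inverse n)) (residue c n ℤ.- c′))
        (ℤ.∣m⇒∣m*n (residue c n ℤ.- c′) (proj₂ (inverse n)))
        where
        lemma : ∀ q u x → (q ℤ.* u ℤ.- ℤ.1ℤ) ℤ.* x ≡ q ℤ.* (u ℤ.* x) ℤ.- x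
        lemma = solve-∀
      coh : ∀ n → + (l ℕ.^ n) ℤ.∣ + q ℤ.* (e (suc n) ℤ.- e n)
      coh n = ≡.subst (+ (l ℕ.^ n) ℤ.∣_) (lemma (+ q) (e (suc n)) (e n) (residue c (suc n)) (residue c n) c′)
        (ℤ.∣m∣n⇒∣m-n (ℤ.∣m∣n⇒∣m+n
          (ℤ.∣-trans (ℤ.∣ᵤ⇒∣ (^-monoʳ-∣ l (ℕ.n≤1+n n))) (div (suc n))) (coherent c n)) (div n))
        where
        lemma : ∀ q e e′ c x c′ → ((q ℤ.* e ℤ.- (c ℤ.- c′)) ℤ.+ (c ℤ.- x)) ℤ.- (q ℤ.* e′ ℤ.- (x ℤ.- c′)) ≡ q ℤ.* (e ℤ.- e′)
        lemma = solve-∀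

  prime-density : ∀ c → ∃₂ λ c′ e → c Ẑ.≈ (Profinite.fromℤ c′ Ẑ.+ Profinite.fromℤ (+ q) Ẑ.* e)
  prime-density c = c′ , (λ ℓ → proj₁ (divided ℓ)) , (λ ℓ → proj₂ (divided ℓ))
    where
    c′ = residue (c p) 1
    congruent : ∀ ℓ → Prime#.value ℓ ≡ q → + q ℤ.∣ residue (c ℓ) 1 ℤ.- c′
    -- An index with value `q` is `p` itself, as primality proofs are irrelevant.
    congruent (prime# _ _) ≡.refl = Congruence.≋-reflexive (+ q) {c′} ≡.refl
    divided : ∀ ℓ → _
    divided ℓ = divide-residue ℓ (c ℓ) c′ (congruent ℓ)

opaque
  -- Induction over the prime factors of `n`: if `c = c′ + p e` and `e = c″ + n′ e′`, then
  -- `c = (c′ + p c″) + p n′ e′`.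
  density : ∀ n .{{_ : NonZero n}} c → ∃₂ λ c′ e → c Ẑ.≈ (Profinite.fromℤ c′ Ẑ.+ Profinite.fromℤ (+ n) Ẑ.* e)
  density n = ≡.subst (λ n → ∀ c → ∃₂ λ c′ e → c Ẑ.≈ (Profinite.fromℤ c′ Ẑ.+ Profinite.fromℤ (+ n) Ẑ.* e))
    (≡.sym isFactorisation) (go factors factorsPrime)
    where
    open PrimeFactorisation (factorise n)
    go : ∀ ps → All Prime ps → ∀ c → ∃₂ λ c′ e → c Ẑ.≈ (Profinite.fromℤ c′ Ẑ.+ Profinite.fromℤ (+ product ps) Ẑ.* e)
    go [] [] c = ℤ.0ℤ , c , λ ℓ → Adic.mk≈ λ n → Congruence.≋-reflexive _ (lemma (Adic.ℤₗ.residue (c ℓ) n))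
      where
      lemma : ∀ x → x ≡ ℤ.0ℤ ℤ.+ ℤ.1ℤ ℤ.* x
      lemma = solve-∀
    go (p ∷ ps) (pp ∷ pps) c with prime-density (prime# p pp) c
    ... | c′ , e , c≈ with go ps pps e
    ...   | c″ , e′ , e≈ = c′ ℤ.+ + p ℤ.* c″ , e′ ,
      Ẑ.trans {c} {Profinite.fromℤ c′ Ẑ.+ Profinite.fromℤ (+ p) Ẑ.* e} {_} c≈
        (Ẑ.trans {Profinite.fromℤ c′ Ẑ.+ Profinite.fromℤ (+ p) Ẑ.* e}
          {Profinite.fromℤ c′ Ẑ.+ Profinite.fromℤ (+ p) Ẑ.* (Profinite.fromℤ c″ Ẑ.+ Profinite.fromℤ (+ product ps) Ẑ.* e′)} {_}
          (Ẑ.+-congˡ {Profinite.fromℤ c′} {Profinite.fromℤ (+ p) Ẑ.* e} {_}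
            (Ẑ.*-congˡ {Profinite.fromℤ (+ p)} {e} {_} e≈))
          λ ℓ → Adic.mk≈ λ n → Congruence.≋-reflexive _
            (≡.trans (lemma c′ (+ p) c″ (+ product ps) (Adic.ℤₗ.residue (e′ ℓ) n))
              (≡.cong (λ m → (c′ ℤ.+ + p ℤ.* c″) ℤ.+ m ℤ.* Adic.ℤₗ.residue (e′ ℓ) n) (≡.sym (ℤ.pos-* p (product ps))))))
      where
      lemma : ∀ c p c′ n e → c ℤ.+ p ℤ.* (c′ ℤ.+ n ℤ.* e) ≡ (c ℤ.+ p ℤ.* c′) ℤ.+ (p ℤ.* n) ℤ.* e
      lemma = solve-∀

primeDivisor : ∀ n → ∃ λ p → Prime p × p ℕ.∣ suc (suc n)
primeDivisor n with factorise (suc (suc n))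
... | record { factors = p ∷ ps ; isFactorisation = eq ; factorsPrime = pp ∷ _ } =
  p , pp , ℕ.divides (product ps) (≡.trans eq (ℕ.*-comm p (product ps)))

-- Finite adeles and their components

module Rat (C : Coefficients) = Rationalisation (Coefficients.A C) (Coefficients.ι C) (Coefficients.ι-hom C)
module Ẑℚ = Rat Ẑ
module ℤₗℚ (ℓ : Prime#) = Rat ℤ[ ℓ ]

component : ∀ ℓ → Ẑℚ.Fraction → ℤₗℚ.Fraction ℓ
component ℓ (Ẑℚ.mkFraction x n) = record { numerator = x ℓ ; denominator-1 = n }

component-hom : ∀ ℓ → Hom Ẑℚ.ring (ℤₗℚ.ring ℓ) (component ℓ)
component-hom ℓ = mkHom Ẑℚ.ring (ℤₗℚ.ring ℓ)
  (λ (Ẑℚ.equal k eq) → record { factor = k ; cross = eq ℓ })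
  (λ x y → Aℚ.refl {component ℓ (x Ẑℚ.+ᶠ y)}) (λ x y → Aℚ.refl {component ℓ (x Ẑℚ.*ᶠ y)})
  (Aℚ.refl {component ℓ Ẑℚ.0ᶠ}) (Aℚ.refl {component ℓ Ẑℚ.1ᶠ}) (λ x → Aℚ.refl {component ℓ (Ẑℚ.-ᶠ x)})
  where
  module Aℚ = CommutativeRing (ℤₗℚ.commutativeRing ℓ)

-- Torsion-freeness of ℤ_ℓ makes the extra factor in the equality of
-- fractions uniform in ℓ.
component-injective : ∀ {x y} → (∀ ℓ → ℤₗℚ._≃_ ℓ (component ℓ x) (component ℓ y)) → x Ẑℚ.≃ y
component-injective {Ẑℚ.mkFraction x m} {Ẑℚ.mkFraction y n} h = Ẑℚ.equal 0 λ ℓ →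
  let module Zₗ = CommutativeRing (Coefficients.A ℤ[ ℓ ]) in
  Zₗ.*-congˡ {ℤₗℚ.D ℓ 0} {x ℓ Zₗ.* ℤₗℚ.D ℓ n} {y ℓ Zₗ.* ℤₗℚ.D ℓ m} (cross ℓ (h ℓ))
  where
  cross : ∀ ℓ → ℤₗℚ._≃_ ℓ (record { numerator = x ℓ ; denominator-1 = m }) (record { numerator = y ℓ ; denominator-1 = n }) →
    let module Zₗ = CommutativeRing (Coefficients.A ℤ[ ℓ ]) in x ℓ Zₗ.* ℤₗℚ.D ℓ n Zₗ.≈ y ℓ Zₗ.* ℤₗℚ.D ℓ m
  cross ℓ (ℤₗℚ.equal k eq) = ℤₗ-torsion-free ℓ (suc k) eq

-- A prime dividing the denominator of `q` would also divide the numerator, as the equation read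
-- modulo this prime shows; lowest terms exclude this. In short, ℚ ∩ Ẑ = ℤ.
integral : ∀ q {c} → Ẑℚ.fromℚ q Ẑℚ.≃ Ẑℚ.fromA c → ∃ λ m → q ≡ ℚ.fromℤ m
integral (mkℚ n zero _) _ = n , ≡.refl
integral (mkℚ n (suc d) coprime) {c} (Ẑℚ.equal k eq) = contradiction (≡.subst Prime p≡1 pp) ¬prime[1]
  where
  p : ℕ
  p = proj₁ (primeDivisor d)
  pp : Prime p
  pp = proj₁ (proj₂ (primeDivisor d))
  ℓ : Prime#
  ℓ = prime# p pp
  c₁ : ℤ
  c₁ = Adic.ℤₗ.residue (c ℓ) 1
  n≈ : + (p ℕ.^ 1) ℤ.∣ n ℤ.* ℤ.1ℤ ℤ.- c₁ ℤ.* (+ suc (suc d))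
  n≈ = Adic._≈ₗ_.at (ℤₗ-torsion-free ℓ (suc k) (eq ℓ)) 1
  p∣n : + p ℤ.∣ n
  p∣n = ≡.subst (+ p ℤ.∣_) (lemma n (c₁ ℤ.* (+ suc (suc d))))
    (ℤ.∣m∣n⇒∣m+n (≡.subst (λ k → + k ℤ.∣ n ℤ.* ℤ.1ℤ ℤ.- c₁ ℤ.* (+ suc (suc d))) (ℕ.*-identityʳ p) n≈)
      (ℤ.∣n⇒∣m*n c₁ {+ suc (suc d)} (ℤ.∣ᵤ⇒∣ (proj₂ (proj₂ (primeDivisor d))))))
    where
    lemma : ∀ n x → (n ℤ.* ℤ.1ℤ ℤ.- x) ℤ.+ x ≡ n
    lemma = solve-∀
  p≡1 : p ≡ 1
  p≡1 = ℕ.recompute coprime (ℤ.∣⇒∣ᵤ p∣n , proj₂ (proj₂ (primeDivisor d)))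

-- Spans and bounded denominators

module _ {S : CommutativeRing 0ℓ 0ℓ} (V : Algebra S) where
  private module S = CommutativeRing S
  open Algebra V hiding (zero)
  open SpanProperties V
  open SetoidReasoning setoid

  span-elim : ∀ {n} {g : Vector Carrier n} (P : Pred Carrier 0ℓ) →
    (∀ {x y} → x ≈ y → x ∈ P → y ∈ P) → 0# ∈ P → (∀ {x y} → x ∈ P → y ∈ P → x + y ∈ P) →
    (∀ s i → scalar s * g i ∈ P) → Span V g ⊆ P
  span-elim {g = g} P resp P0 P+ Pg (c , x≈) = resp (sym x≈) (sum-∈ (λ i → scalar (c i) * g i) (λ i → Pg (c i) i))
    where
    open Sum semiring
    sum-∈ : ∀ {n} (v : Vector Carrier n) → (∀ i → v i ∈ P) → sum v ∈ P
    sum-∈ {zero}  v h = P0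
    sum-∈ {suc n} v h = P+ (h zero) (sum-∈ (v ∘ suc) (h ∘ suc))

  span-neg : ∀ {n} {g : Vector Carrier n} {x} → x ∈ Span V g → - x ∈ Span V g
  span-neg {g = g} {x} x∈ = span-resp {g = g} (begin
    scalar (S.- S.1#) * x ≈⟨ *-congʳ (scalar.-‿homo S.1#) ⟩
    - scalar S.1# * x     ≈⟨ -‿distribˡ-* _ x ⟨
    - (scalar S.1# * x)   ≈⟨ -‿cong (trans (*-congʳ scalar.1#-homo) (*-identityˡ x)) ⟩
    - x                   ∎) (span-scale (S.- S.1#) x∈)
    where open RingProperties ring

  scalar-* : ∀ s x y → (scalar s * x) * y ≈ scalar s * (x * y)
  scalar-* s = *-assoc (scalar s)

  *-scalar : ∀ s x y → x * (scalar s * y) ≈ scalar s * (x * y)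
  *-scalar s x y = begin
    x * (scalar s * y) ≈⟨ *-assoc _ _ _ ⟨
    x * scalar s * y   ≈⟨ *-congʳ (scalar-central s x) ⟨
    scalar s * x * y   ≈⟨ *-assoc _ _ _ ⟩
    scalar s * (x * y) ∎

  span-*ʳ : ∀ {n m} {g : Vector Carrier n} {h : Vector Carrier m} y →
    (∀ i → g i * y ∈ Span V h) → ∀ {x} → x ∈ Span V g → x * y ∈ Span V h
  span-*ʳ {h = h} y gy∈ = span-elim (λ x → x * y ∈ Span V h)
    (λ eq → span-resp {g = h} (*-congʳ eq))
    (span-resp {g = h} (sym (zeroˡ y)) (span-0 h))
    (λ {x} {x′} p q → span-resp {g = h} (sym (distribʳ y x x′)) (span-+ p q))
    (λ s i → span-resp {g = h} (sym (scalar-* s _ y)) (span-scale s (gy∈ i)))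

  span-scalarˡ : ∀ {n m} {g : Vector Carrier n} {h : Vector Carrier m} s →
    (∀ i → scalar s * g i ∈ Span V h) → ∀ {x} → x ∈ Span V g → scalar s * x ∈ Span V h
  span-scalarˡ {h = h} s sg∈ = span-elim (λ x → scalar s * x ∈ Span V h)
    (λ eq → span-resp {g = h} (*-congˡ eq))
    (span-resp {g = h} (sym (zeroʳ _)) (span-0 h))
    (λ {x} {y} p q → span-resp {g = h} (sym (distribˡ _ x y)) (span-+ p q))
    (λ t i → span-resp {g = h} (sym (*-scalar t _ _)) (span-scale t (sg∈ i)))

  span-mono : ∀ {n m} {g : Vector Carrier n} {h : Vector Carrier m} →
    (∀ i → g i ∈ Span V h) → Span V g ⊆ Span V h
  span-mono {h = h} g∈ = span-elim (Span V h) (span-resp {g = h}) (span-0 h) span-+ (λ s i → span-scale s (g∈ i))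

  span-cong : ∀ {n} {g h : Vector Carrier n} → (∀ i → g i ≈ h i) → Span V g ⊆ Span V h
  span-cong {h = h} g≈h = span-mono λ i → span-resp {g = h} (sym (g≈h i)) (span-generator {g = h} i)

  module Multiples (ι : ℤ → S.Carrier) (ι-hom : Hom (CommutativeRing.ring ℤ-ring) S.ring ι) where
    private module ι = RingMorphisms.IsRingHomomorphism ι-hom

    -- `[ n ]` is the integer `n + 1`, so that every index stands for a non-zero multiple; `m ⊛ n`
    -- is the index of the product.
    [_] : ℕ → Carrier
    [ n ] = scalar (ι (+ suc n))

    _⊛_ : ℕ → ℕ → ℕ
    m ⊛ n = n ℕ.+ m ℕ.* suc n

    [⊛] : ∀ m n → [ m ⊛ n ] ≈ [ m ] * [ n ]
    [⊛] m n = trans (scalar.⟦⟧-cong (ι.*-homo (+ suc m) (+ suc n))) (scalar.*-homo _ _)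

    [⊛]-*ˡ : ∀ m n x → [ m ⊛ n ] * x ≈ [ m ] * ([ n ] * x)
    [⊛]-*ˡ m n x = trans (*-congʳ ([⊛] m n)) (*-assoc _ _ _)

    [⊛]-*ʳ : ∀ m n x → [ m ⊛ n ] * x ≈ [ n ] * ([ m ] * x)
    [⊛]-*ʳ m n x = trans ([⊛]-*ˡ m n x) (*-scalar _ [ m ] x)

    Bounded : ∀ {n} → Vector Carrier n → Pred Carrier 0ℓ
    Bounded g x = ∃ λ n → [ n ] * x ∈ Span V g

    module _ {k} {g : Vector Carrier k} where

      bounded-resp : ∀ {x y} → x ≈ y → Bounded g x → Bounded g y
      bounded-resp eq (n , p) = n , span-resp {g = g} (*-congˡ eq) p

      bounded-0 : Bounded g 0#
      bounded-0 = 0 , span-resp {g = g} (sym (zeroʳ _)) (span-0 g)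

      bounded-+ : ∀ {x y} → Bounded g x → Bounded g y → Bounded g (x + y)
      bounded-+ {x} {y} (m , p) (n , q) = m ⊛ n , span-resp {g = g}
        (begin
          [ n ] * ([ m ] * x) + [ m ] * ([ n ] * y) ≈⟨ +-cong ([⊛]-*ʳ m n x) ([⊛]-*ˡ m n y) ⟨
          [ m ⊛ n ] * x + [ m ⊛ n ] * y             ≈⟨ distribˡ _ x y ⟨
          [ m ⊛ n ] * (x + y)                       ∎)
        (span-+ (span-scale _ p) (span-scale _ q))

      uniformly-bounded : ∀ {m} (v : Vector Carrier m) → (∀ i → Bounded g (v i)) →
        ∃ λ n → ∀ i → [ n ] * v i ∈ Span V g
      uniformly-bounded {zero} v h = 0 , λ ()
      uniformly-bounded {suc _} v h with h zero | uniformly-bounded (v ∘ suc) (h ∘ suc)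
      ... | m , p | n , q = m ⊛ n , λ
        { zero    → span-resp {g = g} (sym ([⊛]-*ʳ m n _)) (span-scale _ p)
        ; (suc i) → span-resp {g = g} (sym ([⊛]-*ˡ m n _)) (span-scale _ (q i)) }

denominator-* : ∀ q → ℚ.fromℤ (ℚ.denominator q) ℚ.* q ≡ ℚ.fromℤ (ℚ.numerator q)
denominator-* q@(mkℚ n d _) = ℚ.toℚᵘ-injective (ℚᵘ.≃-trans (ℚ.toℚᵘ-homo-* (ℚ.fromℤ (ℚ.denominator q)) q)
  (ℚᵘ.*≡* (≡.trans (ℤ.*-identityʳ _) (≡.trans (ℤ.*-comm (+ suc d) n)
    (≡.cong (λ m → n ℤ.* (+ suc m)) (≡.sym (ℕ.+-identityʳ d)))))))

ℤ-id-hom : Hom (CommutativeRing.ring ℤ-ring) (CommutativeRing.ring ℤ-ring) (λ n → n)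
ℤ-id-hom = mkHom (CommutativeRing.ring ℤ-ring) (CommutativeRing.ring ℤ-ring)
  (λ p → p) (λ _ _ → ≡.refl) (λ _ _ → ≡.refl) ≡.refl ≡.refl (λ _ → ≡.refl)

module ℚ-Multiples (V : ℚ-Algebra) where
  private module V = Algebra V
  open Algebra V hiding (zero)
  open Multiples (overℤ V) (λ n → n) ℤ-id-hom public

  [_]⁻¹ : ℕ → Carrier
  [ n ]⁻¹ = scalar (ℚ.1/ ℚ.fromℤ (+ suc n))

  []-inverseʳ : ∀ n → [ n ] * [ n ]⁻¹ ≈ 1#
  []-inverseʳ n = V.trans (V.sym (scalar.*-homo _ _))
    (V.trans (scalar.⟦⟧-cong (ℚ.*-inverseʳ (ℚ.fromℤ (+ suc n)))) scalar.1#-homo)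

  -- The lattice spans over ℚ, and the denominators of the finitely many coefficients of `x` are
  -- cleared together.
  lattice-bounded : ∀ (L : Lattice V) x → Bounded (Lattice.generators L) x
  lattice-bounded L x = span-elim V (Bounded g) (bounded-resp {g = g}) (bounded-0 {g = g}) bounded-+
    (λ q i → ℚ.denominator-1 q , SpanProperties.span-resp (overℤ V) {g = g}
      (V.trans (*-congʳ (V.trans (scalar.⟦⟧-cong (≡.sym (denominator-* q))) (scalar.*-homo _ q))) (*-assoc _ _ _))
      (SpanProperties.span-scale (overℤ V) (ℚ.numerator q) (SpanProperties.span-generator (overℤ V) {g = g} i)))
    (Lattice.spanning L x)
    where g = Lattice.generators L

  opaque
    commensurable : (L L′ : Lattice V) → ∃ λ n → ∀ i → [ n ] * Lattice.generators L i ∈ ⟪ L′ ⟫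
    commensurable L L′ = uniformly-bounded (Lattice.generators L) (λ i → lattice-bounded L′ _)

-- Special points and double cosets

module _ (R : Ring 0ℓ 0ℓ) where
  open Ring R
  open Unit
  open UnitProperties R
  open SetoidReasoning setoid

  unit-cancelˡ : ∀ (u : Unit R) {x y} → value u * x ≈ value u * y → x ≈ y
  unit-cancelˡ u {x} {y} eq = trans (sym (cancelˡ x (inverseˡ u))) (trans (*-congˡ eq) (cancelˡ y (inverseˡ u)))

  unit-cancelʳ : ∀ (u : Unit R) {x y} → x * value u ≈ y * value u → x ≈ y
  unit-cancelʳ u {x} {y} eq = trans (cancelʳ x (inverseʳ u)) (trans (*-congʳ eq) (sym (cancelʳ y (inverseʳ u))))

  conjugate⇒commutes : ∀ (u : Unit R) {x y} → y ≈ inv u * x * value u → value u * y ≈ x * value u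
  conjugate⇒commutes u {x} {y} eq =
    trans (*-congˡ (trans eq (*-assoc _ _ _))) (cancelˡ (x * value u) (inverseʳ u))

  commutes⇒conjugate : ∀ (u : Unit R) {x y} → value u * y ≈ x * value u → y ≈ inv u * x * value u
  commutes⇒conjugate u {x} {y} eq =
    trans (sym (cancelˡ y (inverseˡ u))) (trans (*-congˡ eq) (sym (*-assoc _ _ _)))

module _ (R S : Ring 0ℓ 0ℓ) {f : Ring.Carrier R → Ring.Carrier S} (f-hom : Hom R S f) where
  private
    module S = Ring S
    module F = RingMorphisms.IsRingHomomorphism f-hom
  open Unit

  mapᵘ : Unit R → Unit S
  mapᵘ u = record
    { value = f (value u) ; inv = f (inv u)
    ; inverseˡ = S.trans (S.sym (F.*-homo _ _)) (S.trans (F.⟦⟧-cong (inverseˡ u)) F.1#-homo)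
    ; inverseʳ = S.trans (S.sym (F.*-homo _ _)) (S.trans (F.⟦⟧-cong (inverseʳ u)) F.1#-homo) }

module _ {K B : Ring 0ℓ 0ℓ} (i : Embedding K B) where
  open Ring B
  open Unit
  private module i = Embedding i

  -- Skolem-Noether, written as `β i = ψ β` so that an intertwining unit can be exhibited without
  -- computing its inverse.
  AllEmbeddingsConjugate : Set
  AllEmbeddingsConjugate = ∀ (ψ : Embedding K B) → ∃ λ (β : Unit B) → ∀ k → value β * i.⟦ k ⟧ ≈ Embedding.⟦_⟧ ψ k * value β

  SelfCentralizing : Set
  SelfCentralizing = ∀ γ → (∀ k → γ * i.⟦ k ⟧ ≈ i.⟦ k ⟧ * γ) → ∃ λ k → γ ≈ i.⟦ k ⟧

-- generator-minimal expresses that x lies in the completion of L.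
module Correspondence
  (B-algebra K-algebra : ℚ-Algebra) (O : Order K-algebra) (LocallyPrincipal : Lattice B-algebra → Set)
  (B̂-ring : Ring 0ℓ 0ℓ) (ĵ : Algebra.Carrier B-algebra → Ring.Carrier B̂-ring)
  (ĵ-hom : Hom (Algebra.ring B-algebra) B̂-ring ĵ)
  (R̂ : Pred (Ring.Carrier B̂-ring) 0ℓ)
  (R̂-resp : ∀ {x y} → Ring._≈_ B̂-ring x y → x ∈ R̂ → y ∈ R̂)
  (1∈R̂ : Ring.1# B̂-ring ∈ R̂)
  (R̂-* : ∀ {x y} → x ∈ R̂ → y ∈ R̂ → Ring._*_ B̂-ring x y ∈ R̂)
  (i : Embedding (Algebra.ring K-algebra) (Algebra.ring B-algebra))
  (iₐ-hom : Hom (Algebra.ring K-algebra) B̂-ring (ĵ ∘ Embedding.⟦_⟧ i))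
  (K-comm : ∀ k l → Algebra._≈_ K-algebra (Algebra._*_ K-algebra k l) (Algebra._*_ K-algebra l k))
  (Generates : Lattice B-algebra → Unit B̂-ring → Set)
  (divide : ∀ {L x v} → Generates L x → v ∈ ⟪ L ⟫ → Ring._*_ B̂-ring (ĵ v) (Unit.inv x) ∈ R̂)
  (undivide : ∀ {L x v} → Generates L x → Ring._*_ B̂-ring (ĵ v) (Unit.inv x) ∈ R̂ → v ∈ ⟪ L ⟫)
  (generator-minimal : ∀ {L x} → Generates L x → ∀ w → (∀ {v} → v ∈ ⟪ L ⟫ → Ring._*_ B̂-ring (ĵ v) w ∈ R̂) →
    Ring._*_ B̂-ring (Unit.value x) w ∈ R̂)
  (generator : ∀ L → LocallyPrincipal L → ∃ (Generates L))
  (ideal-of : ∀ x → ∃ λ L → LocallyPrincipal L × Generates L x)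
  (skolem-noether : AllEmbeddingsConjugate i)
  (centralizer : SelfCentralizing i)
  where

  private
    module B = Algebra B-algebra
    module K = Algebra K-algebra
    module B̂ = Ring B̂-ring
    module ĵ = RingMorphisms.IsRingHomomorphism ĵ-hom
    module i = Embedding i
    module Bᵤ = UnitProperties B.ring
    module B̂ᵤ = UnitProperties B̂-ring
    module BR = SetoidReasoning B.setoid
    module B̂R = SetoidReasoning B̂.setoid
    ĵᵘ : Unit B.ring → Unit B̂-ring
    ĵᵘ = mapᵘ B.ring B̂-ring ĵ-hom
    iᵘ : Unit K.ring → Unit B.ring
    iᵘ = mapᵘ K.ring B.ring i.isRingHomomorphism
  open Unit
  open SpecialPoints B-algebra K-algebra O LocallyPrincipal
  open DoubleCosets K.ring B̂-ring ⟦ O ⟧ₒ (ĵ ∘ i.⟦_⟧) iₐ-hom R̂ 1∈R̂ (λ {x} {y} → R̂-* {x} {y})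

  module _ {L M x y} (L-gen : Generates L x) (M-gen : Generates M y) (a : B.Carrier) where

    -- With `L̂ = R̂ x` and `M̂ = R̂ y`, the inclusion `M a ⊆ L` becomes the integrality of the
    -- single element `y a x⁻¹`. For `L = M` this describes the right order, for `a = α` or `α⁻¹`
    -- the action of `B^×` on ideals, and for `a = 1` two generators of the same ideal.
    transporter⇒R̂ : (∀ {v} → v ∈ ⟪ M ⟫ → v B.* a ∈ ⟪ L ⟫) → value y B̂.* (ĵ a B̂.* inv x) ∈ R̂
    transporter⇒R̂ Ma⊆L = generator-minimal M-gen (ĵ a B̂.* inv x) λ {v} v∈ →
      R̂-resp (B̂.trans (B̂.*-congʳ (ĵ.*-homo v a)) (B̂.*-assoc _ _ _)) (divide {v = v B.* a} L-gen (Ma⊆L v∈))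

    -- `v a x⁻¹` is the product of `v y⁻¹` and `y a x⁻¹`.
    R̂⇒transporter : value y B̂.* (ĵ a B̂.* inv x) ∈ R̂ → ∀ {v} → v ∈ ⟪ M ⟫ → v B.* a ∈ ⟪ L ⟫
    R̂⇒transporter ∈R̂ {v} v∈ = undivide {v = v B.* a} L-gen (R̂-resp (begin
      ĵ v B̂.* inv y B̂.* (value y B̂.* (ĵ a B̂.* inv x)) ≈⟨ B̂.*-assoc _ _ _ ⟩
      ĵ v B̂.* (inv y B̂.* (value y B̂.* (ĵ a B̂.* inv x))) ≈⟨ B̂.*-congˡ (B̂ᵤ.cancelˡ _ (inverseˡ y)) ⟩
      ĵ v B̂.* (ĵ a B̂.* inv x) ≈⟨ B̂.*-assoc _ _ _ ⟨
      ĵ v B̂.* ĵ a B̂.* inv x ≈⟨ B̂.*-congʳ (ĵ.*-homo v a) ⟨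
      ĵ (v B.* a) B̂.* inv x ∎) (R̂-* (divide {v = v} M-gen v∈) ∈R̂))
      where open B̂R

  -- The inverse of `γ` centralizes `i(K)` as well, so it too comes from `K`; injectivity of `i`
  -- makes the two preimages inverse to each other.
  centralizerᵘ : (γ : Unit B.ring) → (∀ k → value γ B.* i.⟦ k ⟧ B.≈ i.⟦ k ⟧ B.* value γ) →
    ∃ λ (κ : Unit K.ring) → value γ B.≈ i.⟦ value κ ⟧
  centralizerᵘ γ commutes = record
    { value = proj₁ k ; inv = proj₁ l
    ; inverseˡ = i.injective (inverse (proj₂ l) (proj₂ k) (inverseˡ γ))
    ; inverseʳ = i.injective (inverse (proj₂ k) (proj₂ l) (inverseʳ γ)) } , proj₂ k
    where
    k : ∃ λ k → value γ B.≈ i.⟦ k ⟧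
    k = centralizer (value γ) commutes
    l : ∃ λ l → inv γ B.≈ i.⟦ l ⟧
    l = centralizer (inv γ) λ k → unit-cancelˡ B.ring γ (begin
      value γ B.* (inv γ B.* i.⟦ k ⟧)   ≈⟨ Bᵤ.cancelˡ _ (inverseʳ γ) ⟩
      i.⟦ k ⟧                           ≈⟨ Bᵤ.cancelʳ _ (inverseʳ γ) ⟩
      i.⟦ k ⟧ B.* value γ B.* inv γ     ≈⟨ B.*-congʳ (commutes k) ⟨
      value γ B.* i.⟦ k ⟧ B.* inv γ     ≈⟨ B.*-assoc _ _ _ ⟩
      value γ B.* (i.⟦ k ⟧ B.* inv γ)   ∎)
      where open BR
    inverse : ∀ {x y k l} → x B.≈ i.⟦ k ⟧ → y B.≈ i.⟦ l ⟧ → x B.* y B.≈ B.1# → i.⟦ k K.* l ⟧ B.≈ i.⟦ K.1# ⟧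
    inverse x≈ y≈ eq = B.trans (i.*-homo _ _) (B.trans (B.sym (B.*-cong x≈ y≈)) (B.trans eq (B.sym i.1#-homo)))

  module Point (p : SpecialPoint) where
    open SpecialPoint p public
    open Ideal ideal public
    x : Unit B̂-ring
    x = proj₁ (generator lattice locallyPrincipal)
    generates : Generates lattice x
    generates = proj₂ (generator lattice locallyPrincipal)
    β : Unit B.ring
    β = proj₁ (skolem-noether ψ)
    β-intertwines : ∀ k → value β B.* i.⟦ k ⟧ B.≈ ⟦ k ⟧ B.* value β
    β-intertwines = proj₂ (skolem-noether ψ)
    y : Unit B̂-ring
    y = _*ᵘ_ B̂-ring x (ĵᵘ β)

    -- In other words `y i(k) y⁻¹ = x ψ(k) x⁻¹`. Hence `k` lies in `O_y` exactly if `x ψ(k) x⁻¹`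
    -- lies in `R̂`, that is if `ψ(k)` lies in the right order of `𝔞`, and optimality of `ψ` turns
    -- this into `k ∈ O`.
    y-intertwines : ∀ k → value y B̂.* ĵ i.⟦ k ⟧ B̂.≈ value x B̂.* (ĵ ⟦ k ⟧ B̂.* inv x) B̂.* value y
    y-intertwines k = begin
      value x B̂.* ĵ (value β) B̂.* ĵ i.⟦ k ⟧                               ≈⟨ B̂.*-assoc _ _ _ ⟩
      value x B̂.* (ĵ (value β) B̂.* ĵ i.⟦ k ⟧)                             ≈⟨ B̂.*-congˡ (ĵ.*-homo _ _) ⟨
      value x B̂.* ĵ (value β B.* i.⟦ k ⟧)                                 ≈⟨ B̂.*-congˡ (ĵ.⟦⟧-cong (β-intertwines k)) ⟩
      value x B̂.* ĵ (⟦ k ⟧ B.* value β)                                   ≈⟨ B̂.*-congˡ (ĵ.*-homo _ _) ⟩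
      value x B̂.* (ĵ ⟦ k ⟧ B̂.* ĵ (value β))                               ≈⟨ B̂.*-congˡ (B̂.*-congˡ (B̂ᵤ.cancelˡ _ (inverseˡ x))) ⟨
      value x B̂.* (ĵ ⟦ k ⟧ B̂.* (inv x B̂.* (value x B̂.* ĵ (value β))))     ≈⟨ B̂.*-congˡ (B̂.*-assoc _ _ _) ⟨
      value x B̂.* (ĵ ⟦ k ⟧ B̂.* inv x B̂.* (value x B̂.* ĵ (value β)))       ≈⟨ B̂.*-assoc _ _ _ ⟨
      value x B̂.* (ĵ ⟦ k ⟧ B̂.* inv x) B̂.* (value x B̂.* ĵ (value β))       ∎
      where open B̂R

    order : optimalOrder y ≐ ⟦ O ⟧ₒ
    order = to , from
      where
      to : ∀ {k} → k ∈ optimalOrder y → k ∈ ⟦ O ⟧ₒ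
      to {k} (r , r∈ , ik≈) with proj₁ optimal {⟦ k ⟧}
        ((λ {v} → R̂⇒transporter generates generates ⟦ k ⟧ (R̂-resp r≈ r∈) {v}) , (k , tt , B.refl))
        where
        r≈ : r B̂.≈ value x B̂.* (ĵ ⟦ k ⟧ B̂.* inv x)
        r≈ = unit-cancelʳ B̂-ring y (B̂.trans (B̂.sym (conjugate⇒commutes B̂-ring y ik≈)) (y-intertwines k))
      ... | l , l∈ , k≈l = SpanProperties.span-resp (overℤ K-algebra) {g = Lattice.generators (Order.lattice O)} {l} {k}
        (K.sym (Embedding.injective ψ k≈l)) l∈
      from : ∀ {k} → k ∈ ⟦ O ⟧ₒ → k ∈ optimalOrder y
      from {k} k∈ = value x B̂.* (ĵ ⟦ k ⟧ B̂.* inv x) ,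
        transporter⇒R̂ generates generates ⟦ k ⟧ (λ {v} → proj₁ (proj₂ optimal (k , k∈ , B.refl)) {v}) ,
        commutes⇒conjugate B̂-ring y (y-intertwines k)

    N̂-point : N̂
    N̂-point = record { unit = y ; order = order }

  module _ {p q : SpecialPoint} where
    private
      module P = Point p
      module Q = Point q

    -- The element `γ = β_p⁻¹ α β_q` centralizes `i(K)`, so it is some `κ ∈ K^×`, and
    -- `u = x_q α⁻¹ x_p⁻¹` gives `u (x_p β_p) κ = x_q β_q`. Both `u` and `u⁻¹` are integral because
    -- `𝔞_q = 𝔞_p α`. The case `α = 1` covers the independence from the local generators stored in
    -- the ideal.
    point-cong : p ∼ q → P.N̂-point ≈ₒ Q.N̂-point
    point-cong (α , (to , from) , ψ-conj) =
      record { unit = u ; value∈R̂ = u∈R̂ ; inv∈R̂ = R̂-resp (B̂.sym (B̂.*-assoc _ _ _)) u⁻¹∈R̂ } , κ , (begin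
        value Q.x B̂.* ĵ (value Q.β)                                  ≈⟨ B̂.*-congˡ (ĵ.⟦⟧-cong (Bᵤ.cancelˡ _ (inverseˡ α))) ⟨
        value Q.x B̂.* ĵ (inv α B.* (value α B.* value Q.β))          ≈⟨ B̂.*-congˡ (ĵ.⟦⟧-cong (B.*-congˡ βγ≈αβ)) ⟨
        value Q.x B̂.* ĵ (inv α B.* (value P.β B.* value γ))          ≈⟨ B̂.*-congˡ (ĵ.⟦⟧-cong (B.*-congˡ (B.*-congˡ (proj₂ κ′)))) ⟩
        value Q.x B̂.* ĵ (inv α B.* (value P.β B.* i.⟦ value κ ⟧))    ≈⟨ B̂.*-congˡ (B̂.trans (ĵ.*-homo _ _) (B̂.*-congˡ (ĵ.*-homo _ _))) ⟩
        value Q.x B̂.* (ĵ (inv α) B̂.* (ĵ (value P.β) B̂.* iκ))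
          ≈⟨ B̂.*-congˡ (B̂.*-congˡ (B̂ᵤ.cancelˡ _ (inverseˡ P.x))) ⟨
        value Q.x B̂.* (ĵ (inv α) B̂.* (inv P.x B̂.* (value P.x B̂.* (ĵ (value P.β) B̂.* iκ))))
          ≈⟨ B̂.*-congˡ (B̂.*-assoc _ _ _) ⟨
        value Q.x B̂.* (ĵ (inv α) B̂.* inv P.x B̂.* (value P.x B̂.* (ĵ (value P.β) B̂.* iκ)))
          ≈⟨ B̂.*-assoc _ _ _ ⟨
        value u B̂.* (value P.x B̂.* (ĵ (value P.β) B̂.* iκ))           ≈⟨ B̂.*-congˡ (B̂.*-assoc _ _ _) ⟨
        value u B̂.* (value P.y B̂.* iκ)                               ≈⟨ B̂.*-assoc _ _ _ ⟨
        value u B̂.* value P.y B̂.* iκ                                 ∎)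
      where
      open B̂R
      γ : Unit B.ring
      γ = _*ᵘ_ B.ring (_⁻¹ᵘ B.ring P.β) (_*ᵘ_ B.ring α Q.β)
      βγ≈αβ : value P.β B.* value γ B.≈ value α B.* value Q.β
      βγ≈αβ = Bᵤ.cancelˡ _ (inverseʳ P.β)
      γ-commutes : ∀ k → value γ B.* i.⟦ k ⟧ B.≈ i.⟦ k ⟧ B.* value γ
      γ-commutes k = unit-cancelˡ B.ring P.β (BR.begin
        value P.β B.* (value γ B.* i.⟦ k ⟧)             BR.≈⟨ B.*-assoc _ _ _ ⟨
        value P.β B.* value γ B.* i.⟦ k ⟧               BR.≈⟨ B.*-congʳ βγ≈αβ ⟩
        value α B.* value Q.β B.* i.⟦ k ⟧               BR.≈⟨ B.*-assoc _ _ _ ⟩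
        value α B.* (value Q.β B.* i.⟦ k ⟧)             BR.≈⟨ B.*-congˡ (Q.β-intertwines k) ⟩
        value α B.* (Q.⟦ k ⟧ B.* value Q.β)             BR.≈⟨ B.*-assoc _ _ _ ⟨
        value α B.* Q.⟦ k ⟧ B.* value Q.β               BR.≈⟨ B.*-congʳ (conjugate⇒commutes B.ring α (ψ-conj k)) ⟩
        P.⟦ k ⟧ B.* value α B.* value Q.β               BR.≈⟨ B.*-assoc _ _ _ ⟩
        P.⟦ k ⟧ B.* (value α B.* value Q.β)             BR.≈⟨ B.*-congˡ βγ≈αβ ⟨
        P.⟦ k ⟧ B.* (value P.β B.* value γ)             BR.≈⟨ B.*-assoc _ _ _ ⟨
        P.⟦ k ⟧ B.* value P.β B.* value γ               BR.≈⟨ B.*-congʳ (P.β-intertwines k) ⟨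
        value P.β B.* i.⟦ k ⟧ B.* value γ               BR.≈⟨ B.*-assoc _ _ _ ⟩
        value P.β B.* (i.⟦ k ⟧ B.* value γ)             BR.∎)
      κ′ : ∃ λ (κ : Unit K.ring) → value γ B.≈ i.⟦ value κ ⟧
      κ′ = centralizerᵘ γ γ-commutes
      κ : Unit K.ring
      κ = proj₁ κ′
      iκ : B̂.Carrier
      iκ = ĵ i.⟦ value κ ⟧
      u : Unit B̂-ring
      u = _*ᵘ_ B̂-ring Q.x (_*ᵘ_ B̂-ring (ĵᵘ (_⁻¹ᵘ B.ring α)) (_⁻¹ᵘ B̂-ring P.x))
      u∈R̂ : value Q.x B̂.* (ĵ (inv α) B̂.* inv P.x) ∈ R̂
      u∈R̂ = transporter⇒R̂ P.generates Q.generates (inv α) λ {v} v∈ → let (z , z∈ , v≈) = to v∈ in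
        SpanProperties.span-resp (overℤ B-algebra) {g = Lattice.generators P.lattice} {z} {v B.* inv α}
          (B.trans (Bᵤ.cancelʳ z (inverseʳ α)) (B.*-congʳ (B.sym v≈))) z∈
      u⁻¹∈R̂ : value P.x B̂.* (ĵ (value α) B̂.* inv Q.x) ∈ R̂
      u⁻¹∈R̂ = transporter⇒R̂ Q.generates P.generates (value α) λ {v} v∈ → from (v , v∈ , B.refl)

    -- From `x_q β_q = u x_p β_p κ` the element `α = β_p κ β_q⁻¹` satisfies `x_q = u x_p α`. So
    -- `x_q α⁻¹ x_p⁻¹ = u` and its inverse are integral, which gives `𝔞_q = 𝔞_p α`. That `α`
    -- conjugates `ψ_p` to `ψ_q` rests on `κ` commuting with `K`.
    point-injective : P.N̂-point ≈ₒ Q.N̂-point → p ∼ q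
    point-injective (u , κ , y≈) = α ,
      ( (λ {v} v∈ → v B.* inv α , R̂⇒transporter P.generates Q.generates (inv α) (R̂-resp (B̂.sym xα⁻¹x⁻¹≈u) (R̂^×.value∈R̂ u)) {v} v∈ ,
           Bᵤ.cancelʳ v (inverseˡ α))
      , (λ {v} (z , z∈ , v≈) → SpanProperties.span-resp (overℤ B-algebra) {g = Lattice.generators Q.lattice} {z B.* value α} {v}
           (B.sym v≈) (R̂⇒transporter Q.generates P.generates (value α) (R̂-resp (B̂.sym xαx⁻¹≈u⁻¹) (R̂^×.inv∈R̂ u)) {z} z∈)) ) ,
      λ k → commutes⇒conjugate B.ring α (unit-cancelʳ B.ring Q.β (begin
        value α B.* Q.⟦ k ⟧ B.* value Q.β                    ≈⟨ B.*-assoc _ _ _ ⟩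
        value α B.* (Q.⟦ k ⟧ B.* value Q.β)                  ≈⟨ B.*-congˡ (Q.β-intertwines k) ⟨
        value α B.* (value Q.β B.* i.⟦ k ⟧)                  ≈⟨ B.*-assoc _ _ _ ⟨
        value α B.* value Q.β B.* i.⟦ k ⟧                    ≈⟨ B.*-congʳ αβ≈βκ ⟩
        value P.β B.* i.⟦ value κ ⟧ B.* i.⟦ k ⟧              ≈⟨ B.*-assoc _ _ _ ⟩
        value P.β B.* (i.⟦ value κ ⟧ B.* i.⟦ k ⟧)            ≈⟨ B.*-congˡ (i.*-homo _ _) ⟨
        value P.β B.* i.⟦ value κ K.* k ⟧                    ≈⟨ B.*-congˡ (i.⟦⟧-cong (K-comm _ _)) ⟩
        value P.β B.* i.⟦ k K.* value κ ⟧                    ≈⟨ B.*-congˡ (i.*-homo _ _) ⟩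
        value P.β B.* (i.⟦ k ⟧ B.* i.⟦ value κ ⟧)            ≈⟨ B.*-assoc _ _ _ ⟨
        value P.β B.* i.⟦ k ⟧ B.* i.⟦ value κ ⟧              ≈⟨ B.*-congʳ (P.β-intertwines k) ⟩
        P.⟦ k ⟧ B.* value P.β B.* i.⟦ value κ ⟧              ≈⟨ B.*-assoc _ _ _ ⟩
        P.⟦ k ⟧ B.* (value P.β B.* i.⟦ value κ ⟧)            ≈⟨ B.*-congˡ αβ≈βκ ⟨
        P.⟦ k ⟧ B.* (value α B.* value Q.β)                  ≈⟨ B.*-assoc _ _ _ ⟨
        P.⟦ k ⟧ B.* value α B.* value Q.β                    ∎))
      where
      open BR
      α : Unit B.ring
      α = _*ᵘ_ B.ring (_*ᵘ_ B.ring P.β (iᵘ κ)) (_⁻¹ᵘ B.ring Q.β)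
      αβ≈βκ : value α B.* value Q.β B.≈ value P.β B.* i.⟦ value κ ⟧
      αβ≈βκ = B.sym (Bᵤ.cancelʳ _ (inverseˡ Q.β))
      v : Unit B̂-ring
      v = R̂^×.unit u
      x≈uxα : value Q.x B̂.≈ value v B̂.* (value P.x B̂.* ĵ (value α))
      x≈uxα = unit-cancelʳ B̂-ring (ĵᵘ Q.β) (B̂R.begin
        value Q.x B̂.* ĵ (value Q.β)                                            B̂R.≈⟨ y≈ ⟩
        value v B̂.* (value P.x B̂.* ĵ (value P.β)) B̂.* ĵ i.⟦ value κ ⟧          B̂R.≈⟨ B̂.*-assoc _ _ _ ⟩
        value v B̂.* (value P.x B̂.* ĵ (value P.β) B̂.* ĵ i.⟦ value κ ⟧)          B̂R.≈⟨ B̂.*-congˡ (B̂.*-assoc _ _ _) ⟩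
        value v B̂.* (value P.x B̂.* (ĵ (value P.β) B̂.* ĵ i.⟦ value κ ⟧))        B̂R.≈⟨ B̂.*-congˡ (B̂.*-congˡ (ĵ.*-homo _ _)) ⟨
        value v B̂.* (value P.x B̂.* ĵ (value P.β B.* i.⟦ value κ ⟧))            B̂R.≈⟨ B̂.*-congˡ (B̂.*-congˡ (ĵ.⟦⟧-cong αβ≈βκ)) ⟨
        value v B̂.* (value P.x B̂.* ĵ (value α B.* value Q.β))                  B̂R.≈⟨ B̂.*-congˡ (B̂.*-congˡ (ĵ.*-homo _ _)) ⟩
        value v B̂.* (value P.x B̂.* (ĵ (value α) B̂.* ĵ (value Q.β)))            B̂R.≈⟨ B̂.*-congˡ (B̂.*-assoc _ _ _) ⟨
        value v B̂.* (value P.x B̂.* ĵ (value α) B̂.* ĵ (value Q.β))              B̂R.≈⟨ B̂.*-assoc _ _ _ ⟨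
        value v B̂.* (value P.x B̂.* ĵ (value α)) B̂.* ĵ (value Q.β)              B̂R.∎)
      xα : Unit B̂-ring
      xα = _*ᵘ_ B̂-ring P.x (ĵᵘ α)
      xα⁻¹x⁻¹≈u : value Q.x B̂.* (ĵ (inv α) B̂.* inv P.x) B̂.≈ value v
      xα⁻¹x⁻¹≈u = B̂.trans (B̂.*-congʳ x≈uxα) (B̂.sym (B̂ᵤ.cancelʳ (value v) (inverseʳ xα)))
      xαx⁻¹≈u⁻¹ : value P.x B̂.* (ĵ (value α) B̂.* inv Q.x) B̂.≈ inv v
      xαx⁻¹≈u⁻¹ = B̂.trans (B̂.sym (B̂.*-assoc _ _ _))
        (B̂.trans (B̂.*-congʳ (B̂.sym (B̂.trans (B̂.*-congˡ x≈uxα) (B̂ᵤ.cancelˡ _ (inverseˡ v)))))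
          (B̂.sym (B̂ᵤ.cancelʳ (inv v) (inverseʳ Q.x))))

  -- The generator chosen for the ideal and the `β` chosen for `i` need not be `x` and 1. But two
  -- generators of the same ideal differ by an element of `R̂^×`, and `β` centralizes `i(K)`, hence
  -- comes from `K^×`.
  point-surjective : ∀ z → ∃ λ p → Point.N̂-point p ≈ₒ z
  point-surjective z = p , record
    { unit = u
    ; value∈R̂ = R̂-resp (B̂.*-congˡ (B̂.trans (B̂.*-congʳ ĵ.1#-homo) (B̂.*-identityˡ _)))
        (transporter⇒R̂ P.generates L-gen B.1# L*1)
    ; inv∈R̂ = R̂-resp (B̂.*-congˡ (B̂.trans (B̂.*-congʳ ĵ.1#-homo) (B̂.*-identityˡ _)))
        (transporter⇒R̂ L-gen P.generates B.1# L*1) } ,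
    _⁻¹ᵘ K.ring (proj₁ κ) , (begin
      value x                                             ≈⟨ B̂ᵤ.cancelʳ (value x) (inverseˡ P.x) ⟩
      value u B̂.* value P.x                               ≈⟨ B̂.*-congˡ (B̂ᵤ.cancelʳ (value P.x) (inverseʳ (ĵᵘ (iᵘ (proj₁ κ))))) ⟩
      value u B̂.* (value P.x B̂.* ĵ i.⟦ value (proj₁ κ) ⟧ B̂.* iκ⁻¹)
        ≈⟨ B̂.*-congˡ (B̂.*-congʳ (B̂.*-congˡ (ĵ.⟦⟧-cong (proj₂ κ)))) ⟨
      value u B̂.* (value P.y B̂.* iκ⁻¹)                    ≈⟨ B̂.*-assoc _ _ _ ⟨
      value u B̂.* value P.y B̂.* iκ⁻¹                      ∎)
    where
    open B̂R
    x : Unit B̂-ring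
    x = N̂.unit z
    L : Lattice B-algebra
    L = proj₁ (ideal-of x)
    L-gen : Generates L x
    L-gen = proj₂ (proj₂ (ideal-of x))
    L*1 : ∀ {v} → v ∈ ⟪ L ⟫ → v B.* B.1# ∈ ⟪ L ⟫
    L*1 {v} = SpanProperties.span-resp (overℤ B-algebra) {g = Lattice.generators L} {v} {v B.* B.1#} (B.sym (B.*-identityʳ v))
    conjugates : ∀ w → ĵ w B̂.≈ inv x B̂.* (value x B̂.* (ĵ w B̂.* inv x)) B̂.* value x
    conjugates w = commutes⇒conjugate B̂-ring x (B̂.trans (B̂ᵤ.cancelʳ _ (inverseˡ x)) (B̂.*-congʳ (B̂.*-assoc _ _ _)))
    p : SpecialPoint
    p = record
      { ideal = record { lattice = L ; locallyPrincipal = proj₁ (proj₂ (ideal-of x)) }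
      ; ψ = i
      ; optimal =
          (λ {w} (w-right , (k , _ , w≈)) → k , proj₁ (N̂.order z) {k}
            (value x B̂.* (ĵ w B̂.* inv x) , transporter⇒R̂ L-gen L-gen w (λ {v} → w-right {v}) ,
             B̂.trans (ĵ.⟦⟧-cong (B.sym w≈)) (conjugates w)) , w≈) ,
          (λ {w} (k , k∈ , w≈) → let (r , r∈ , ik≈) = proj₂ (N̂.order z) {k} k∈ in
            (λ {v} → R̂⇒transporter L-gen L-gen w (R̂-resp (unit-cancelʳ B̂-ring x (B̂.trans
              (B̂.sym (conjugate⇒commutes B̂-ring x (B̂.trans (ĵ.⟦⟧-cong w≈) ik≈)))
              (conjugate⇒commutes B̂-ring x (conjugates w)))) r∈) {v}) ,
            (k , tt , w≈)) }
    module P = Point p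
    κ : ∃ λ (κ : Unit K.ring) → value P.β B.≈ i.⟦ value κ ⟧
    κ = centralizerᵘ P.β P.β-intertwines
    iκ⁻¹ : B̂.Carrier
    iκ⁻¹ = ĵ i.⟦ inv (proj₁ κ) ⟧
    u : Unit B̂-ring
    u = _*ᵘ_ B̂-ring x (_⁻¹ᵘ B̂-ring P.x)

  opaque
    toPoint : SpecialPoint → N̂
    toPoint = Point.N̂-point

    toPoint-cong : ∀ {p q} → p ∼ q → toPoint p ≈ₒ toPoint q
    toPoint-cong {p} {q} = point-cong {p} {q}

    toPoint-injective : ∀ {p q} → toPoint p ≈ₒ toPoint q → p ∼ q
    toPoint-injective {p} {q} = point-injective {p} {q}

    toPoint-surjective : ∀ z → ∃ λ p → ∀ {q} → q ∼ p → toPoint q ≈ₒ z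
    toPoint-surjective z = p , λ {q} q∼p → Setoid.trans setoid {toPoint q} {toPoint p} {z} (point-cong {q} {p} q∼p) p≈z
      where
      p : SpecialPoint
      p = proj₁ (point-surjective z)
      p≈z : toPoint p ≈ₒ z
      p≈z = proj₂ (point-surjective z)

  bijection : Bijection classes setoid
  bijection = record
    { to        = toPoint
    ; cong      = λ {p} {q} → toPoint-cong {p} {q}
    ; bijective = (λ {p} {q} → toPoint-injective {p} {q}) , toPoint-surjective }

-- Lattices and their completions

-- Saturation and bounded denominators are assumed of the single lattice `Λ`, for which coordinates
-- are available; commensurability extends both to all lattices.
module LocalGlobal
  (V : ℚ-Algebra) (Ŵ : Algebra (Coefficients.A Ẑ)) (W : ∀ ℓ → Algebra (Coefficients.A ℤ[ ℓ ]))
  (ĵ : Algebra.Carrier V → Algebra.Carrier Ŵ) (ĵ-hom : Hom (Algebra.ring V) (Algebra.ring Ŵ) ĵ)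
  (ĵ-scalar : ∀ n → Algebra._≈_ Ŵ (ĵ (Algebra.scalar V (ℚ.fromℤ n))) (Algebra.scalar Ŵ (Coefficients.ι Ẑ n)))
  (j : ∀ ℓ → Algebra.Carrier V → Algebra.Carrier (W ℓ))
  (π : ∀ ℓ → Algebra.Carrier Ŵ → Algebra.Carrier (W ℓ)) (π-hom : ∀ ℓ → Hom (Algebra.ring Ŵ) (Algebra.ring (W ℓ)) (π ℓ))
  (π-scalar : ∀ ℓ c → Algebra._≈_ (W ℓ) (π ℓ (Algebra.scalar Ŵ c)) (Algebra.scalar (W ℓ) (c ℓ)))
  (π-ĵ : ∀ ℓ v → Algebra._≈_ (W ℓ) (π ℓ (ĵ v)) (j ℓ v))
  (π-injective : ∀ {x y} → (∀ ℓ → Algebra._≈_ (W ℓ) (π ℓ x) (π ℓ y)) → Algebra._≈_ Ŵ x y)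
  (Λ : Lattice V)
  (Λ-saturated : ∀ {v} → ĵ v ∈ Span Ŵ (ĵ ∘ Lattice.generators Λ) → v ∈ ⟪ Λ ⟫)
  (Λ-bounded : ∀ w → Multiples.Bounded Ŵ (Coefficients.ι Ẑ) (Coefficients.ι-hom Ẑ) (ĵ ∘ Lattice.generators Λ) w)
  where

  private
    module V = Algebra V
    module Vℤ = SpanProperties (overℤ V)
    module W ℓ = Algebra (W ℓ)
    module Vₘ = ℚ-Multiples V
    module ĵ = RingMorphisms.IsRingHomomorphism ĵ-hom
    module π ℓ = RingMorphisms.IsRingHomomorphism (π-hom ℓ)
    module M = Multiples Ŵ (Coefficients.ι Ẑ) (Coefficients.ι-hom Ẑ)
  open Algebra Ŵ hiding (zero)
  open M using ([_])
  open SpanProperties Ŵ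
  open SetoidReasoning setoid
  open Unit
  open Lattice using (generators)

  hat : Lattice V → Pred Carrier 0ℓ
  hat L = Span Ŵ (ĵ ∘ generators L)

  loc : ∀ ℓ → Lattice V → Pred (W.Carrier ℓ) 0ℓ
  loc ℓ L = Span (W ℓ) (j ℓ ∘ generators L)

  ĵ-∈ : ∀ L {x} → x ∈ ⟪ L ⟫ → ĵ x ∈ hat L
  ĵ-∈ L = map-span (overℤ V) Ŵ (Coefficients.ι Ẑ) ĵ ĵ-hom ĵ-scalar {g = generators L}

  generator-∈ : ∀ L i → ĵ (generators L i) ∈ hat L
  generator-∈ L = span-generator {g = ĵ ∘ generators L}

  π-span : ∀ ℓ {n} {g : Vector Carrier n} {w} → w ∈ Span Ŵ g → π ℓ w ∈ Span (W ℓ) (π ℓ ∘ g)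
  π-span ℓ {g = g} = map-span Ŵ (W ℓ) (λ c → c ℓ) (π ℓ) (π-hom ℓ) (π-scalar ℓ) {g = g}

  π-∈ : ∀ ℓ L {w} → w ∈ hat L → π ℓ w ∈ loc ℓ L
  π-∈ ℓ L w∈ = span-cong (W ℓ) (λ i → π-ĵ ℓ (generators L i)) (π-span ℓ w∈)

  opaque
    -- The coefficients at the different primes form one coefficient in Ẑ.
    assemble : ∀ L (w : ∀ ℓ → W.Carrier ℓ) → (∀ ℓ → w ℓ ∈ loc ℓ L) → ∃ λ ŵ → ŵ ∈ hat L × ∀ ℓ → W._≈_ ℓ (π ℓ ŵ) (w ℓ)
    assemble L w w∈ = _ , ((λ i ℓ → proj₁ (w∈′ ℓ) i) , refl) , λ ℓ →
      W.trans ℓ (π-sum ℓ (λ i ℓ → proj₁ (w∈′ ℓ) i) (ĵ ∘ generators L)) (W.sym ℓ (proj₂ (w∈′ ℓ)))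
      where
      w∈′ : ∀ ℓ → w ℓ ∈ Span (W ℓ) (π ℓ ∘ ĵ ∘ generators L)
      w∈′ ℓ = span-cong (W ℓ) (λ i → W.sym ℓ (π-ĵ ℓ (generators L i))) (w∈ ℓ)
      open Sum semiring
      π-sum : ∀ ℓ {n} (c : Vector (∀ ℓ → _) n) (g : Vector Carrier n) →
        W._≈_ ℓ (π ℓ (∑[ i < n ] (scalar (c i) * g i)))
                (Sum.sum (W.semiring ℓ) (λ i → W._*_ ℓ (W.scalar ℓ (c i ℓ)) (π ℓ (g i))))
      π-sum ℓ {zero}  c g = π.0#-homo ℓ
      π-sum ℓ {suc n} c g = W.trans ℓ (π.+-homo ℓ _ _) (W.+-cong ℓ
        (W.trans ℓ (π.*-homo ℓ _ _) (W.*-congʳ ℓ (π-scalar ℓ (c zero)))) (π-sum ℓ (c ∘ suc) (g ∘ suc)))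

  ĵ-[] : ∀ n → ĵ Vₘ.[ n ] ≈ [ n ]
  ĵ-[] n = ĵ-scalar (+ suc n)

  ĵ-[]-* : ∀ n v → ĵ (Vₘ.[ n ] V.* v) ≈ [ n ] * ĵ v
  ĵ-[]-* n v = trans (ĵ.*-homo _ _) (*-congʳ (ĵ-[] n))

  []-cancel : ∀ n x → [ n ] * (ĵ Vₘ.[ n ]⁻¹ * x) ≈ x
  []-cancel n x = begin
    [ n ] * (ĵ Vₘ.[ n ]⁻¹ * x)        ≈⟨ *-assoc _ _ _ ⟨
    [ n ] * ĵ Vₘ.[ n ]⁻¹ * x          ≈⟨ *-congʳ (*-congʳ (ĵ-[] n)) ⟨
    ĵ Vₘ.[ n ] * ĵ Vₘ.[ n ]⁻¹ * x     ≈⟨ *-congʳ (ĵ.*-homo _ _) ⟨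
    ĵ (Vₘ.[ n ] V.* Vₘ.[ n ]⁻¹) * x   ≈⟨ *-congʳ (trans (ĵ.⟦⟧-cong (Vₘ.[]-inverseʳ n)) ĵ.1#-homo) ⟩
    1# * x                            ≈⟨ *-identityˡ x ⟩
    x                                 ∎

  []⁻¹-cancel : ∀ n x → ĵ Vₘ.[ n ]⁻¹ * ([ n ] * x) ≈ x
  []⁻¹-cancel n x = trans (*-scalar Ŵ _ _ x) ([]-cancel n x)

  hat-resp : ∀ L {x y} → x ≈ y → x ∈ hat L → y ∈ hat L
  hat-resp L = span-resp {g = ĵ ∘ generators L}

  [_]-hat : ∀ n L {x} → x ∈ hat L → [ n ] * x ∈ hat L
  [ n ]-hat L = span-scale {g = ĵ ∘ generators L} (Coefficients.ι Ẑ (+ suc n))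

  opaque
    commensurable-hat : (L L′ : Lattice V) → ∃ λ n → ∀ {w} → w ∈ hat L → [ n ] * w ∈ hat L′
    commensurable-hat L L′ with Vₘ.commensurable L L′
    ... | n , nL⊆L′ = n , span-scalarˡ Ŵ (Coefficients.ι Ẑ (+ suc n)) λ i →
      hat-resp L′ (ĵ-[]-* n (generators L i)) (ĵ-∈ L′ {Vₘ.[ n ] V.* generators L i} (nL⊆L′ i))

  opaque
    bounded : ∀ L w → ∃ λ n → [ n ] * w ∈ hat L
    bounded L w with Λ-bounded w | commensurable-hat Λ L
    ... | m , p | n , q = m M.⊛ n , hat-resp L (sym (M.[⊛]-*ʳ m n w)) (q p)

  opaque
    -- Density of ℤ in Ẑ, applied to each coefficient: `L̂ = L + [ n ] L̂`.
    approximate : ∀ L n {w} → w ∈ hat L → ∃₂ λ v w′ → v ∈ ⟪ L ⟫ × w′ ∈ hat L × w ≈ ĵ v + [ n ] * w′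
    approximate L n = span-elim Ŵ (λ w → ∃₂ λ v w′ → v ∈ ⟪ L ⟫ × w′ ∈ hat L × w ≈ ĵ v + [ n ] * w′)
      (λ eq (v , w′ , v∈ , w′∈ , p) → v , w′ , v∈ , w′∈ , trans (sym eq) p)
      (V.0# , 0# , Vℤ.span-0 _ , span-0 _ , (begin
        0#                  ≈⟨ +-identityˡ 0# ⟨
        0# + 0#             ≈⟨ +-cong ĵ.0#-homo (zeroʳ _) ⟨
        ĵ V.0# + [ n ] * 0# ∎))
      (λ {x} {y} (v , w , v∈ , w∈ , p) (v′ , w′ , v′∈ , w′∈ , q) →
        v V.+ v′ , w + w′ , Vℤ.span-+ v∈ v′∈ , span-+ w∈ w′∈ , (begin
        x + y                                     ≈⟨ +-cong p q ⟩
        ĵ v + [ n ] * w + (ĵ v′ + [ n ] * w′)     ≈⟨ interchange _ _ _ _ ⟩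
        ĵ v + ĵ v′ + ([ n ] * w + [ n ] * w′)     ≈⟨ +-cong (ĵ.+-homo v v′) (distribˡ [ n ] w w′) ⟨
        ĵ (v V.+ v′) + [ n ] * (w + w′)           ∎))
      λ c i → let (c′ , e , c≈) = density (suc n) c ; g = generators L i in
        V.scalar (ℚ.fromℤ c′) V.* g , scalar e * ĵ g ,
        Vℤ.span-scale c′ (Vℤ.span-generator {g = generators L} i) , span-scale e (generator-∈ L i) , (begin
        scalar c * ĵ g
          ≈⟨ *-congʳ (trans (scalar.⟦⟧-cong c≈) (trans (scalar.+-homo _ _) (+-congˡ (scalar.*-homo _ _)))) ⟩
        (scalar (Coefficients.ι Ẑ c′) + [ n ] * scalar e) * ĵ g
          ≈⟨ distribʳ _ _ _ ⟩
        scalar (Coefficients.ι Ẑ c′) * ĵ g + [ n ] * scalar e * ĵ g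
          ≈⟨ +-cong (trans (*-congʳ (sym (ĵ-scalar c′))) (sym (ĵ.*-homo _ _))) (*-assoc _ _ _) ⟩
        ĵ (V.scalar (ℚ.fromℤ c′) V.* g) + [ n ] * (scalar e * ĵ g) ∎)
      where open CommutativeSemigroupProperties +-commutativeSemigroup using (interchange)

  opaque
    -- Let `n Λ ⊆ L` and `m L̂ ⊆ Λ̂`, and write `v = u + n m w` with `u ∈ L` and `w ∈ L̂`. Then
    -- `z = (v - u) / n` is an element of the algebra whose image is `m w ∈ Λ̂`. So `z ∈ Λ` by
    -- saturation of `Λ`, and `v = u + n z` lies in `L`.
    saturated : ∀ L {v} → ĵ v ∈ hat L → v ∈ ⟪ L ⟫
    saturated L {v} v∈ with Vₘ.commensurable Λ L | commensurable-hat L Λ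
    ... | n , nΛ⊆L | m , mL⊆Λ with approximate L (n M.⊛ m) v∈
    ... | u , w , u∈ , w∈ , v≈ = Vℤ.span-resp {g = generators L} {u V.+ Vₘ.[ n ] V.* z} {v} u+nz≈v
      (Vℤ.span-+ {g = generators L} {u} {Vₘ.[ n ] V.* z} u∈ nz∈)
      where
      open RingProperties V.ring
      z : V.Carrier
      z = Vₘ.[ n ]⁻¹ V.* (v V.- u)
      module VR = SetoidReasoning V.setoid
      nz≈ : Vₘ.[ n ] V.* z V.≈ v V.- u
      nz≈ = V.trans (V.sym (V.*-assoc _ _ _)) (V.trans (V.*-congʳ (Vₘ.[]-inverseʳ n)) (V.*-identityˡ _))
      u+nz≈v : u V.+ Vₘ.[ n ] V.* z V.≈ v
      u+nz≈v = V.trans (V.+-congˡ nz≈) (V.trans (V.+-comm _ _) (V.trans (V.+-assoc _ _ _)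
        (V.trans (V.+-congˡ (V.-‿inverseˡ u)) (V.+-identityʳ v))))
      ĵz≈ : [ m ] * w ≈ ĵ z
      ĵz≈ = begin
        [ m ] * w                                    ≈⟨ []⁻¹-cancel n _ ⟨
        ĵ Vₘ.[ n ]⁻¹ * ([ n ] * ([ m ] * w))         ≈⟨ *-congˡ (M.[⊛]-*ˡ n m w) ⟨
        ĵ Vₘ.[ n ]⁻¹ * ([ n M.⊛ m ] * w)             ≈⟨ *-congˡ (difference _ _ _ v≈) ⟨
        ĵ Vₘ.[ n ]⁻¹ * (ĵ v - ĵ u)                   ≈⟨ *-congˡ (trans (ĵ.+-homo _ _) (+-congˡ (ĵ.-‿homo u))) ⟨
        ĵ Vₘ.[ n ]⁻¹ * ĵ (v V.- u)                   ≈⟨ ĵ.*-homo _ _ ⟨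
        ĵ z                                          ∎
        where
        difference : ∀ x y z → x ≈ y + z → x - y ≈ z
        difference x y z eq = trans (+-congʳ (trans eq (+-comm y z)))
          (trans (+-assoc _ _ _) (trans (+-congˡ (-‿inverseʳ y)) (+-identityʳ z)))
      nz∈ : Vₘ.[ n ] V.* z ∈ ⟪ L ⟫
      nz∈ = span-scalarˡ (overℤ V) {g = generators Λ} {h = generators L} (+ suc n) nΛ⊆L {z}
        (Λ-saturated {z} (hat-resp Λ {[ m ] * w} {ĵ z} ĵz≈ (mL⊆Λ {w} w∈)))

  opaque
    hat-neg : ∀ L {x} → x ∈ hat L → - x ∈ hat L
    hat-neg L {x} = span-neg Ŵ {g = ĵ ∘ generators L} {x}

  opaque
    hat-* : ∀ (R : Order V) {x y} → x ∈ hat (Order.lattice R) → y ∈ hat (Order.lattice R) → x * y ∈ hat (Order.lattice R)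
    hat-* R {x} {y} = span-* {g = ĵ ∘ generators (Order.lattice R)} λ i k →
      hat-resp (Order.lattice R) {ĵ (generators (Order.lattice R) i V.* generators (Order.lattice R) k)} (ĵ.*-homo _ _)
        (ĵ-∈ (Order.lattice R) {generators (Order.lattice R) i V.* generators (Order.lattice R) k}
          (Order.*-closed R (Vℤ.span-generator {g = generators (Order.lattice R)} i)
                            (Vℤ.span-generator {g = generators (Order.lattice R)} k)))

  opaque
    hat-1 : ∀ (R : Order V) → 1# ∈ hat (Order.lattice R)
    hat-1 R = hat-resp (Order.lattice R) {ĵ V.1#} {1#} ĵ.1#-homo (ĵ-∈ (Order.lattice R) {V.1#} (Order.1-closed R))

  module _ (R : Order V) where
    private
      Λᴿ = Order.lattice R
      ĝ = ĵ ∘ generators Λᴿ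

    Generates : Lattice V → Unit ring → Set
    Generates L x = hat L ≐ Image setoid (_* value x) (hat Λᴿ)

    LocallyPrincipal : Lattice V → Set
    LocallyPrincipal L = ∀ ℓ → ∃ λ (x : Unit (W.ring ℓ)) →
      loc ℓ L ≐ Image (W.setoid ℓ) (λ r → W._*_ ℓ r (value x)) (loc ℓ Λᴿ)

    opaque
      generator : ∀ {L} → LocallyPrincipal L → ∃ (Generates L)
      generator {L} principal = x , (to , from)
        where
        module _ (ℓ : Prime#) where
          private module Wₗ = Algebra (W ℓ)
          xₗ : Unit Wₗ.ring
          xₗ = proj₁ (principal ℓ)
          1∈loc : Wₗ.1# ∈ loc ℓ Λᴿ
          1∈loc = SpanProperties.span-resp (W ℓ) {g = j ℓ ∘ generators Λᴿ} {π ℓ 1#} {Wₗ.1#} (π.1#-homo ℓ) (π-∈ ℓ Λᴿ {1#} (hat-1 R))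
          xₗ∈ : value xₗ ∈ loc ℓ L
          xₗ∈ = proj₂ (proj₂ (principal ℓ)) {value xₗ} (Wₗ.1# , 1∈loc , Wₗ.sym (Wₗ.*-identityˡ _))
        x̂ : ∃ λ ŵ → ŵ ∈ hat L × ∀ ℓ → W._≈_ ℓ (π ℓ ŵ) (value (xₗ ℓ))
        x̂ = assemble L (λ ℓ → value (xₗ ℓ)) xₗ∈
        -- Some non-zero integer lies in `L̂`. Its quotients by the local generators lie in the
        -- completions of `R`, so they assemble in `R̂`, and dividing by that integer gives the
        -- inverse of `x̂`.
        n : ℕ
        n = proj₁ (bounded L 1#)
        [n]∈ : [ n ] ∈ hat L
        [n]∈ = hat-resp L {[ n ] * 1#} {[ n ]} (*-identityʳ _) (proj₂ (bounded L 1#))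
        quotientₗ : ∀ ℓ → ∃ λ r → r ∈ loc ℓ Λᴿ × W._≈_ ℓ (π ℓ [ n ]) (W._*_ ℓ r (value (xₗ ℓ)))
        quotientₗ ℓ = proj₁ (proj₂ (principal ℓ)) {π ℓ [ n ]} (π-∈ ℓ L {[ n ]} [n]∈)
        r̂ : ∃ λ ŵ → ŵ ∈ hat Λᴿ × ∀ ℓ → W._≈_ ℓ (π ℓ ŵ) (proj₁ (quotientₗ ℓ))
        r̂ = assemble Λᴿ (λ ℓ → proj₁ (quotientₗ ℓ)) (λ ℓ → proj₁ (proj₂ (quotientₗ ℓ)))
        x⁻¹ : Carrier
        x⁻¹ = ĵ Vₘ.[ n ]⁻¹ * proj₁ r̂
        left : x⁻¹ * proj₁ x̂ ≈ 1#
        left = begin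
          x⁻¹ * proj₁ x̂                          ≈⟨ *-assoc _ _ _ ⟩
          ĵ Vₘ.[ n ]⁻¹ * (proj₁ r̂ * proj₁ x̂)     ≈⟨ *-congˡ (π-injective rx≈n) ⟩
          ĵ Vₘ.[ n ]⁻¹ * [ n ]                   ≈⟨ *-congˡ (*-identityʳ _) ⟨
          ĵ Vₘ.[ n ]⁻¹ * ([ n ] * 1#)            ≈⟨ []⁻¹-cancel n 1# ⟩
          1#                                     ∎
          where
          rx≈n : ∀ ℓ → W._≈_ ℓ (π ℓ (proj₁ r̂ * proj₁ x̂)) (π ℓ [ n ])
          rx≈n ℓ = Wₗ.trans (π.*-homo ℓ _ _) (Wₗ.trans (Wₗ.*-cong (proj₂ (proj₂ r̂) ℓ) (proj₂ (proj₂ x̂) ℓ))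
            (Wₗ.sym (proj₂ (proj₂ (quotientₗ ℓ)))))
            where module Wₗ = Algebra (W ℓ)
        right : proj₁ x̂ * x⁻¹ ≈ 1#
        right = π-injective xx⁻¹≈1
          where
          -- Only a left inverse of `x̂` is known so far. At each `ℓ` the component of `x̂` is the
          -- unit `xₗ`, whose left inverse is its inverse.
          right-of-left : ∀ ℓ (u : Unit (W.ring ℓ)) {x y z} → W._≈_ ℓ z (W._*_ ℓ x y) →
            W._≈_ ℓ x (value u) → W._≈_ ℓ (W._*_ ℓ y x) (W.1# ℓ) → W._≈_ ℓ z (W.1# ℓ)
          right-of-left ℓ u {x} {y} {z} z≈ x≈ yx≈1 = Wₗ.trans z≈ (Wₗ.trans (Wₗ.*-cong x≈ y≈) (inverseʳ u))
            where
            module Wₗ = Algebra (W ℓ)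
            y≈ : y Wₗ.≈ inv u
            y≈ = Wₗ.trans (UnitProperties.cancelʳ Wₗ.ring y (inverseʳ u))
              (Wₗ.trans (Wₗ.*-congʳ (Wₗ.trans (Wₗ.*-congˡ (Wₗ.sym x≈)) yx≈1)) (Wₗ.*-identityˡ _))
          xx⁻¹≈1 : ∀ ℓ → W._≈_ ℓ (π ℓ (proj₁ x̂ * x⁻¹)) (π ℓ 1#)
          xx⁻¹≈1 ℓ = Wₗ.trans (right-of-left ℓ (xₗ ℓ) (π.*-homo ℓ _ _) (proj₂ (proj₂ x̂) ℓ)
            (Wₗ.trans (Wₗ.sym (π.*-homo ℓ _ _)) (Wₗ.trans (π.⟦⟧-cong ℓ left) (π.1#-homo ℓ))))
            (Wₗ.sym (π.1#-homo ℓ))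
            where module Wₗ = Algebra (W ℓ)
        x : Unit ring
        x = record { value = proj₁ x̂ ; inv = x⁻¹ ; inverseˡ = left ; inverseʳ = right }
        to : ∀ {z} → z ∈ hat L → z ∈ Image setoid (_* value x) (hat Λᴿ)
        to {z} z∈ = proj₁ s , proj₁ (proj₂ s) , π-injective z≈sx
          where
          sₗ : ∀ ℓ → ∃ λ r → r ∈ loc ℓ Λᴿ × W._≈_ ℓ (π ℓ z) (W._*_ ℓ r (value (xₗ ℓ)))
          sₗ ℓ = proj₁ (proj₂ (principal ℓ)) {π ℓ z} (π-∈ ℓ L {z} z∈)
          s : ∃ λ ŵ → ŵ ∈ hat Λᴿ × ∀ ℓ → W._≈_ ℓ (π ℓ ŵ) (proj₁ (sₗ ℓ))
          s = assemble Λᴿ (λ ℓ → proj₁ (sₗ ℓ)) (λ ℓ → proj₁ (proj₂ (sₗ ℓ)))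
          z≈sx : ∀ ℓ → W._≈_ ℓ (π ℓ z) (π ℓ (proj₁ s * proj₁ x̂))
          z≈sx ℓ = Wₗ.trans (proj₂ (proj₂ (sₗ ℓ))) (Wₗ.sym (Wₗ.trans (π.*-homo ℓ _ _)
            (Wₗ.*-cong (proj₂ (proj₂ s) ℓ) (proj₂ (proj₂ x̂) ℓ))))
            where module Wₗ = Algebra (W ℓ)
        from : ∀ {z} → z ∈ Image setoid (_* value x) (hat Λᴿ) → z ∈ hat L
        from {z} (r , r∈ , z≈) = hat-resp L {proj₁ s} {z} (π-injective (proj₂ (proj₂ s))) (proj₁ (proj₂ s))
          where
          zₗ∈ : ∀ ℓ → π ℓ z ∈ loc ℓ L
          zₗ∈ ℓ = proj₂ (proj₂ (principal ℓ)) {π ℓ z} (π ℓ r , π-∈ ℓ Λᴿ {r} r∈ ,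
            Wₗ.trans (π.⟦⟧-cong ℓ z≈) (Wₗ.trans (π.*-homo ℓ _ _) (Wₗ.*-congˡ (proj₂ (proj₂ x̂) ℓ))))
            where module Wₗ = Algebra (W ℓ)
          s : ∃ λ ŵ → ŵ ∈ hat L × ∀ ℓ → W._≈_ ℓ (π ℓ ŵ) (π ℓ z)
          s = assemble L (λ ℓ → π ℓ z) zₗ∈

    private
      module Wᵤ ℓ = UnitProperties (W.ring ℓ)
      module Ŵᵤ = UnitProperties ring

    opaque
      divide : ∀ {L x z} → Generates L x → z ∈ hat L → z * inv x ∈ hat Λᴿ
      divide {L} {x} {z} (to , _) z∈ with to {z} z∈
      ... | r , r∈ , z≈ = hat-resp Λᴿ {r} {z * inv x}
        (trans (Ŵᵤ.cancelʳ r (inverseʳ x)) (*-congʳ (sym z≈))) r∈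

    opaque
      multiply : ∀ {L x r} → Generates L x → r ∈ hat Λᴿ → r * value x ∈ hat L
      multiply {L} {x} {r} (_ , from) r∈ = from {r * value x} (r , r∈ , refl)

    opaque
      undivide : ∀ {L x z} → Generates L x → z * inv x ∈ hat Λᴿ → z ∈ hat L
      undivide {L} {x} {z} gen zx⁻¹∈ = hat-resp L {z * inv x * value x} {z}
        (sym (Ŵᵤ.cancelʳ z (inverseˡ x))) (multiply {L} {x} {z * inv x} gen zx⁻¹∈)

    opaque
      -- The component of `x` at `ℓ` is a local generator. Both inclusions are checked on lattice
      -- generators only: these come from `V`, so that `divide` and `multiply` apply to them before
      -- passing to the component.
      generates⇒principal : ∀ {L x} → Generates L x → LocallyPrincipal L
      generates⇒principal {L} {x} gen ℓ = xₗ ,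
        (λ {z} z∈ → z Wₗ.* inv xₗ , to z z∈ , Wᵤ.cancelʳ ℓ z (inverseˡ xₗ)) ,
        (λ {z} (r , r∈ , z≈) → SpanProperties.span-resp (W ℓ) {g = j ℓ ∘ generators L} {r Wₗ.* π ℓ (value x)} {z}
          (Wₗ.sym z≈) (from r r∈))
        where
        module Wₗ = Algebra (W ℓ)
        xₗ : Unit Wₗ.ring
        xₗ = record
          { value = π ℓ (value x) ; inv = π ℓ (inv x)
          ; inverseˡ = Wₗ.trans (Wₗ.sym (π.*-homo ℓ _ _)) (Wₗ.trans (π.⟦⟧-cong ℓ (inverseˡ x)) (π.1#-homo ℓ))
          ; inverseʳ = Wₗ.trans (Wₗ.sym (π.*-homo ℓ _ _)) (Wₗ.trans (π.⟦⟧-cong ℓ (inverseʳ x)) (π.1#-homo ℓ)) }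
        π-ĵ-* : ∀ v w → π ℓ (ĵ v * w) Wₗ.≈ j ℓ v Wₗ.* π ℓ w
        π-ĵ-* v w = Wₗ.trans (π.*-homo ℓ _ _) (Wₗ.*-congʳ (π-ĵ ℓ v))
        to : ∀ z → z ∈ loc ℓ L → z Wₗ.* inv xₗ ∈ loc ℓ Λᴿ
        to z = span-*ʳ (W ℓ) {g = j ℓ ∘ generators L} {h = j ℓ ∘ generators Λᴿ} (inv xₗ)
          (λ i → SpanProperties.span-resp (W ℓ) {g = j ℓ ∘ generators Λᴿ}
            {π ℓ (ĵ (generators L i) * inv x)} {j ℓ (generators L i) Wₗ.* inv xₗ} (π-ĵ-* _ _)
            (π-∈ ℓ Λᴿ {ĵ (generators L i) * inv x} (divide {L} {x} {ĵ (generators L i)} gen (generator-∈ L i)))) {z}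
        from : ∀ r → r ∈ loc ℓ Λᴿ → r Wₗ.* value xₗ ∈ loc ℓ L
        from r = span-*ʳ (W ℓ) {g = j ℓ ∘ generators Λᴿ} {h = j ℓ ∘ generators L} (value xₗ)
          (λ i → SpanProperties.span-resp (W ℓ) {g = j ℓ ∘ generators L}
            {π ℓ (ĵ (generators Λᴿ i) * value x)} {j ℓ (generators Λᴿ i) Wₗ.* value xₗ} (π-ĵ-* _ _)
            (π-∈ ℓ L {ĵ (generators Λᴿ i) * value x} (multiply {L} {x} {ĵ (generators Λᴿ i)} gen (generator-∈ Λᴿ i)))) {r}

    opaque
      -- The approximation gives `x = t + [ n ] w` with `w ∈ R̂`, and the lattice is
      -- `R t + [ n ] R`. Its completion lies in `R̂ x`, since `[ n ] x⁻¹` and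
      -- `t x⁻¹ = 1 - w ([ n ] x⁻¹)` lie in `R̂`; conversely `r x = r t + [ n ] (r w)`.
      ideal : ∀ x → ∃ λ L → Generates L x
      ideal x = L , to , from
        where
        boundₓ : ∃ λ n → [ n ] * value x ∈ hat Λᴿ
        boundₓ = bounded Λᴿ (value x)
        boundₓ⁻¹ : ∃ λ n → [ n ] * inv x ∈ hat Λᴿ
        boundₓ⁻¹ = bounded Λᴿ (inv x)
        n : ℕ
        n = proj₁ boundₓ M.⊛ proj₁ boundₓ⁻¹
        nx∈ : [ n ] * value x ∈ hat Λᴿ
        nx∈ = hat-resp Λᴿ (sym (M.[⊛]-*ʳ (proj₁ boundₓ) (proj₁ boundₓ⁻¹) (value x)))
          ([ proj₁ boundₓ⁻¹ ]-hat Λᴿ {[ proj₁ boundₓ ] * value x} (proj₂ boundₓ))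
        nx⁻¹∈ : [ n ] * inv x ∈ hat Λᴿ
        nx⁻¹∈ = hat-resp Λᴿ (sym (M.[⊛]-*ˡ (proj₁ boundₓ) (proj₁ boundₓ⁻¹) (inv x)))
          ([ proj₁ boundₓ ]-hat Λᴿ {[ proj₁ boundₓ⁻¹ ] * inv x} (proj₂ boundₓ⁻¹))
        -- The precision is the square of `[ n ]`: one factor is spent on `t = r / [ n ]`, the other
        -- keeps the error of `t` in `[ n ] R̂`.
        approximation : ∃₂ λ r w → r ∈ ⟪ Λᴿ ⟫ × w ∈ hat Λᴿ × [ n ] * value x ≈ ĵ r + [ n M.⊛ n ] * w
        approximation = approximate Λᴿ (n M.⊛ n) {[ n ] * value x} nx∈
        t : V.Carrier
        t = Vₘ.[ n ]⁻¹ V.* proj₁ approximation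
        w : Carrier
        w = proj₁ (proj₂ approximation)
        w∈ : w ∈ hat Λᴿ
        w∈ = proj₁ (proj₂ (proj₂ (proj₂ approximation)))
        x≈ : value x ≈ ĵ t + [ n ] * w
        x≈ = begin
          value x ≈⟨ []⁻¹-cancel n _ ⟨
          ĵ Vₘ.[ n ]⁻¹ * ([ n ] * value x) ≈⟨ *-congˡ (proj₂ (proj₂ (proj₂ (proj₂ approximation)))) ⟩
          ĵ Vₘ.[ n ]⁻¹ * (ĵ (proj₁ approximation) + [ n M.⊛ n ] * w) ≈⟨ distribˡ _ _ _ ⟩
          ĵ Vₘ.[ n ]⁻¹ * ĵ (proj₁ approximation) + ĵ Vₘ.[ n ]⁻¹ * ([ n M.⊛ n ] * w)
            ≈⟨ +-cong (sym (ĵ.*-homo _ _)) (trans (*-congˡ (M.[⊛]-*ˡ n n w)) ([]⁻¹-cancel n _)) ⟩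
          ĵ t + [ n ] * w ∎
        g₁ g₂ : Vector V.Carrier (Lattice.size Λᴿ)
        g₁ i = generators Λᴿ i V.* t
        g₂ i = Vₘ.[ n ] V.* generators Λᴿ i
        g₁∈ : ∀ {T} (A : Algebra T) (f : V.Carrier → Algebra.Carrier A) i → f (g₁ i) ∈ Span A (f ∘ (g₁ ++ g₂))
        g₁∈ A f i = ≡.subst (λ v → f v ∈ Span A (f ∘ (g₁ ++ g₂))) (lookup-++ˡ g₁ g₂ i)
          (SpanProperties.span-generator A {g = f ∘ (g₁ ++ g₂)} (i ↑ˡ _))
        g₂∈ : ∀ {T} (A : Algebra T) (f : V.Carrier → Algebra.Carrier A) i → f (g₂ i) ∈ Span A (f ∘ (g₁ ++ g₂))
        g₂∈ A f i = ≡.subst (λ v → f v ∈ Span A (f ∘ (g₁ ++ g₂))) (lookup-++ʳ g₁ g₂ i)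
          (SpanProperties.span-generator A {g = f ∘ (g₁ ++ g₂)} (_ ↑ʳ i))
        spanning : ∀ v → v ∈ Span V (g₁ ++ g₂)
        spanning v = SpanProperties.span-resp V {g = g₁ ++ g₂} {Vₘ.[ n ] V.* (Vₘ.[ n ]⁻¹ V.* v)} {v}
          (UnitProperties.cancelˡ V.ring v (Vₘ.[]-inverseʳ n))
          (span-scalarˡ V {g = generators Λᴿ} {h = g₁ ++ g₂} (ℚ.fromℤ (+ suc n)) (g₂∈ V (λ v → v)) {Vₘ.[ n ]⁻¹ V.* v}
            (Lattice.spanning Λᴿ (Vₘ.[ n ]⁻¹ V.* v)))
        L : Lattice V
        L = record { generators = g₁ ++ g₂ ; spanning = spanning }
        t/x∈ : ĵ t * inv x ∈ hat Λᴿ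
        t/x∈ = hat-resp Λᴿ {1# + - (w * ([ n ] * inv x))} {ĵ t * inv x} (sym (begin
          ĵ t * inv x                                     ≈⟨ *-congʳ (difference _ _ _ x≈) ⟩
          (value x + - ([ n ] * w)) * inv x               ≈⟨ distribʳ _ _ _ ⟩
          value x * inv x + - ([ n ] * w) * inv x         ≈⟨ +-cong (inverseʳ x) (sym (-‿distribˡ-* _ _)) ⟩
          1# + - ([ n ] * w * inv x)                      ≈⟨ +-congˡ (-‿cong (trans (scalar-* Ŵ _ _ _) (sym (*-scalar Ŵ _ _ _)))) ⟩
          1# + - (w * ([ n ] * inv x))                    ∎))
          (span-+ {g = ĝ} {1#} { - (w * ([ n ] * inv x))} (hat-1 R)
            (hat-neg Λᴿ {w * ([ n ] * inv x)} (hat-* R {w} {[ n ] * inv x} w∈ nx⁻¹∈)))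
          where
          open RingProperties ring
          difference : ∀ x y z → x ≈ y + z → y ≈ x + - z
          difference x y z eq = sym (trans (+-congʳ eq) (trans (+-assoc _ _ _) (trans (+-congˡ (-‿inverseʳ z)) (+-identityʳ y))))
        g/x∈ : ∀ k → ĵ ((g₁ ++ g₂) k) * inv x ∈ hat Λᴿ
        g/x∈ k with splitAt (Lattice.size Λᴿ) k
        ... | inj₁ i = hat-resp Λᴿ {ĵ (generators Λᴿ i) * (ĵ t * inv x)} {ĵ (g₁ i) * inv x}
          (trans (sym (*-assoc _ _ _)) (*-congʳ (sym (ĵ.*-homo _ _))))
          (hat-* R {ĵ (generators Λᴿ i)} {ĵ t * inv x} (generator-∈ Λᴿ i) t/x∈)
        ... | inj₂ i = hat-resp Λᴿ {ĵ (generators Λᴿ i) * ([ n ] * inv x)} {ĵ (g₂ i) * inv x}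
          (trans (*-scalar Ŵ _ _ _) (trans (sym (*-assoc _ _ _)) (*-congʳ (sym (ĵ-[]-* n _)))))
          (hat-* R {ĵ (generators Λᴿ i)} {[ n ] * inv x} (generator-∈ Λᴿ i) nx⁻¹∈)
        to : ∀ {z} → z ∈ hat L → z ∈ Image setoid (_* value x) (hat Λᴿ)
        to {z} z∈ = z * inv x , span-*ʳ Ŵ {g = ĵ ∘ (g₁ ++ g₂)} {h = ĝ} (inv x) g/x∈ {z} z∈ , Ŵᵤ.cancelʳ z (inverseˡ x)
        from : ∀ {z} → z ∈ Image setoid (_* value x) (hat Λᴿ) → z ∈ hat L
        from {z} (r , r∈ , z≈) = hat-resp L {r * ĵ t + [ n ] * (r * w)} {z}
          (sym (trans z≈ (trans (*-congˡ x≈) (trans (distribˡ _ _ _) (+-congˡ (*-scalar Ŵ _ _ _))))))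
          (span-+ {g = ĵ ∘ (g₁ ++ g₂)} {r * ĵ t} {[ n ] * (r * w)}
            (span-*ʳ Ŵ {g = ĝ} {h = ĵ ∘ (g₁ ++ g₂)} (ĵ t) (λ i → hat-resp L {ĵ (g₁ i)} {ĝ i * ĵ t} (ĵ.*-homo _ _) (g₁∈ Ŵ ĵ i)) {r} r∈)
            (span-scalarˡ Ŵ {g = ĝ} {h = ĵ ∘ (g₁ ++ g₂)} (Coefficients.ι Ẑ (+ suc n))
              (λ i → hat-resp L {ĵ (g₂ i)} {[ n ] * ĝ i} (ĵ-[]-* n _) (g₂∈ Ŵ ĵ i)) {r * w} (hat-* R {r} {w} r∈ w∈)))

    opaque
      -- As `1 ∈ R̂`, the generator `x` itself lies in `L̂`, so it is a Ẑ-combination of elements of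
      -- `L`, and right multiplication by `w` sends these into `R̂`.
      generator-minimal : ∀ {L x} → Generates L x → ∀ w → (∀ {v} → v ∈ ⟪ L ⟫ → ĵ v * w ∈ hat Λᴿ) →
        value x * w ∈ hat Λᴿ
      generator-minimal {L} {x} gen w Lw⊆ = span-*ʳ Ŵ {g = ĵ ∘ generators L} {h = ĝ} w
        (λ i → Lw⊆ {generators L i} (Vℤ.span-generator {g = generators L} i)) {value x}
        (hat-resp L {1# * value x} {value x} (*-identityˡ _) (multiply {L} {x} {1#} gen (hat-1 R)))

    opaque
      ĵ-divide : ∀ {L x v} → Generates L x → v ∈ ⟪ L ⟫ → ĵ v * inv x ∈ hat Λᴿ
      ĵ-divide {L} {x} {v} gen v∈ = divide {L} {x} {ĵ v} gen (ĵ-∈ L {v} v∈)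

    opaque
      ĵ-undivide : ∀ {L x v} → Generates L x → ĵ v * inv x ∈ hat Λᴿ → v ∈ ⟪ L ⟫
      ĵ-undivide {L} {x} {v} gen vx⁻¹∈ = saturated L {v} (undivide {L} {x} {ĵ v} gen vx⁻¹∈)

    opaque
      principal-ideal : ∀ x → ∃ λ L → LocallyPrincipal L × Generates L x
      principal-ideal x = proj₁ (ideal x) , generates⇒principal {proj₁ (ideal x)} {x} (proj₂ (ideal x)) , proj₂ (ideal x)

    -- With R̂ and IsLeftIdeal as separate parameters the type of an instance
    -- agrees syntactically with the intended one; comparing the two by
    -- unfolding the completions is infeasible.
    module _ (R̂ : Pred Carrier 0ℓ) (R̂⊆hat : ∀ {x} → x ∈ R̂ → x ∈ hat Λᴿ) (hat⊆R̂ : ∀ {x} → x ∈ hat Λᴿ → x ∈ R̂)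
      (IsLeftIdeal : Lattice V → Set)
      (leftIdeal⇒principal : ∀ L → IsLeftIdeal L → LocallyPrincipal L)
      (principal⇒leftIdeal : ∀ L → LocallyPrincipal L → IsLeftIdeal L)
      (K : ℚ-Algebra) (O : Order K) (i : Embedding (Algebra.ring K) V.ring)
      (iₐ-hom : Hom (Algebra.ring K) (Algebra.ring Ŵ) (λ k → ĵ (Embedding.⟦_⟧ i k)))
      {1∈R̂ : 1# ∈ R̂} {R̂-* : ∀ {x y} → x ∈ R̂ → y ∈ R̂ → x * y ∈ R̂}
      (K-comm : ∀ k l → Algebra._≈_ K (Algebra._*_ K k l) (Algebra._*_ K l k))
      (skolem-noether : AllEmbeddingsConjugate i)
      (centralizer : SelfCentralizing i)
      where

      bijection : Bijection (SpecialPoints.classes V K O IsLeftIdeal)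
        (DoubleCosets.setoid (Algebra.ring K) (Algebra.ring Ŵ) ⟦ O ⟧ₒ (λ k → ĵ (Embedding.⟦_⟧ i k)) iₐ-hom R̂ 1∈R̂ R̂-*)
      bijection = Correspondence.bijection V K O IsLeftIdeal ring ĵ ĵ-hom R̂
        (λ {x} {y} x≈y x∈ → hat⊆R̂ {y} (hat-resp Λᴿ {x} {y} x≈y (R̂⊆hat {x} x∈)))
        1∈R̂ (λ {x} {y} → R̂-* {x} {y}) i iₐ-hom K-comm Generates
        (λ {L} {x} {v} gen v∈ → hat⊆R̂ {ĵ v * inv x} (ĵ-divide {L} {x} {v} gen v∈))
        (λ {L} {x} {v} gen vx⁻¹∈ → ĵ-undivide {L} {x} {v} gen (R̂⊆hat {ĵ v * inv x} vx⁻¹∈))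
        (λ {L} {x} gen w Lw⊆ → hat⊆R̂ {value x * w}
          (generator-minimal {L} {x} gen w λ {v} v∈ → R̂⊆hat {ĵ v * w} (Lw⊆ {v} v∈)))
        (λ L ideal → generator {L} (leftIdeal⇒principal L ideal))
        (λ x → let (L , principal , gen) = principal-ideal x in L , principal⇒leftIdeal L principal , gen)
        skolem-noether centralizer

-- Quaternions in coordinates

-- Opaque, so that sums over the basis are not unfolded into coordinates.
opaque
  rank : ℕ
  rank = 4

module QuaternionCoordinates (S : CommutativeRing 0ℓ 0ℓ) (a b : CommutativeRing.Carrier S) where
  private module S = CommutativeRing S
  open S using () renaming (_+_ to _⊕_; _*_ to _⊗_; -_ to ⊖_; 0# to O; 1# to I)
  open Algebra (Quaternion.algebra S a b) hiding (zero)
  open Sum semiring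
  open SemiringSolver S.commutativeSemiring

  opaque
    scalar-coordinates : ∀ c x y z w → scalar c * ((x , y) , (z , w)) ≈ ((c ⊗ x , c ⊗ y) , (c ⊗ z , c ⊗ w))
    scalar-coordinates c x y z w =
      -- The semiring solver has no negation: the conjugates in the product enter as the atoms `⊖ w`
      -- and, further down, `⊖ y`.
      ( solve 7 (λ a b c x y z w → let o = con 0 in
          (c :* x :+ a :* (o :* y)) :+ (b :* (o :* z :+ a :* (o :* w)) :+ a :* (o :* (o :* w :+ o :* z))) := c :* x)
          S.refl a b c x y z (⊖ w)
      , solve 7 (λ a b c x y z w → let o = con 0 in
          (c :* y :+ o :* x) :+ (b :* (o :* w :+ o :* z) :+ o :* (o :* z :+ a :* (o :* w))) := c :* y)
          S.refl a b c x y z (⊖ w) ) ,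
      ( solve 6 (λ a c x y z w → let o = con 0 in
          (c :* z :+ a :* (o :* w)) :+ (o :* x :+ a :* (o :* y)) := c :* z) S.refl a c x (⊖ y) z w
      , solve 5 (λ c x y z w → let o = con 0 in
          (c :* w :+ o :* z) :+ (o :* y :+ o :* x) := c :* w) S.refl c x (⊖ y) z w )

  standardBasis : Vector Carrier 4
  standardBasis zero                   = (I , O) , (O , O)
  standardBasis (suc zero)             = (O , I) , (O , O)
  standardBasis (suc (suc zero))       = (O , O) , (I , O)
  standardBasis (suc (suc (suc zero))) = (O , O) , (O , I)

  vector : ∀ {X : Set} → X → X → X → X → Vector X 4
  vector x y z w zero                   = x
  vector x y z w (suc zero)             = y
  vector x y z w (suc (suc zero))       = z
  vector x y z w (suc (suc (suc zero))) = w

  opaque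
    combination-coordinates : ∀ (c : Vector S.Carrier 4) → ∑[ i < 4 ] (scalar (c i) * standardBasis i) ≈
      ((c zero , c (suc zero)) , (c (suc (suc zero)) , c (suc (suc (suc zero)))))
    combination-coordinates c = trans {∑[ i < 4 ] (scalar (c i) * standardBasis i)} {∑[ i < 4 ] (c i ⊙ standardBasis i)}
      (sum-cong-≋ {4} {λ i → scalar (c i) * standardBasis i} {λ i → c i ⊙ standardBasis i}
        (λ i → let ((x , y) , (z , w)) = standardBasis i in scalar-coordinates (c i) x y z w))
      ( ( S.trans (solve 5 (λ w x y z i → let o = con 0 in
            w :* i :+ (x :* o :+ (y :* o :+ (z :* o :+ o))) := w :* i) S.refl w x y z I) (S.*-identityʳ w)
        , S.trans (solve 5 (λ w x y z i → let o = con 0 in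
            w :* o :+ (x :* i :+ (y :* o :+ (z :* o :+ o))) := x :* i) S.refl w x y z I) (S.*-identityʳ x) )
      , ( S.trans (solve 5 (λ w x y z i → let o = con 0 in
            w :* o :+ (x :* o :+ (y :* i :+ (z :* o :+ o))) := y :* i) S.refl w x y z I) (S.*-identityʳ y)
        , S.trans (solve 5 (λ w x y z i → let o = con 0 in
            w :* o :+ (x :* o :+ (y :* o :+ (z :* i :+ o))) := z :* i) S.refl w x y z I) (S.*-identityʳ z) ) )
      where
      _⊙_ : S.Carrier → Carrier → Carrier
      c ⊙ ((x , y) , (z , w)) = (c ⊗ x , c ⊗ y) , (c ⊗ z , c ⊗ w)
      w x y z : S.Carrier
      w = c zero
      x = c (suc zero)
      y = c (suc (suc zero))
      z = c (suc (suc (suc zero)))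

  opaque
    unfolding rank

    basis : Vector Carrier rank
    basis = standardBasis

    basis-spans : ∀ x → x ∈ Span (Quaternion.algebra S a b) basis
    basis-spans ((x , y) , (z , w)) = c , sym {∑[ i < 4 ] (scalar (c i) * basis i)} {(x , y) , (z , w)} (combination-coordinates c)
      where
      c : Vector S.Carrier 4
      c = vector x y z w

  module _ (T : CommutativeRing 0ℓ 0ℓ) (f : CommutativeRing.Carrier T → S.Carrier)
    (f-hom : Hom (CommutativeRing.ring T) S.ring f) where
    private
      module T = CommutativeRing T
      V : Algebra T
      V = restrict {T} {S} f f-hom (Quaternion.algebra S a b)

    opaque
      unfolding basis

      -- `g` will be the image of the rational basis in the completion.
      span⇒coordinates : (g : Vector Carrier rank) → (∀ i → g i ≈ basis i) → ∀ v → v ∈ Span V g →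
        ∃₂ λ (c₀ c₁ : T.Carrier) → ∃₂ λ (c₂ c₃ : T.Carrier) → v ≈ ((f c₀ , f c₁) , (f c₂ , f c₃))
      span⇒coordinates g g≈ v (c , v≈) = c zero , c (suc zero) , c (suc (suc zero)) , c (suc (suc (suc zero))) ,
        trans {v} {∑[ i < 4 ] (scalar (f (c i)) * g i)} v≈
          (trans {∑[ i < 4 ] (scalar (f (c i)) * g i)} {∑[ i < 4 ] (scalar (f (c i)) * basis i)}
            (sum-cong-≋ {4} {λ i → scalar (f (c i)) * g i} {λ i → scalar (f (c i)) * basis i}
              (λ i → *-congˡ {scalar (f (c i))} {g i} {basis i} (g≈ i)))
            (combination-coordinates (f ∘ c)))

      coordinates⇒span : ∀ v c₀ c₁ c₂ c₃ → v ≈ ((f c₀ , f c₁) , (f c₂ , f c₃)) → v ∈ Span V basis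
      coordinates⇒span v c₀ c₁ c₂ c₃ v≈ = c ,
        trans {v} {(f c₀ , f c₁) , (f c₂ , f c₃)} {∑[ i < 4 ] (scalar (f (c i)) * basis i)} v≈
          (sym {∑[ i < 4 ] (scalar (f (c i)) * basis i)} {(f c₀ , f c₁) , (f c₂ , f c₃)} (combination-coordinates (f ∘ c)))
        where
        c : Vector T.Carrier 4
        c = vector c₀ c₁ c₂ c₃

  module _ (T : CommutativeRing 0ℓ 0ℓ) (f : CommutativeRing.Carrier T → S.Carrier)
    (f-hom : Hom (CommutativeRing.ring T) S.ring f)
    (ι : ℤ → CommutativeRing.Carrier T) (ι-hom : Hom (CommutativeRing.ring ℤ-ring) (CommutativeRing.ring T) ι)
    (f-fraction : ∀ q → ∃₂ λ n x → f (ι (+ suc n)) ⊗ q S.≈ f x) where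
    private
      V : Algebra T
      V = restrict {T} {S} f f-hom (Quaternion.algebra S a b)
      module D = Multiples V ι ι-hom

    opaque
      -- By `f-fraction` each coordinate of `w` is a fraction, whose denominator clears one term of
      -- the expansion in the basis.
      restricted-bounded : (g : Vector Carrier rank) → (∀ i → g i ≈ basis i) → ∀ w → D.Bounded g w
      restricted-bounded g g≈ w = span-elim (Quaternion.algebra S a b) {g = basis} (D.Bounded g)
        (λ {x} {y} → D.bounded-resp {g = g} {x} {y}) (D.bounded-0 {g = g}) (λ {x} {y} → D.bounded-+ {g = g} {x} {y})
        term {w} (basis-spans w)
        where
        term : ∀ q i → D.Bounded g (scalar q * basis i)
        term q i with f-fraction q
        ... | n , x , nq≈x = n , SpanProperties.span-resp V {g = g} {scalar (f x) * g i} {D.[ n ] * (scalar q * basis i)}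
          (trans {scalar (f x) * g i} {scalar (f x) * basis i} (*-congˡ {scalar (f x)} {g i} {basis i} (g≈ i))
            (trans {scalar (f x) * basis i} {D.[ n ] * scalar q * basis i}
              (*-congʳ {basis i} {scalar (f x)} {D.[ n ] * scalar q}
                (trans {scalar (f x)} {scalar (f (ι (+ suc n)) ⊗ q)} {D.[ n ] * scalar q}
                  (scalar.⟦⟧-cong (S.sym nq≈x))
                  (scalar.*-homo (f (ι (+ suc n))) q)))
              (*-assoc D.[ n ] (scalar q) (basis i))))
          (SpanProperties.span-scale V {g = g} x {g i} (SpanProperties.span-generator V {g = g} i))

ratio-* : ∀ q → ∃₂ λ n x → (Ẑℚ.fromA (Profinite.fromℤ (+ suc n)) Ẑℚ.*ᶠ q) Ẑℚ.≃ Ẑℚ.fromA x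
ratio-* (Ẑℚ.mkFraction x n) = n , x , Ẑℚ.equal 0 (Ẑ.*-congˡ {Ẑℚ.D 0} {Ẑℚ.D n Ẑ.* x Ẑ.* Ẑℚ.D 0} {x Ẑ.* Ẑℚ.D (n ℕ.+ 0)}
  (Ẑ.trans {Ẑℚ.D n Ẑ.* x Ẑ.* Ẑℚ.D 0} {Ẑℚ.D n Ẑ.* x} {x Ẑ.* Ẑℚ.D (n ℕ.+ 0)} (Ẑ.*-identityʳ (Ẑℚ.D n Ẑ.* x))
    (≡.subst (λ m → Ẑℚ.D n Ẑ.* x Ẑ.≈ x Ẑ.* Ẑℚ.D m) (≡.sym (ℕ.+-identityʳ n)) (Ẑ.*-comm (Ẑℚ.D n) x))))

component-fromℚ : ∀ ℓ q → component ℓ (Ẑℚ.fromℚ q) ≡ ℤₗℚ.fromℚ ℓ q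
component-fromℚ ℓ (mkℚ _ _ _) = ≡.refl

-- Completions of the quaternion algebra

module Completions (a b : ℚ) where
  private
    B : ℚ-Algebra
    B = quaternionAlgebra a b
    module B = Algebra B
    module CẐ = Completion Ẑ a b
    module Cℤ ℓ = Completion ℤ[ ℓ ] a b
    module BC = QuaternionCoordinates ℚ-ring a b
    module B̂C = QuaternionCoordinates Ẑℚ.commutativeRing (Ẑℚ.fromℚ a) (Ẑℚ.fromℚ b)
    module M ℓ = QuaternionMap Ẑℚ.commutativeRing (ℤₗℚ.commutativeRing ℓ) (component ℓ) (component-hom ℓ) (Ẑℚ.fromℚ a) (Ẑℚ.fromℚ b)
    module ℚM (C : Coefficients) = QuaternionMap ℚ-ring (Rat.commutativeRing C) (Rat.fromℚ C) (Rat.fromℚ-hom C) a b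

  Ŵ : Algebra (Coefficients.A Ẑ)
  Ŵ = record
    { ring           = Algebra.ring (Completion.algebra Ẑ a b)
    ; scalar         = Algebra.scalar CẐ.algebra/A
    ; scalar-hom     = Algebra.scalar-hom CẐ.algebra/A
    ; scalar-central = Algebra.scalar-central CẐ.algebra/A }
  module Ŵ = Algebra Ŵ

  W : ∀ ℓ → Algebra (Coefficients.A ℤ[ ℓ ])
  W ℓ = Completion.algebra/A ℤ[ ℓ ] a b
  module W ℓ = Algebra (W ℓ)

  π : ∀ ℓ → Ŵ.Carrier → W.Carrier ℓ
  π ℓ = M.map ℓ

  opaque
    π-hom : ∀ ℓ → Hom Ŵ.ring (W.ring ℓ) (π ℓ)
    -- The structure constants arise as components of those of `B̂`; that they are the images of `a`
    -- and `b` in the local ring is seen only after a case split on the rational numbers.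
    π-hom ℓ = ≡.subst₂ (λ x y → Hom Ŵ.ring (Quaternion.ring (ℤₗℚ.commutativeRing ℓ) x y) (π ℓ))
      (component-fromℚ ℓ a) (component-fromℚ ℓ b) (M.map-hom ℓ)

  opaque
    π-scalar : ∀ ℓ c → W._≈_ ℓ (π ℓ (Ŵ.scalar c)) (W.scalar ℓ (c ℓ))
    π-scalar ℓ c = M.map-scalar ℓ (Ẑℚ.fromA c)

  opaque
    π-include : ∀ ℓ v → W._≈_ ℓ (π ℓ (CẐ.include v)) (Cℤ.include ℓ v)
    π-include ℓ ((x , y) , (z , w)) = (reflexive x , reflexive y) , (reflexive z , reflexive w)
      where
      reflexive : ∀ q → ℤₗℚ._≃_ ℓ (component ℓ (Ẑℚ.fromℚ q)) (ℤₗℚ.fromℚ ℓ q)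
      reflexive q = CommutativeRing.reflexive (ℤₗℚ.commutativeRing ℓ) (component-fromℚ ℓ q)

  opaque
    π-injective : ∀ {x y} → (∀ ℓ → W._≈_ ℓ (π ℓ x) (π ℓ y)) → x Ŵ.≈ y
    π-injective h =
      (component-injective (λ ℓ → proj₁ (proj₁ (h ℓ))) , component-injective (λ ℓ → proj₂ (proj₁ (h ℓ)))) ,
      (component-injective (λ ℓ → proj₁ (proj₂ (h ℓ))) , component-injective (λ ℓ → proj₂ (proj₂ (h ℓ))))

  opaque
    include-scalar : ∀ k → CẐ.include (B.scalar (ℚ.fromℤ k)) Ŵ.≈ Ŵ.scalar (Coefficients.ι Ẑ k)
    include-scalar k = ℚM.map-scalar Ẑ (ℚ.fromℤ k)

  Λ : Lattice B
  Λ = record { generators = BC.basis ; spanning = BC.basis-spans }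

  opaque
    unfolding QuaternionCoordinates.basis

    include-basis : ∀ i → CẐ.include (BC.basis i) Ŵ.≈ B̂C.basis i
    include-basis zero = Ŵ.refl {B̂C.basis zero}
    include-basis (suc zero) = Ŵ.refl {B̂C.basis (suc zero)}
    include-basis (suc (suc zero)) = Ŵ.refl {B̂C.basis (suc (suc zero))}
    include-basis (suc (suc (suc zero))) = Ŵ.refl {B̂C.basis (suc (suc (suc zero)))}

  opaque
    -- Over the standard basis the coefficients are the coordinates of `v`, which are therefore
    -- rational numbers in Ẑ.
    Λ-saturated : ∀ {v} → CẐ.include v ∈ Span Ŵ (CẐ.include ∘ BC.basis) → v ∈ ⟪ Λ ⟫
    Λ-saturated {v@((x , y) , (z , w))} v∈ = fromCoordinates (B̂C.span⇒coordinates (Coefficients.A Ẑ) Ẑℚ.fromA Ẑℚ.fromA-hom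
      (CẐ.include ∘ BC.basis) include-basis (CẐ.include v) v∈)
      where
      fromCoordinates : (∃₂ λ c₀ c₁ → ∃₂ λ c₂ c₃ →
        CẐ.include v Ŵ.≈ ((Ẑℚ.fromA c₀ , Ẑℚ.fromA c₁) , (Ẑℚ.fromA c₂ , Ẑℚ.fromA c₃))) → v ∈ ⟪ Λ ⟫
      fromCoordinates (c₀ , c₁ , c₂ , c₃ , (x≈ , y≈) , (z≈ , w≈)) =
        BC.coordinates⇒span ℤ-ring ℚ.fromℤ ℤ→ℚ-hom v
          (proj₁ (integral x x≈)) (proj₁ (integral y y≈)) (proj₁ (integral z z≈)) (proj₁ (integral w w≈))
          ((proj₂ (integral x x≈) , proj₂ (integral y y≈)) , (proj₂ (integral z z≈) , proj₂ (integral w w≈)))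

  opaque
    Λ-bounded : ∀ w → Multiples.Bounded Ŵ (Coefficients.ι Ẑ) (Coefficients.ι-hom Ẑ) (CẐ.include ∘ BC.basis) w
    Λ-bounded = B̂C.restricted-bounded (Coefficients.A Ẑ) Ẑℚ.fromA Ẑℚ.fromA-hom (Coefficients.ι Ẑ) (Coefficients.ι-hom Ẑ)
      ratio-* (CẐ.include ∘ BC.basis) include-basis

-- Embeddings of quadratic fields

ℚ-*-cancelˡ-0 : ∀ {p q} → p ≢ 0ℚ → p ℚ.* q ≡ 0ℚ → q ≡ 0ℚ
ℚ-*-cancelˡ-0 {p} {q} p≢0 eq = begin
  q                       ≡⟨ ℚ.*-identityˡ q ⟨
  1ℚ ℚ.* q                ≡⟨ ≡.cong (ℚ._* q) (ℚ.*-inverseˡ p) ⟨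
  ℚ.1/ p ℚ.* p ℚ.* q      ≡⟨ ℚ.*-assoc (ℚ.1/ p) p q ⟩
  ℚ.1/ p ℚ.* (p ℚ.* q)    ≡⟨ ≡.cong (ℚ.1/ p ℚ.*_) eq ⟩
  ℚ.1/ p ℚ.* 0ℚ           ≡⟨ ℚ.*-zeroʳ (ℚ.1/ p) ⟩
  0ℚ                      ∎
  where
  open ≡.≡-Reasoning
  instance _ = ℚ.≢-nonZero p≢0

module _ (R : Ring 0ℓ 0ℓ) where
  open Ring R
  open SetoidReasoning setoid

  private
    module ℚ→R {f : ℚ → Carrier} (f-hom : Hom (CommutativeRing.ring ℚ-ring) R f) =
      RingMorphisms.IsRingHomomorphism f-hom

  module _ {f g : ℚ → Carrier} (f-hom : Hom (CommutativeRing.ring ℚ-ring) R f)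
           (g-hom : Hom (CommutativeRing.ring ℚ-ring) R g) where
    private
      module f = ℚ→R f-hom
      module g = ℚ→R g-hom
      module ι = RingMorphisms.IsRingHomomorphism ℤ→ℚ-hom

    ℕ-agree : ∀ n → f (ℚ.fromℤ (+ n)) ≈ g (ℚ.fromℤ (+ n))
    ℕ-agree zero    = trans f.0#-homo (sym g.0#-homo)
    ℕ-agree (suc n) = begin
      f (ℚ.fromℤ (+ suc n))                  ≡⟨ ≡.cong f (ι.+-homo (+ 1) (+ n)) ⟩
      f (1ℚ ℚ.+ ℚ.fromℤ (+ n))               ≈⟨ f.+-homo _ _ ⟩
      f 1ℚ + f (ℚ.fromℤ (+ n))               ≈⟨ +-cong (trans f.1#-homo (sym g.1#-homo)) (ℕ-agree n) ⟩
      g 1ℚ + g (ℚ.fromℤ (+ n))               ≈⟨ g.+-homo _ _ ⟨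
      g (1ℚ ℚ.+ ℚ.fromℤ (+ n))               ≡⟨ ≡.cong g (ι.+-homo (+ 1) (+ n)) ⟨
      g (ℚ.fromℤ (+ suc n))                  ∎

    ℤ-agree : ∀ n → f (ℚ.fromℤ n) ≈ g (ℚ.fromℤ n)
    ℤ-agree (+ n)    = ℕ-agree n
    ℤ-agree -[1+ n ] = begin
      f (ℚ.fromℤ -[1+ n ])         ≈⟨ f.-‿homo _ ⟩
      - f (ℚ.fromℤ (+ suc n))      ≈⟨ -‿cong (ℕ-agree (suc n)) ⟩
      - g (ℚ.fromℤ (+ suc n))      ≈⟨ g.-‿homo _ ⟨
      g (ℚ.fromℤ -[1+ n ])         ∎

    -- Homomorphisms agree on ℤ, and the image of a denominator is invertible. Hence an embedding,
    -- required only to be a ring homomorphism, respects rational scalars.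
    ℚ-agree : ∀ q → f q ≈ g q
    ℚ-agree q = begin
      f q                                ≈⟨ *-identityˡ _ ⟨
      1# * f q                           ≈⟨ *-congʳ (inverse g-hom) ⟨
      g (ℚ.1/ D) * g D * f q             ≈⟨ *-assoc _ _ _ ⟩
      g (ℚ.1/ D) * (g D * f q)           ≈⟨ *-congˡ (*-congʳ (ℤ-agree (ℚ.denominator q))) ⟨
      g (ℚ.1/ D) * (f D * f q)           ≈⟨ *-congˡ (numerator f-hom) ⟩
      g (ℚ.1/ D) * f (ℚ.fromℤ (ℚ.numerator q)) ≈⟨ *-congˡ (ℤ-agree (ℚ.numerator q)) ⟩
      g (ℚ.1/ D) * g (ℚ.fromℤ (ℚ.numerator q)) ≈⟨ *-congˡ (numerator g-hom) ⟨
      g (ℚ.1/ D) * (g D * g q)           ≈⟨ *-assoc _ _ _ ⟨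
      g (ℚ.1/ D) * g D * g q             ≈⟨ *-congʳ (inverse g-hom) ⟩
      1# * g q                           ≈⟨ *-identityˡ _ ⟩
      g q                                ∎
      where
      D : ℚ
      D = ℚ.fromℤ (ℚ.denominator q)
      module _ {h : ℚ → Carrier} (h-hom : Hom (CommutativeRing.ring ℚ-ring) R h) where
        private module h = ℚ→R h-hom
        numerator : h D * h q ≈ h (ℚ.fromℤ (ℚ.numerator q))
        numerator = trans (sym (h.*-homo _ _)) (h.⟦⟧-cong (denominator-* q))
        inverse : h (ℚ.1/ D) * h D ≈ 1#
        inverse = trans (sym (h.*-homo _ _)) (trans (h.⟦⟧-cong (ℚ.*-inverseˡ D)) h.1#-homo)

module QuadraticEmbeddings (B : ℚ-Algebra) (d : ℚ) where
  open Algebra B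
  open SetoidReasoning setoid
  open Unit
  private
    module K = Algebra ℚ[√ d ]
    module ℚR = CommutativeRing ℚ-ring

  √d : K.Carrier
  √d = 0ℚ , 1ℚ

  √d² : √d K.* √d K.≈ K.scalar d
  √d² = +-*-Solver.solve 1 (λ d → con 0ℚ :* con 0ℚ :+ d :* (con 1ℚ :* con 1ℚ) := d) ≡.refl d ,
        ≡.refl
    where open +-*-Solver

  K-decompose : ∀ x y → (x , y) K.≈ (K.scalar x K.+ K.scalar y K.* √d)
  K-decompose x y =
    +-*-Solver.solve 3 (λ d x y → x := x :+ (y :* con 0ℚ :+ d :* (con 0ℚ :* con 1ℚ))) ≡.refl d x y ,
    +-*-Solver.solve 2 (λ x y → y := con 0ℚ :+ (y :* con 1ℚ :+ con 0ℚ :* con 0ℚ)) ≡.refl x y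
    where open +-*-Solver

  module _ (ψ : Embedding K.ring ring) where
    private module ψ = Embedding ψ

    embedding-scalar : ∀ q → ψ.⟦ K.scalar q ⟧ ≈ scalar q
    embedding-scalar = ℚ-agree ring (∘-hom ℚR.ring K.ring ring ψ.isRingHomomorphism K.scalar-hom) scalar-hom

    embedding-√d² : ψ.⟦ √d ⟧ * ψ.⟦ √d ⟧ ≈ scalar d
    embedding-√d² = trans (sym (ψ.*-homo _ _)) (trans (ψ.⟦⟧-cong √d²) (embedding-scalar d))

    embedding-decompose : ∀ x y → ψ.⟦ x , y ⟧ ≈ scalar x + scalar y * ψ.⟦ √d ⟧
    embedding-decompose x y = trans (ψ.⟦⟧-cong (K-decompose x y)) (trans (ψ.+-homo _ _)
      (+-cong (embedding-scalar x) (trans (ψ.*-homo _ _) (*-congʳ (embedding-scalar y)))))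

    centralizer-embedding :
      (∀ t → t * t ≈ scalar d → ∀ γ → γ * t ≈ t * γ → ∃₂ λ x y → γ ≈ scalar x + scalar y * t) →
      ∀ γ → (∀ k → γ * ψ.⟦ k ⟧ ≈ ψ.⟦ k ⟧ * γ) → ∃ λ k → γ ≈ ψ.⟦ k ⟧
    centralizer-embedding centralizer γ commutes = (proj₁ xy , proj₁ (proj₂ xy)) ,
      trans (proj₂ (proj₂ xy)) (sym (embedding-decompose (proj₁ xy) (proj₁ (proj₂ xy))))
      where
      xy : ∃₂ λ x y → γ ≈ scalar x + scalar y * ψ.⟦ √d ⟧
      xy = centralizer ψ.⟦ √d ⟧ embedding-√d² γ (commutes √d)

  intertwines : ∀ (ψ φ : Embedding K.ring ring) β → β * Embedding.⟦_⟧ φ √d ≈ Embedding.⟦_⟧ ψ √d * β →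
    ∀ k → β * Embedding.⟦_⟧ φ k ≈ Embedding.⟦_⟧ ψ k * β
  intertwines ψ φ β eq (x , y) = begin
    β * φ.⟦ x , y ⟧                              ≈⟨ *-congˡ (embedding-decompose φ x y) ⟩
    β * (scalar x + scalar y * φ.⟦ √d ⟧)         ≈⟨ distribˡ _ _ _ ⟩
    β * scalar x + β * (scalar y * φ.⟦ √d ⟧)     ≈⟨ +-cong (sym (scalar-central x β)) (*-scalar B y β _) ⟩
    scalar x * β + scalar y * (β * φ.⟦ √d ⟧)     ≈⟨ +-congˡ (*-congˡ eq) ⟩
    scalar x * β + scalar y * (ψ.⟦ √d ⟧ * β)     ≈⟨ +-congˡ (*-assoc _ _ _) ⟨
    scalar x * β + scalar y * ψ.⟦ √d ⟧ * β       ≈⟨ distribʳ _ _ _ ⟨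
    (scalar x + scalar y * ψ.⟦ √d ⟧) * β         ≈⟨ *-congʳ (embedding-decompose ψ x y) ⟨
    ψ.⟦ x , y ⟧ * β                              ∎
    where
    module ψ = Embedding ψ
    module φ = Embedding φ

  module _
    (unit? : ∀ x → x ≈ 0# ⊎ ∃ λ (u : Unit ring) → value u ≈ x)
    (e₁ e₂ : Carrier) (scalar-of-commuting : ∀ s → s * e₁ ≈ e₁ * s → s * e₂ ≈ e₂ * s → ∃ λ x → s ≈ scalar x)
    (non-square : ∀ x → ¬ scalar x * scalar x ≈ scalar d)
    where

    module _ (φ ψ : Embedding K.ring ring) where
      private
        module φ = Embedding φ
        module ψ = Embedding ψ
        s t : Carrier
        s = ψ.⟦ √d ⟧
        t = φ.⟦ √d ⟧
        -- If this vanishes for y = 1, then t = - s, and it is s y - y s.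
        intertwiner : Carrier → Carrier
        intertwiner y = s * y + y * t
        -- Both sides are `s y t + d y`, because `s² = t² = d`.
        intertwiner-intertwines : ∀ y → intertwiner y * t ≈ s * intertwiner y
        intertwiner-intertwines y = begin
          (s * y + y * t) * t           ≈⟨ distribʳ _ _ _ ⟩
          s * y * t + y * t * t         ≈⟨ +-congˡ (trans (*-assoc _ _ _) (*-congˡ (embedding-√d² φ))) ⟩
          s * y * t + y * scalar d      ≈⟨ +-cong (*-assoc _ _ _) (sym (scalar-central d y)) ⟩
          s * (y * t) + scalar d * y    ≈⟨ +-congˡ (trans (sym (*-assoc _ _ _)) (*-congʳ (embedding-√d² ψ))) ⟨
          s * (y * t) + s * (s * y)     ≈⟨ +-comm _ _ ⟩
          s * (s * y) + s * (y * t)     ≈⟨ distribˡ _ _ _ ⟨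
          s * (s * y + y * t)           ∎
        result : ∀ y → (∃ λ (u : Unit ring) → value u ≈ intertwiner y) → ∃ λ (β : Unit ring) →
          ∀ k → value β * φ.⟦ k ⟧ ≈ ψ.⟦ k ⟧ * value β
        result y (u , u≈) = u , intertwines ψ φ (value u)
          (trans (*-congʳ u≈) (trans (intertwiner-intertwines y) (*-congˡ (sym u≈))))
        open RingProperties ring
        commutes : intertwiner 1# ≈ 0# → ∀ y → intertwiner y ≈ 0# → s * y ≈ y * s
        commutes eq₁ y eq = begin
          s * y                       ≈⟨ +-identityʳ _ ⟨
          s * y + 0#                  ≈⟨ +-congˡ (trans (*-congˡ t+s≈0) (zeroʳ y)) ⟨
          s * y + y * (t + s)         ≈⟨ +-congˡ (distribˡ _ _ _) ⟩
          s * y + (y * t + y * s)     ≈⟨ +-assoc _ _ _ ⟨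
          s * y + y * t + y * s       ≈⟨ +-congʳ eq ⟩
          0# + y * s                  ≈⟨ +-identityˡ _ ⟩
          y * s                       ∎
          where
          t+s≈0 : t + s ≈ 0#
          t+s≈0 = trans (+-comm t s) (trans (sym (+-cong (*-identityʳ s) (*-identityˡ t))) eq₁)
        not-scalar : ∀ {x} → ¬ s ≈ scalar x
        not-scalar {x} s≈x = non-square x (trans (*-cong (sym s≈x) (sym s≈x)) (embedding-√d² ψ))

      -- Three values of `y` suffice. If the intertwiner vanishes at 1, `e₁` and `e₂`, then `s`
      -- commutes with `e₁` and `e₂` and is a scalar with square `d`, which is impossible. Any
      -- non-zero value is a unit.
      skolem-noether : ∃ λ (β : Unit ring) → ∀ k → value β * φ.⟦ k ⟧ ≈ ψ.⟦ k ⟧ * value β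
      skolem-noether with unit? (intertwiner 1#) | unit? (intertwiner e₁) | unit? (intertwiner e₂)
      ... | inj₂ u | _      | _      = result 1# u
      ... | inj₁ _ | inj₂ u | _      = result e₁ u
      ... | inj₁ _ | inj₁ _ | inj₂ u = result e₂ u
      ... | inj₁ z | inj₁ z₁ | inj₁ z₂ = contradiction
        (proj₂ (scalar-of-commuting s (commutes z e₁ z₁) (commutes z e₂ z₂))) not-scalar

module ScaledInverse (B : ℚ-Algebra) where
  open Algebra B
  open SetoidReasoning setoid

  scaled-inverse : ∀ {x y q} → q ≢ 0ℚ → x * y ≈ scalar q → y * x ≈ scalar q → ∃ λ (u : Unit ring) → Unit.value u ≈ x
  scaled-inverse {x} {y} {q} q≢0 xy≈ yx≈ = record
    { value = x ; inv = scalar (ℚ.1/ q) * y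
    ; inverseˡ = trans (*-assoc _ _ _) (trans (*-congˡ yx≈) 1/q*q)
    ; inverseʳ = trans (*-scalar B _ _ _) (trans (*-congˡ xy≈) 1/q*q) } , refl
    where
    instance _ = ℚ.≢-nonZero q≢0
    1/q*q : scalar (ℚ.1/ q) * scalar q ≈ 1#
    1/q*q = trans (sym (scalar.*-homo _ _)) (trans (scalar.⟦⟧-cong (ℚ.*-inverseˡ q)) scalar.1#-homo)

-- Definite rational quaternions

module RationalQuaternions (a b : ℚ) (a≢0 : a ≢ 0ℚ) (b≢0 : b ≢ 0ℚ) (definite : Definite a b) where
  open Algebra (quaternionAlgebra a b) hiding (zero)
  open Unit
  open QuaternionCoordinates ℚ-ring a b

  conjugate : Carrier → Carrier
  conjugate ((x , y) , (z , w)) = (x , ℚ.- y) , (ℚ.- z , ℚ.- w)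

  private
    nrd : Carrier → ℚ
    nrd = Quaternion.reducedNorm ℚ-ring a b

  opaque
    *-conjugate : ∀ x → x * conjugate x ≈ scalar (nrd x)
    *-conjugate ((x , y) , (z , w)) =
      ( solve 6 (λ a b x y z w →
          (x :* x :+ a :* (y :* (:- y))) :+
          (b :* (z :* (:- z) :+ a :* (w :* (:- (:- w)))) :+ a :* (con 0ℚ :* (z :* (:- (:- w)) :+ w :* (:- z)))) :=
          (x :* x :- a :* (y :* y)) :- b :* (z :* z :- a :* (w :* w))) ≡.refl a b x y z w
      , solve 6 (λ a b x y z w →
          (x :* (:- y) :+ y :* x) :+
          (b :* (z :* (:- (:- w)) :+ w :* (:- z)) :+ con 0ℚ :* (z :* (:- z) :+ a :* (w :* (:- (:- w))))) := con 0ℚ)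
          ≡.refl a b x y z w ) ,
      ( solve 5 (λ a x y z w →
          (x :* (:- z) :+ a :* (y :* (:- w))) :+ (z :* x :+ a :* (w :* (:- (:- y)))) := con 0ℚ) ≡.refl a x y z w
      , solve 4 (λ x y z w →
          (x :* (:- w) :+ y :* (:- z)) :+ (z :* (:- (:- y)) :+ w :* x) := con 0ℚ) ≡.refl x y z w )
      where open +-*-Solver

    nrd-conjugate : ∀ x → nrd (conjugate x) ≡ nrd x
    nrd-conjugate ((x , y) , (z , w)) = solve 6 (λ a b x y z w →
      (x :* x :- a :* ((:- y) :* (:- y))) :- b :* ((:- z) :* (:- z) :- a :* ((:- w) :* (:- w))) :=
      (x :* x :- a :* (y :* y)) :- b :* (z :* z :- a :* (w :* w))) ≡.refl a b x y z w
      where open +-*-Solver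

    conjugate-involutive : ∀ x → conjugate (conjugate x) ≈ x
    conjugate-involutive ((x , y) , (z , w)) = (≡.refl , neg y) , (neg z , neg w)
      where
      neg : ∀ q → ℚ.- (ℚ.- q) ≡ q
      neg q = solve 1 (λ q → :- (:- q) := q) ≡.refl q
        where open +-*-Solver

    conjugate-* : ∀ x → conjugate x * x ≈ scalar (nrd x)
    conjugate-* x = trans {conjugate x * x} {conjugate x * conjugate (conjugate x)} {scalar (nrd x)}
      (*-congˡ {conjugate x} {x} {conjugate (conjugate x)} (sym {conjugate (conjugate x)} {x} (conjugate-involutive x)))
      (trans {conjugate x * conjugate (conjugate x)} {scalar (nrd (conjugate x))} {scalar (nrd x)}
        (*-conjugate (conjugate x)) (scalar.⟦⟧-cong (nrd-conjugate x)))

  0? : ∀ x → x ≈ 0# ⊎ (¬ x ≈ 0#)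
  0? ((x , y) , (z , w)) with x ℚ.≟ 0ℚ | y ℚ.≟ 0ℚ | z ℚ.≟ 0ℚ | w ℚ.≟ 0ℚ
  ... | yes p | yes q | yes r | yes s = inj₁ ((p , q) , (r , s))
  ... | no ¬p | _     | _     | _     = inj₂ λ ((p , _) , _) → ¬p p
  ... | _     | no ¬p | _     | _     = inj₂ λ ((_ , p) , _) → ¬p p
  ... | _     | _     | no ¬p | _     = inj₂ λ (_ , (p , _)) → ¬p p
  ... | _     | _     | _     | no ¬p = inj₂ λ (_ , (_ , p)) → ¬p p

  opaque
    nrd≢0 : ∀ x → ¬ x ≈ 0# → nrd x ≢ 0ℚ
    nrd≢0 x x≉0 eq = ℚ.<⇒≢ {0ℚ} {nrd x} (definite x x≉0) (≡.sym eq)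

  opaque
    -- A definite quaternion algebra is a division algebra: the inverse is the conjugate divided by
    -- the non-zero reduced norm.
    unit? : ∀ x → x ≈ 0# ⊎ ∃ λ (u : Unit ring) → value u ≈ x
    unit? x = ⊎-map₂ (λ x≉0 → ScaledInverse.scaled-inverse (quaternionAlgebra a b) {x} {conjugate x} {nrd x}
      (nrd≢0 x x≉0) (*-conjugate x) (conjugate-* x)) (0? x)

  opaque
    -- The coordinates of `x y - y x` along i, j and ij are the 2 × 2 minors of the imaginary parts,
    -- up to sign and the non-zero factors 2 `b`, 2 `a` and 2. So the imaginary parts of commuting
    -- quaternions are linearly dependent.
    commuting-minors : ∀ x₀ x₁ x₂ x₃ y₀ y₁ y₂ y₃ → let x = (x₀ , x₁) , (x₂ , x₃) ; y = (y₀ , y₁) , (y₂ , y₃) in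
      x * y ≈ y * x → x₁ ℚ.* y₂ ≡ x₂ ℚ.* y₁ × x₁ ℚ.* y₃ ≡ x₃ ℚ.* y₁ × x₂ ℚ.* y₃ ≡ x₃ ℚ.* y₂
    commuting-minors x₀ x₁ x₂ x₃ y₀ y₁ y₂ y₃ ((_ , eq₁) , (eq₂ , eq₃)) =
      difference (ℚ-*-cancelˡ-0 {2ℚ} (λ ()) (≡.trans
        (solve 8 (λ x₀ x₁ x₂ x₃ y₀ y₁ y₂ y₃ → con 2ℚ :* (x₁ :* y₂ :- x₂ :* y₁) :=
          ((x₀ :* y₃ :+ x₁ :* y₂) :+ (x₂ :* (:- y₁) :+ x₃ :* y₀)) :-
          ((y₀ :* x₃ :+ y₁ :* x₂) :+ (y₂ :* (:- x₁) :+ y₃ :* x₀))) ≡.refl x₀ x₁ x₂ x₃ y₀ y₁ y₂ y₃)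
        (vanishes eq₃))) ,
      difference (ℚ-*-cancelˡ-0 {2ℚ} (λ ()) (ℚ-*-cancelˡ-0 {a} a≢0 (≡.trans
        (solve 9 (λ a x₀ x₁ x₂ x₃ y₀ y₁ y₂ y₃ → a :* (con 2ℚ :* (x₁ :* y₃ :- x₃ :* y₁)) :=
          ((x₀ :* y₂ :+ a :* (x₁ :* y₃)) :+ (x₂ :* y₀ :+ a :* (x₃ :* (:- y₁)))) :-
          ((y₀ :* x₂ :+ a :* (y₁ :* x₃)) :+ (y₂ :* x₀ :+ a :* (y₃ :* (:- x₁))))) ≡.refl a x₀ x₁ x₂ x₃ y₀ y₁ y₂ y₃)
        (vanishes eq₂)))) ,
      ≡.sym (difference (ℚ-*-cancelˡ-0 {2ℚ} (λ ()) (ℚ-*-cancelˡ-0 {b} b≢0 (≡.trans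
        (solve 10 (λ a b x₀ x₁ x₂ x₃ y₀ y₁ y₂ y₃ → b :* (con 2ℚ :* (x₃ :* y₂ :- x₂ :* y₃)) :=
          ((x₀ :* y₁ :+ x₁ :* y₀) :+ (b :* (x₂ :* (:- y₃) :+ x₃ :* y₂) :+ con 0ℚ :* (x₂ :* y₂ :+ a :* (x₃ :* (:- y₃))))) :-
          ((y₀ :* x₁ :+ y₁ :* x₀) :+ (b :* (y₂ :* (:- x₃) :+ y₃ :* x₂) :+ con 0ℚ :* (y₂ :* x₂ :+ a :* (y₃ :* (:- x₃))))))
          ≡.refl a b x₀ x₁ x₂ x₃ y₀ y₁ y₂ y₃)
        (vanishes eq₁)))))
      where
      open +-*-Solver
      2ℚ : ℚ
      2ℚ = 1ℚ ℚ.+ 1ℚ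
      vanishes : ∀ {p q} → p ≡ q → p ℚ.- q ≡ 0ℚ
      vanishes {p} ≡.refl = ℚ.+-inverseʳ p
      difference : ∀ {p q} → p ℚ.- q ≡ 0ℚ → p ≡ q
      difference {p} {q} eq = ≡.trans (solve 2 (λ p q → p := (p :- q) :+ q) ≡.refl p q)
        (≡.trans (≡.cong (ℚ._+ q) eq) (ℚ.+-identityˡ q))

  e₁ e₂ : Carrier
  e₁ = (0ℚ , 1ℚ) , (0ℚ , 0ℚ)
  e₂ = (0ℚ , 0ℚ) , (1ℚ , 0ℚ)

  opaque
    -- `e₁` and `e₂` are i and j; against them the minors become the imaginary coordinates of `s`.
    scalar-of-commuting : ∀ s → s * e₁ ≈ e₁ * s → s * e₂ ≈ e₂ * s → ∃ λ x → s ≈ scalar x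
    scalar-of-commuting ((x₀ , x₁) , (x₂ , x₃)) c₁ c₂ = x₀ , (≡.refl , x₁≡0) , (x₂≡0 , x₃≡0)
      where
      vanish : ∀ p {q} → p ℚ.* 0ℚ ≡ q ℚ.* 1ℚ → q ≡ 0ℚ
      vanish p {q} eq = ≡.trans (≡.sym (ℚ.*-identityʳ q)) (≡.trans (≡.sym eq) (ℚ.*-zeroʳ p))
      x₁≡0 : x₁ ≡ 0ℚ
      x₁≡0 = vanish x₂ (≡.sym (proj₁ (commuting-minors x₀ x₁ x₂ x₃ 0ℚ 0ℚ 1ℚ 0ℚ c₂)))
      x₂≡0 : x₂ ≡ 0ℚ
      x₂≡0 = vanish x₁ (proj₁ (commuting-minors x₀ x₁ x₂ x₃ 0ℚ 1ℚ 0ℚ 0ℚ c₁))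
      x₃≡0 : x₃ ≡ 0ℚ
      x₃≡0 = vanish x₁ (proj₁ (proj₂ (commuting-minors x₀ x₁ x₂ x₃ 0ℚ 1ℚ 0ℚ 0ℚ c₁)))

  opaque
    scalar-square : ∀ {d} → NonSquare d → ∀ x → ¬ scalar x * scalar x ≈ scalar d
    scalar-square nonsquare x eq = nonsquare x (proj₁ (proj₁
      (trans {scalar (x ℚ.* x)} {scalar x * scalar x} (scalar.*-homo x x) eq)))

  private
    divideℚ : ∀ (q : ℚ) {p} → p ≢ 0ℚ → ℚ
    divideℚ q {p} p≢0 = q ℚ.* ℚ.1/ p
      where instance _ = ℚ.≢-nonZero p≢0

    divideℚ-* : ∀ {p q r s} (p≢0 : p ≢ 0ℚ) → q ℚ.* r ≡ s ℚ.* p → s ≡ divideℚ q p≢0 ℚ.* r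
    divideℚ-* {p} {q} {r} {s} p≢0 eq = begin
      s                         ≡⟨ ℚ.*-identityʳ s ⟨
      s ℚ.* 1ℚ                  ≡⟨ ≡.cong (s ℚ.*_) (ℚ.*-inverseʳ p) ⟨
      s ℚ.* (p ℚ.* ℚ.1/ p)      ≡⟨ ℚ.*-assoc s p (ℚ.1/ p) ⟨
      s ℚ.* p ℚ.* ℚ.1/ p        ≡⟨ ≡.cong (ℚ._* ℚ.1/ p) eq ⟨
      q ℚ.* r ℚ.* ℚ.1/ p        ≡⟨ solve 3 (λ q r p → q :* r :* p := q :* p :* r) ≡.refl q r (ℚ.1/ p) ⟩
      q ℚ.* ℚ.1/ p ℚ.* r        ∎
      where
      open ≡.≡-Reasoning
      open +-*-Solver
      instance _ = ℚ.≢-nonZero p≢0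

  opaque
    combination : ∀ y g₀ g₁ g₂ g₃ t₀ t₁ t₂ t₃ → g₁ ≡ y ℚ.* t₁ → g₂ ≡ y ℚ.* t₂ → g₃ ≡ y ℚ.* t₃ →
      ∃₂ λ x y → ((g₀ , g₁) , (g₂ , g₃)) ≈ scalar x + scalar y * ((t₀ , t₁) , (t₂ , t₃))
    combination y g₀ g₁ g₂ g₃ t₀ t₁ t₂ t₃ p q r = x , y ,
      trans {(g₀ , g₁) , (g₂ , g₃)} {scalar x + ((y ℚ.* t₀ , y ℚ.* t₁) , (y ℚ.* t₂ , y ℚ.* t₃))} {scalar x + scalar y * t}
        ((solve 2 (λ g z → g := (g :- z) :+ z) ≡.refl g₀ (y ℚ.* t₀) , 0+ p) , (0+ q , 0+ r))
        (+-congˡ {scalar x} {(y ℚ.* t₀ , y ℚ.* t₁) , (y ℚ.* t₂ , y ℚ.* t₃)} {scalar y * t}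
          (sym {scalar y * t} {(y ℚ.* t₀ , y ℚ.* t₁) , (y ℚ.* t₂ , y ℚ.* t₃)} (scalar-coordinates y t₀ t₁ t₂ t₃)))
      where
      open +-*-Solver
      x : ℚ
      x = g₀ ℚ.- y ℚ.* t₀
      t : Carrier
      t = (t₀ , t₁) , (t₂ , t₃)
      0+ : ∀ {p q} → p ≡ q → p ≡ 0ℚ ℚ.+ q
      0+ {p} ≡.refl = ≡.sym (ℚ.+-identityˡ p)

  opaque
    -- The imaginary part of `t` is not zero, since `d` is not a square. Dividing by one of its
    -- non-zero coordinates, the minors show that the imaginary part of `g` is a multiple of that of
    -- `t`.
    centralizer : ∀ {d} → NonSquare d → ∀ t → t * t ≈ scalar d → ∀ g → g * t ≈ t * g →
      ∃₂ λ x y → g ≈ scalar x + scalar y * t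
    centralizer {d} nonsquare t@((t₀ , t₁) , (t₂ , t₃)) t² g@((g₀ , g₁) , (g₂ , g₃)) gt≈tg
      with commuting-minors g₀ g₁ g₂ g₃ t₀ t₁ t₂ t₃ gt≈tg | t₁ ℚ.≟ 0ℚ | t₂ ℚ.≟ 0ℚ | t₃ ℚ.≟ 0ℚ
    ... | m₁₂ , m₁₃ , m₂₃ | no t₁≢0 | _ | _ =
      combination (divideℚ g₁ t₁≢0) g₀ g₁ g₂ g₃ t₀ t₁ t₂ t₃
        (divideℚ-* {q = g₁} {t₁} {g₁} t₁≢0 ≡.refl) (divideℚ-* {q = g₁} {t₂} {g₂} t₁≢0 m₁₂) (divideℚ-* {q = g₁} {t₃} {g₃} t₁≢0 m₁₃)
    ... | m₁₂ , m₁₃ , m₂₃ | yes _ | no t₂≢0 | _ =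
      combination (divideℚ g₂ t₂≢0) g₀ g₁ g₂ g₃ t₀ t₁ t₂ t₃
        (divideℚ-* {q = g₂} {t₁} {g₁} t₂≢0 (≡.sym m₁₂)) (divideℚ-* {q = g₂} {t₂} {g₂} t₂≢0 ≡.refl) (divideℚ-* {q = g₂} {t₃} {g₃} t₂≢0 m₂₃)
    ... | m₁₂ , m₁₃ , m₂₃ | yes _ | yes _ | no t₃≢0 =
      combination (divideℚ g₃ t₃≢0) g₀ g₁ g₂ g₃ t₀ t₁ t₂ t₃
        (divideℚ-* {q = g₃} {t₁} {g₁} t₃≢0 (≡.sym m₁₃)) (divideℚ-* {q = g₃} {t₂} {g₂} t₃≢0 (≡.sym m₂₃)) (divideℚ-* {q = g₃} {t₃} {g₃} t₃≢0 ≡.refl)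
    ... | _ | yes t₁≡0 | yes t₂≡0 | yes t₃≡0 = contradiction
      (trans {scalar t₀ * scalar t₀} {t * t} (*-cong {scalar t₀} {t} {scalar t₀} {t} t₀≈t t₀≈t) t²) (scalar-square nonsquare t₀)
      where
      t₀≈t : scalar t₀ ≈ t
      t₀≈t = (≡.refl , ≡.sym t₁≡0) , (≡.sym t₂≡0 , ≡.sym t₃≡0)

proposition1p4 : (a b : ℚ) → a ≢ 0ℚ → b ≢ 0ℚ → Definite a b →
    (R : Order (quaternionAlgebra a b)) →
    (d : ℚ) → NonSquare d →
    (i : Embedding (Algebra.ring ℚ[√ d ]) (Algebra.ring (quaternionAlgebra a b))) →
    (O : Order ℚ[√ d ]) (D : ℤ) → HasDiscriminant d O D →
    Bijection (specialPointClasses a b R d O) (O-points a b R d O i)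
proposition1p4 a b a≢0 b≢0 definite R d nonsquare i O _ _ =
  LocalGlobal.bijection (quaternionAlgebra a b)
    -- Not Completion.algebra/A itself: Algebra.ring of this literal reduces when
    -- the type is instantiated, as the syntactic comparison requires.
    (record
      { ring           = Algebra.ring (Completion.algebra Ẑ a b)
      ; scalar         = Algebra.scalar (Completion.algebra/A Ẑ a b)
      ; scalar-hom     = Algebra.scalar-hom (Completion.algebra/A Ẑ a b)
      ; scalar-central = Algebra.scalar-central (Completion.algebra/A Ẑ a b) })
    C.W (Completion.include Ẑ a b) (Completion.include-hom Ẑ a b) C.include-scalar
    (λ ℓ → Completion.include ℤ[ ℓ ] a b) C.π C.π-hom C.π-scalar C.π-include (λ {x} {y} → C.π-injective {x} {y})
    C.Λ (λ {v} → C.Λ-saturated {v}) C.Λ-bounded R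
    (Completion.complete Ẑ a b (Order.lattice R)) (λ x∈ → x∈) (λ x∈ → x∈)
    (IsLeftIdeal a b R d O) (λ _ principal → principal) (λ _ principal → principal) ℚ[√ d ] O i
    (∘-hom (Algebra.ring ℚ[√ d ]) (Algebra.ring (quaternionAlgebra a b)) (Algebra.ring (Completion.algebra Ẑ a b))
      (Completion.include-hom Ẑ a b)
      (RingMorphisms.IsRingMonomorphism.isRingHomomorphism (Embedding.isRingMonomorphism i)))
    (CommutativeRing.*-comm (Quadratic.commutativeRing ℚ-ring d))
    (E.skolem-noether H.unit? H.e₁ H.e₂ H.scalar-of-commuting (H.scalar-square nonsquare) i)
    (E.centralizer-embedding i (H.centralizer nonsquare))
  where
  module C = Completions a b
  module H = RationalQuaternions a b a≢0 b≢0 definite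
  module E = QuadraticEmbeddings (quaternionAlgebra a b) d
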